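{- The entailment problem for QPL (given a finite set $\mathcal H$ of formulas and a formula $Q$, decide whether $\mathcal H\vdash Q$) is solvable in time $O(n^n)$, where $n$ is the total length of the formulas in $S=\mathcal H\cup\{Q\}$. In the case that the number of quantifications in $S$ is bounded, the QPL entailment problem is solvable in polynomial time.
   Context: Language: first-order, no equality, no function symbols of positive arity; terms are variables and constants; atomic formulas $\top,\bot,R(t_1,\dots,t_j)$; formulas (strings; length = number of symbol occurrences) built by $\land,\lor,\to,\forall x,\exists x$; $A(t)$ is substitution of substitutable $t$ for free $x$. QPL is the Hilbert-style calculus with rules (premises / conclusion): axioms $\top$ and $A\to A$; $A,B/A\land B$; $A\land B/A$, $A\land B/B$; $A/A\lor B$, $B/A\lor B$; $A\lor A/A$; $B/A\to B$; $A,A\to B/B$; $\bot/A$; $A/\forall xA$ ($x$ not free in $A$); $\forall xA(x)/A(t)$; $A(t)/\exists xA(x)$; $\exists xA/A$ ($x$ not free in $A$). $\mathcal H\vdash Q$ means there is a finite derivation tree of $Q$ whose leaves are axioms or members of $\mathcal H$. Time is measured in the standard computation model of the analysis of algorithms. -}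

module Defs where

open import Data.Nat using (ℕ; zero; suc; _+_; _*_; _∸_; _^_; _≤_; _≡ᵇ_)
open import Data.Nat.Properties using () renaming (_≟_ to _≟ℕ_)
open import Data.Bool using (Bool; true; false; if_then_else_; _∧_; _∨_; not)
open import Data.List using (List; []; _∷_; _++_; length; map; deduplicate)
open import Data.Nat.ListAction using (sum)
import Data.List.Properties as LP
open import Data.List.Membership.Propositional using (_∈_)
open import Data.List.Relation.Unary.Unique.Propositional using (Unique)
open import Data.Maybe using (Maybe; just; nothing)
open import Data.Product using (Σ; _×_; _,_)
open import Relation.Binary.PropositionalEquality using (_≡_; refl; cong; cong₂)
open import Relation.Nullary using (Dec; yes; no; ¬_)
open import Relation.Binary.Definitions using (DecidableEquality)

-- Syntax.  Variables x_i, constants c_i, relation symbols R_i (the arity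
-- of an atom R(t_1,...,t_j) is the length j of its argument list; a
-- symbol is thus the pair (i , j)).  No equality, no function symbols.

data Term : Set where
  var   : ℕ → Term
  const : ℕ → Term

data Formula : Set where
  TOP BOT : Formula
  atom    : ℕ → List Term → Formula
  and or imp : Formula → Formula → Formula
  all ex  : ℕ → Formula → Formula

-- number of symbol occurrences (Polish notation, no auxiliary symbols)
len : Formula → ℕ
len TOP          = 1
len BOT          = 1
len (atom r ts)  = suc (length ts)
len (and A B)    = suc (len A + len B)
len (or A B)     = suc (len A + len B)
len (imp A B)    = suc (len A + len B)
len (all x A)    = 2 + len A
len (ex x A)     = 2 + len A

quants : Formula → ℕ
quants TOP         = 0
quants BOT         = 0
quants (atom r ts) = 0
quants (and A B)   = quants A + quants B
quants (or A B)    = quants A + quants B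
quants (imp A B)   = quants A + quants B
quants (all x A)   = suc (quants A)
quants (ex x A)    = suc (quants A)

_≟T_ : DecidableEquality Term
var i ≟T var j with i ≟ℕ j
... | yes refl = yes refl
... | no ne = no λ { refl → ne refl }
var i ≟T const j = no λ ()
const i ≟T var j = no λ ()
const i ≟T const j with i ≟ℕ j
... | yes refl = yes refl
... | no ne = no λ { refl → ne refl }

_≟F_ : DecidableEquality Formula
TOP ≟F TOP = yes refl
BOT ≟F BOT = yes refl
atom r ts ≟F atom s us with r ≟ℕ s | LP.≡-dec _≟T_ ts us
... | yes refl | yes refl = yes refl
... | no ne | _ = no λ { refl → ne refl }
... | _ | no ne = no λ { refl → ne refl }
and A B ≟F and C D with A ≟F C | B ≟F D
... | yes refl | yes refl = yes refl
... | no ne | _ = no λ { refl → ne refl }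
... | _ | no ne = no λ { refl → ne refl }
or A B ≟F or C D with A ≟F C | B ≟F D
... | yes refl | yes refl = yes refl
... | no ne | _ = no λ { refl → ne refl }
... | _ | no ne = no λ { refl → ne refl }
imp A B ≟F imp C D with A ≟F C | B ≟F D
... | yes refl | yes refl = yes refl
... | no ne | _ = no λ { refl → ne refl }
... | _ | no ne = no λ { refl → ne refl }
all x A ≟F all y B with x ≟ℕ y | A ≟F B
... | yes refl | yes refl = yes refl
... | no ne | _ = no λ { refl → ne refl }
... | _ | no ne = no λ { refl → ne refl }
ex x A ≟F ex y B with x ≟ℕ y | A ≟F B
... | yes refl | yes refl = yes refl
... | no ne | _ = no λ { refl → ne refl }
... | _ | no ne = no λ { refl → ne refl }
TOP ≟F BOT = no λ ()
TOP ≟F atom _ _ = no λ ()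
TOP ≟F and _ _ = no λ ()
TOP ≟F or _ _ = no λ ()
TOP ≟F imp _ _ = no λ ()
TOP ≟F all _ _ = no λ ()
TOP ≟F ex _ _ = no λ ()
BOT ≟F TOP = no λ ()
BOT ≟F atom _ _ = no λ ()
BOT ≟F and _ _ = no λ ()
BOT ≟F or _ _ = no λ ()
BOT ≟F imp _ _ = no λ ()
BOT ≟F all _ _ = no λ ()
BOT ≟F ex _ _ = no λ ()
atom _ _ ≟F TOP = no λ ()
atom _ _ ≟F BOT = no λ ()
atom _ _ ≟F and _ _ = no λ ()
atom _ _ ≟F or _ _ = no λ ()
atom _ _ ≟F imp _ _ = no λ ()
atom _ _ ≟F all _ _ = no λ ()
atom _ _ ≟F ex _ _ = no λ ()
and _ _ ≟F TOP = no λ ()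
and _ _ ≟F BOT = no λ ()
and _ _ ≟F atom _ _ = no λ ()
and _ _ ≟F or _ _ = no λ ()
and _ _ ≟F imp _ _ = no λ ()
and _ _ ≟F all _ _ = no λ ()
and _ _ ≟F ex _ _ = no λ ()
or _ _ ≟F TOP = no λ ()
or _ _ ≟F BOT = no λ ()
or _ _ ≟F atom _ _ = no λ ()
or _ _ ≟F and _ _ = no λ ()
or _ _ ≟F imp _ _ = no λ ()
or _ _ ≟F all _ _ = no λ ()
or _ _ ≟F ex _ _ = no λ ()
imp _ _ ≟F TOP = no λ ()
imp _ _ ≟F BOT = no λ ()
imp _ _ ≟F atom _ _ = no λ ()
imp _ _ ≟F and _ _ = no λ ()
imp _ _ ≟F or _ _ = no λ ()
imp _ _ ≟F all _ _ = no λ ()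
imp _ _ ≟F ex _ _ = no λ ()
all _ _ ≟F TOP = no λ ()
all _ _ ≟F BOT = no λ ()
all _ _ ≟F atom _ _ = no λ ()
all _ _ ≟F and _ _ = no λ ()
all _ _ ≟F or _ _ = no λ ()
all _ _ ≟F imp _ _ = no λ ()
all _ _ ≟F ex _ _ = no λ ()
ex _ _ ≟F TOP = no λ ()
ex _ _ ≟F BOT = no λ ()
ex _ _ ≟F atom _ _ = no λ ()
ex _ _ ≟F and _ _ = no λ ()
ex _ _ ≟F or _ _ = no λ ()
ex _ _ ≟F imp _ _ = no λ ()
ex _ _ ≟F all _ _ = no λ ()

freeInT : ℕ → Term → Bool
freeInT x (var y)   = x ≡ᵇ y
freeInT x (const c) = false

anyB : (Term → Bool) → List Term → Bool
anyB p []       = false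
anyB p (t ∷ ts) = p t ∨ anyB p ts

freeIn : ℕ → Formula → Bool
freeIn x TOP         = false
freeIn x BOT         = false
freeIn x (atom r ts) = anyB (freeInT x) ts
freeIn x (and A B)   = freeIn x A ∨ freeIn x B
freeIn x (or A B)    = freeIn x A ∨ freeIn x B
freeIn x (imp A B)   = freeIn x A ∨ freeIn x B
freeIn x (all y A)   = not (x ≡ᵇ y) ∧ freeIn x A
freeIn x (ex y A)    = not (x ≡ᵇ y) ∧ freeIn x A

substT : ℕ → Term → Term → Term
substT x t (var y)   = if x ≡ᵇ y then t else var y
substT x t (const c) = const c

subst : ℕ → Term → Formula → Formula
subst x t TOP         = TOP
subst x t BOT         = BOT
subst x t (atom r ts) = atom r (map (substT x t) ts)
subst x t (and A B)   = and (subst x t A) (subst x t B)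
subst x t (or A B)    = or (subst x t A) (subst x t B)
subst x t (imp A B)   = imp (subst x t A) (subst x t B)
subst x t (all y A)   = if x ≡ᵇ y then all y A else all y (subst x t A)
subst x t (ex y A)    = if x ≡ᵇ y then ex y A else ex y (subst x t A)

substitutable : Term → ℕ → Formula → Bool
substitutable t x TOP         = true
substitutable t x BOT         = true
substitutable t x (atom r ts) = true
substitutable t x (and A B)   = substitutable t x A ∧ substitutable t x B
substitutable t x (or A B)    = substitutable t x A ∧ substitutable t x B
substitutable t x (imp A B)   = substitutable t x A ∧ substitutable t x B
substitutable t x (all y A)   =
  not (freeIn x (all y A)) ∨ (not (freeInT y t) ∧ substitutable t x A)
substitutable t x (ex y A)    =
  not (freeIn x (ex y A)) ∨ (not (freeInT y t) ∧ substitutable t x A)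

infix 4 _⊢_
data _⊢_ (H : List Formula) : Formula → Set where
  hyp   : ∀ {A} → A ∈ H → H ⊢ A
  axTop : H ⊢ TOP
  axId  : ∀ {A} → H ⊢ imp A A
  andI  : ∀ {A B} → H ⊢ A → H ⊢ B → H ⊢ and A B
  andE₁ : ∀ {A B} → H ⊢ and A B → H ⊢ A
  andE₂ : ∀ {A B} → H ⊢ and A B → H ⊢ B
  orI₁  : ∀ {A B} → H ⊢ A → H ⊢ or A B
  orI₂  : ∀ {A B} → H ⊢ B → H ⊢ or A B
  orC   : ∀ {A} → H ⊢ or A A → H ⊢ A
  impI  : ∀ {A B} → H ⊢ B → H ⊢ imp A B
  mp    : ∀ {A B} → H ⊢ A → H ⊢ imp A B → H ⊢ B
  botE  : ∀ {A} → H ⊢ BOT → H ⊢ A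
  allI  : ∀ {x A} → freeIn x A ≡ false → H ⊢ A → H ⊢ all x A
  allE  : ∀ {x A t} → substitutable t x A ≡ true → H ⊢ all x A → H ⊢ subst x t A
  exI   : ∀ {x A t} → substitutable t x A ≡ true → H ⊢ subst x t A → H ⊢ ex x A
  exE   : ∀ {x A} → freeIn x A ≡ false → H ⊢ ex x A → H ⊢ A

setS : List Formula → Formula → List Formula
setS H Q = deduplicate _≟F_ (Q ∷ H)

size : List Formula → Formula → ℕ
size H Q = sum (map len (setS H Q))

quantsS : List Formula → Formula → ℕ
quantsS H Q = sum (map quants (setS H Q))

-- Machine model: unit-cost RAM (registers indexed by ℕ, holding ℕ)

data Instr : Set where
  LOADI : ℕ → ℕ → Instr          -- R[r] := k
  ADD   : ℕ → ℕ → ℕ → Instr      -- R[r] := R[a] + R[b]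
  SUB   : ℕ → ℕ → ℕ → Instr      -- R[r] := R[a] ∸ R[b]
  LOAD  : ℕ → ℕ → Instr          -- R[r] := R[R[a]]
  STORE : ℕ → ℕ → Instr          -- R[R[a]] := R[r]
  JZ    : ℕ → ℕ → Instr          -- if R[r] = 0 then goto l
  JMP   : ℕ → Instr
  HALT  : Instr

Program : Set
Program = List Instr

Memory : Set
Memory = ℕ → ℕ

upd : Memory → ℕ → ℕ → Memory
upd m r v i = if i ≡ᵇ r then v else m i

fetch : Program → ℕ → Instr
fetch []       _       = HALT      -- falling off the program halts
fetch (i ∷ is) zero    = i
fetch (i ∷ is) (suc n) = fetch is n

-- run for at most `fuel` steps (each executed instruction, HALT
-- included, costs one step); `just m` = halted with final memory m
exec : Program → ℕ → ℕ → Memory → Maybe Memory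
exec P zero       pc m = nothing
exec P (suc fuel) pc m with fetch P pc
... | LOADI r k   = exec P fuel (suc pc) (upd m r k)
... | ADD r a b   = exec P fuel (suc pc) (upd m r (m a + m b))
... | SUB r a b   = exec P fuel (suc pc) (upd m r (m a ∸ m b))
... | LOAD r a    = exec P fuel (suc pc) (upd m r (m (m a)))
... | STORE a r   = exec P fuel (suc pc) (upd m (m a) (m r))
... | JZ r l      = if m r ≡ᵇ 0 then exec P fuel l m else exec P fuel (suc pc) m
... | JMP l       = exec P fuel l m
... | HALT        = just m

nth : List ℕ → ℕ → ℕ
nth []       _       = 0
nth (x ∷ xs) zero    = x
nth (x ∷ xs) (suc n) = nth xs n

initMem : List ℕ → Memory
initMem w zero    = length w
initMem w (suc i) = nth w i

-- Input encoding (Polish notation, one token per register)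
-- TOP 0, BOT 1, AND 2, OR 3, IMP 4, ALL 5, EX 6, SEP 7,
-- x_i ↦ 8+3i, c_i ↦ 9+3i, R_i of arity j ↦ 10+3i followed by j.

encT : Term → ℕ
encT (var i)   = 8 + 3 * i
encT (const i) = 9 + 3 * i

encF : Formula → List ℕ
encF TOP         = 0 ∷ []
encF BOT         = 1 ∷ []
encF (atom r ts) = (10 + 3 * r) ∷ length ts ∷ map encT ts
encF (and A B)   = 2 ∷ encF A ++ encF B
encF (or A B)    = 3 ∷ encF A ++ encF B
encF (imp A B)   = 4 ∷ encF A ++ encF B
encF (all x A)   = 5 ∷ encT (var x) ∷ encF A
encF (ex x A)    = 6 ∷ encT (var x) ∷ encF A

encList : List Formula → List ℕ
encList []       = []
encList (A ∷ As) = encF A ++ 7 ∷ encList As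

encode : List Formula → Formula → List ℕ
encode H Q = encList (Q ∷ H)

SolvesWithin : (List Formula → Formula → Set) → Program → (ℕ → ℕ) → Set
SolvesWithin Inst P T =
  ∀ (H : List Formula) (Q : Formula) → Unique H → Inst H Q →
  Σ Memory λ m → exec P (T (size H Q)) 0 (initMem (encode H Q)) ≡ just m
               × (H ⊢ Q → m 0 ≡ 1) × (m 0 ≡ 1 → H ⊢ Q)

AnyInstance : List Formula → Formula → Set
AnyInstance H Q = 0 ≡ 0

BoundedQuants : ℕ → List Formula → Formula → Set
BoundedQuants k H Q = quantsS H Q ≤ k

{-# OPTIONS --safe #-}
module Submission where

-- Derivations have a normal form without detours (introduction followed by elimination), so
-- H ⊢ Q can be decided among the instances of the subformulas of S = H ∪ {Q}. Terms that do not
-- occur in S can be replaced by one constant throughout a derivation, so it suffices to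
-- instantiate with the τ terms occurring in the atoms of S together with that constant. The rules of
-- the calculus between these formulas are Horn clauses, and there are O(n τ^q) of them, where q
-- is the number of quantifiers. Unit propagation is quadratic in the number of clauses up to a
-- polynomial factor in n, so everything takes O(n⁴ τ^(2q)) steps. As every quantifier
-- contributes 2 to n, we have τ + 2q ≤ n, which gives O(n^n) in general and O(n^(4+2k)) for q ≤ k.
--
-- The RAM program is compiled from a first-order functional language on trees of numbers.

open import Defs
open import Data.Nat using (ℕ; zero; suc; _+_; _*_; _∸_; _^_; _≤_; _<_; z≤n; s≤s; _≡ᵇ_; >-nonZero)
open import Data.Nat.Properties
open import Data.Nat.DivMod using (_/_; m*n/n≡m)
open import Data.Nat.ListAction using (sum)
open import Data.Nat.Tactic.RingSolver using (solve-∀)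
open import Data.Bool using (Bool; true; false; if_then_else_; _∧_; _∨_; not; T)
open import Data.Bool.ListAction using () renaming (all to every)
open import Data.List using (List; []; _∷_; _++_; length; map; concatMap; reverse; deduplicate; filter)
open import Data.List.Properties using (length-++; length-map; length-reverse; map-++; ++-assoc; reverse-involutive; unfold-reverse; filter-all)
open import Data.List.Membership.Propositional using (_∈_; _∉_)
open import Data.List.Membership.Propositional.Properties using (∈-++⁺ˡ; ∈-++⁺ʳ; ∈-++⁻)
open import Data.List.Membership.DecPropositional _≟T_ using (_∈?_)
open import Data.List.Relation.Binary.Subset.Propositional using (_⊆_)
open import Data.List.Relation.Unary.All using (All; []; _∷_; tabulate; universal)
open import Data.List.Relation.Unary.All.Properties using (++⁺; concat⁺; map⁺)
open import Data.List.Relation.Unary.AllPairs using ([]; _∷_)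
open import Data.List.Relation.Unary.Any using (here; there)
open import Data.List.Relation.Unary.Unique.Propositional using (Unique)
open import Data.Maybe using (Maybe; just; nothing)
open import Data.Product using (Σ; _×_; _,_; proj₁; proj₂)
open import Data.Sum using (_⊎_; inj₁; inj₂)
open import Data.Empty using (⊥; ⊥-elim)
open import Data.Unit using (⊤; tt)
open import Relation.Nullary using (yes; no; does; ¬_; ¬?)
open import Relation.Binary.PropositionalEquality using (_≡_; _≢_; refl; sym; trans; cong; cong₂) renaming (subst to transport)

-- Normalization is easy here because no rule discharges an assumption: an implication is introduced
-- from its conclusion or as `A → A`, a disjunction is eliminated only as `A ∨ A`, and the universal
-- formulas that can be introduced and the existential ones that can be eliminated are vacuous. So
-- each elimination merely inverts an introduction, and a predicate closed under introductions alone
-- can be shown to contain everything derivable. The obstacle is the exact bound: n^n leaves no room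
-- for a factor such as n^4 or for a larger base, so τ + 2q must not exceed n by even one. Two
-- things endanger this. The additional constant counts as a term; it is paid for by a symbol of the
-- goal that is not an argument. And a goal that is also a hypothesis counts once in n but would be
-- processed twice; hence membership of Q in H is tested, and answered, before any clause is
-- generated. The fourth power arises as n² from the work per clause and n² from squaring the number
-- O(n τ^q) of clauses. Compilation to the RAM costs a constant factor, because every call takes at
-- most as many steps as the program has instructions.

-- A functional language on trees of numbers and its cost semantics.

data Val : Set where
  num  : ℕ → Val
  pair : Val → Val → Val

data Op : Set where
  plus minus neq : Op

-- Truth is 0, the value on which ifz takes its first branch.
bit : Bool → ℕ
bit true  = 0
bit false = 1

⟦_⟧ : Op → ℕ → ℕ → ℕ
⟦ plus ⟧ i j  = i + j
⟦ minus ⟧ i j = i ∸ j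
⟦ neq ⟧ i j   = bit (i ≡ᵇ j)

infixr 4 _&_
data Expr : Set where
  arg     : Expr
  lit     : ℕ → Expr
  fst snd : Expr → Expr
  _&_     : Expr → Expr → Expr
  op      : Op → Expr → Expr → Expr
  ifz     : Expr → Expr → Expr → Expr
  bind    : Expr → Expr → Expr
  call    : Expr → Expr
  fix     : Expr → Expr → Expr

-- A pair counts as nonzero because it is represented by its address, which is at least 7.
caseZ : Val → Set → Set → Set
caseZ (num zero)    X Y = X
caseZ (num (suc _)) X Y = Y
caseZ (pair _ _)    X Y = Y

-- The cost counts calls only: the RAM steps between two calls are bounded by the program length.
data Eval : Expr → Expr → Val → Val → ℕ → Set where
  arg  : ∀ {B v} → Eval B arg v v 0
  lit  : ∀ {B v k} → Eval B (lit k) v (num k) 0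
  fst  : ∀ {B e v a b t} → Eval B e v (pair a b) t → Eval B (fst e) v a t
  snd  : ∀ {B e v a b t} → Eval B e v (pair a b) t → Eval B (snd e) v b t
  _&_  : ∀ {B e f v a b s t} → Eval B e v a s → Eval B f v b t → Eval B (e & f) v (pair a b) (s + t)
  op   : ∀ {B o e f v i j s t} → Eval B e v (num i) s → Eval B f v (num j) t →
         Eval B (op o e f) v (num (⟦ o ⟧ i j)) (s + t)
  ifz₀ : ∀ {B e f g v u s t} → Eval B e v (num 0) s → Eval B f v u t → Eval B (ifz e f g) v u (s + t)
  ifz₁ : ∀ {B e f g v w u s t} → caseZ w ⊥ ⊤ → Eval B e v w s → Eval B g v u t → Eval B (ifz e f g) v u (s + t)
  bind : ∀ {B e f v w u s t} → Eval B e v w s → Eval B f (pair w v) u t → Eval B (bind e f) v u (s + t)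
  call : ∀ {B e v w u s t} → Eval B e v w s → Eval B B w u t → Eval B (call e) v u (s + suc t)
  fix  : ∀ {B C e v w u s t} → Eval B e v w s → Eval C C w u t → Eval B (fix C e) v u (s + suc t)

-- The strict inequality pays for the call itself: a body of cost s contributes `suc s` to its
-- caller, and this is at most t.
Run : Expr → Val → Val → ℕ → Set
Run B v u t = Σ ℕ λ s → Eval B B v u s × s < t

fstW sndW : Val → (Val → Set) → Set
fstW (num _) X    = ⊥
fstW (pair a b) X = X a
sndW (num _) X    = ⊥
sndW (pair a b) X = X b

opW : Op → Val → Val → (Val → Set) → Set
opW o (num i) (num j) X = X (num (⟦ o ⟧ i j))
opW o _ _ X = ⊥

-- A weakest-precondition calculus. On a concrete program it computes to nested triples (result,
-- cost bound, run), one for each call executed, followed by the postcondition. The correctness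
-- proofs of programs below consist of exactly these triples, an equation and a cost estimate.
wp : Expr → Expr → Val → (Val → ℕ → Set) → Set
wp B arg          v X = X v 0
wp B (lit k)      v X = X (num k) 0
wp B (fst e)      v X = wp B e v λ w t → fstW w λ a → X a t
wp B (snd e)      v X = wp B e v λ w t → sndW w λ b → X b t
wp B (e & f)      v X = wp B e v λ a s → wp B f v λ b t → X (pair a b) (s + t)
wp B (op o e f)   v X = wp B e v λ a s → wp B f v λ b t → opW o a b λ w → X w (s + t)
wp B (ifz e f g)  v X = wp B e v λ w s →
  caseZ w (wp B f v λ u t → X u (s + t)) (wp B g v λ u t → X u (s + t))
wp B (bind e f)   v X = wp B e v λ w s → wp B f (pair w v) λ u t → X u (s + t)
wp B (call e)     v X = wp B e v λ w s → Σ Val λ u → Σ ℕ λ t → Run B w u t × X u (s + t)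
wp B (fix C e)    v X = wp B e v λ w s → Σ Val λ u → Σ ℕ λ t → Run C w u t × X u (s + t)

Holds : Expr → Expr → Val → (Val → ℕ → Set) → Set
Holds B e v X = Σ Val λ u → Σ ℕ λ s → Σ ℕ λ t → Eval B e v u s × s ≤ t × X u t

wp-sound : ∀ B e v X → wp B e v X → Holds B e v X
wp-sound B arg v X p = _ , _ , _ , arg , z≤n , p
wp-sound B (lit k) v X p = _ , _ , _ , lit , z≤n , p
wp-sound B (fst e) v X p with wp-sound B e v _ p
... | pair a b , _ , _ , d , le , q = _ , _ , _ , fst d , le , q
wp-sound B (snd e) v X p with wp-sound B e v _ p
... | pair a b , _ , _ , d , le , q = _ , _ , _ , snd d , le , q
wp-sound B (e & f) v X p with wp-sound B e v _ p
... | _ , _ , _ , d , le , q with wp-sound B f v _ q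
... | _ , _ , _ , d′ , le′ , r = _ , _ , _ , (d & d′) , +-mono-≤ le le′ , r
wp-sound B (op o e f) v X p with wp-sound B e v _ p
... | a , _ , _ , d , le , q with wp-sound B f v _ q
wp-sound B (op o e f) v X p | num i , _ , _ , d , le , q | num j , _ , _ , d′ , le′ , r =
  _ , _ , _ , op d d′ , +-mono-≤ le le′ , r
wp-sound B (ifz e f g) v X p with wp-sound B e v _ p
... | num zero , _ , _ , d , le , q with wp-sound B f v _ q
...   | _ , _ , _ , d′ , le′ , r = _ , _ , _ , ifz₀ d d′ , +-mono-≤ le le′ , r
wp-sound B (ifz e f g) v X p | num (suc _) , _ , _ , d , le , q with wp-sound B g v _ q
...   | _ , _ , _ , d′ , le′ , r = _ , _ , _ , ifz₁ tt d d′ , +-mono-≤ le le′ , r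
wp-sound B (ifz e f g) v X p | pair _ _ , _ , _ , d , le , q with wp-sound B g v _ q
...   | _ , _ , _ , d′ , le′ , r = _ , _ , _ , ifz₁ tt d d′ , +-mono-≤ le le′ , r
wp-sound B (bind e f) v X p with wp-sound B e v _ p
... | _ , _ , _ , d , le , q with wp-sound B f _ _ q
... | _ , _ , _ , d′ , le′ , r = _ , _ , _ , bind d d′ , +-mono-≤ le le′ , r
wp-sound B (call e) v X p with wp-sound B e v _ p
... | _ , _ , _ , d , le , (_ , _ , (_ , d′ , le′) , r) = _ , _ , _ , call d d′ , +-mono-≤ le le′ , r
wp-sound B (fix C e) v X p with wp-sound B e v _ p
... | _ , _ , _ , d , le , (_ , _ , (_ , d′ , le′) , r) = _ , _ , _ , fix d d′ , +-mono-≤ le le′ , r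

run : ∀ {B v u t} → wp B B v (λ w s → w ≡ u × s < t) → Run B v u t
run {B} {v} p with wp-sound B B v _ p
... | _ , _ , _ , d , le , refl , lt = _ , d , ≤-<-trans le lt

-- Compilation to the RAM.

-- Registers: 0 accumulator, 1 environment, 2 stack, 3 heap pointer, 4–6 scratch; heap from 7 on.
-- The heap is never overwritten, and the stack is a linked list in it.

PUSH PUSHENV POP EXTEND CONS : List Instr
PUSH    = STORE 3 0 ∷ LOADI 4 1 ∷ ADD 3 4 3 ∷ STORE 3 2 ∷ SUB 2 3 4 ∷ ADD 3 4 3 ∷ []
PUSHENV = STORE 3 1 ∷ LOADI 4 1 ∷ ADD 3 4 3 ∷ STORE 3 2 ∷ SUB 2 3 4 ∷ ADD 3 4 3 ∷ []
EXTEND  = STORE 3 0 ∷ LOADI 4 1 ∷ ADD 3 4 3 ∷ STORE 3 1 ∷ SUB 1 3 4 ∷ ADD 3 4 3 ∷ []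
POP     = LOADI 4 1 ∷ ADD 4 4 2 ∷ LOAD 2 4 ∷ []
CONS    = LOAD 5 2 ∷ STORE 3 5 ∷ LOADI 4 1 ∷ ADD 3 4 3 ∷ STORE 3 0 ∷ SUB 0 3 4 ∷ ADD 3 4 3 ∷ POP

OP : Op → List Instr
OP plus  = LOAD 5 2 ∷ ADD 0 5 0 ∷ POP
OP minus = LOAD 5 2 ∷ SUB 0 5 0 ∷ POP
OP neq   = LOAD 5 2 ∷ SUB 4 5 0 ∷ SUB 5 0 5 ∷ ADD 5 4 5 ∷ LOADI 4 1 ∷ SUB 5 4 5 ∷ SUB 0 4 5 ∷ POP

-- Calling convention: the environment of the caller and, on top of it, the return address go on the
-- stack, and the argument becomes the new environment. The dispatch behind the callee pops the
-- address, and `LEAVE` restores the environment.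
ENTER : ℕ → List Instr
ENTER r = PUSHENV ++ LOADI 4 0 ∷ ADD 1 4 0 ∷ LOADI 0 r ∷ PUSH

LEAVE : List Instr
LEAVE = LOAD 1 2 ∷ POP

-- The RAM has no computed jumps: a return compares the tag on the stack with every
-- possible return address.
dispatch : List ℕ → ℕ → List Instr
dispatch []       a = []
dispatch (r ∷ rs) a =
  LOAD 5 2 ∷ LOADI 4 r ∷ SUB 6 5 4 ∷ SUB 5 4 5 ∷ ADD 5 5 6 ∷
  JZ 5 (7 + a) ∷ JMP (11 + a) ∷ LOADI 4 1 ∷ ADD 4 4 2 ∷ LOAD 2 4 ∷ JMP r ∷ dispatch rs (11 + a)

-- `en` is the start of the enclosing program body, the target of `call`, and `a` the address of the
-- code itself. `sites` collects the return addresses of the calls to `en`; a `fix` opens a new body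
-- with its own dispatch, so the sites of that body stay inside.
code  : Expr → ℕ → ℕ → List Instr
sites : Expr → ℕ → ℕ → List ℕ

after : Expr → ℕ → ℕ → ℕ
after e en a = length (code e en a) + a

code arg         en a = LOADI 4 0 ∷ ADD 0 4 1 ∷ []
code (lit k)     en a = LOADI 0 k ∷ []
code (fst e)     en a = code e en a ++ LOAD 0 0 ∷ []
code (snd e)     en a = code e en a ++ LOADI 4 1 ∷ ADD 4 4 0 ∷ LOAD 0 4 ∷ []
code (e & f)     en a = code e en a ++ PUSH ++ code f en (6 + after e en a) ++ CONS
code (op o e f)  en a = code e en a ++ PUSH ++ code f en (6 + after e en a) ++ OP o
code (ifz e f g) en a =
  let b = suc (after e en a); c = suc (after g en b) in
  code e en a ++ JZ 0 c ∷ code g en b ++ JMP (after f en c) ∷ code f en c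
code (bind e f)  en a = code e en a ++ PUSHENV ++ EXTEND ++ code f en (12 + after e en a) ++ LEAVE
code (call e)    en a =
  -- `ENTER` has 15 instructions and the jump is one more, so this is the address of `LEAVE`.
  let r = 16 + after e en a in
  code e en a ++ ENTER r ++ JMP en ∷ LEAVE
code (fix C e)   en a =
  let b = 15 + after e en a
      c = after C b b
      ss = sites C b b
      -- the exit address does not depend on the values of the tags
      r = length (dispatch (0 ∷ ss) c) + c in
  code e en a ++ ENTER r ++ code C b b ++ dispatch (r ∷ ss) c ++ LEAVE

sites arg         en a = []
sites (lit k)     en a = []
sites (fst e)     en a = sites e en a
sites (snd e)     en a = sites e en a
sites (e & f)     en a = sites e en a ++ sites f en (6 + after e en a)
sites (op o e f)  en a = sites e en a ++ sites f en (6 + after e en a)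
sites (ifz e f g) en a =
  let b = suc (after e en a); c = suc (after g en b) in
  sites e en a ++ sites g en b ++ sites f en c
sites (bind e f)  en a = sites e en a ++ sites f en (12 + after e en a)
sites (call e)    en a = sites e en a ++ (16 + after e en a) ∷ []
sites (fix C e)   en a = sites e en a

-- Execution of straight-line code and of jumps.

data At (P : Program) : ℕ → List Instr → Set where
  []  : ∀ {a} → At P a []
  _∷_ : ∀ {a i is} → fetch P a ≡ i → At P (suc a) is → At P a (i ∷ is)

At-++ : ∀ {P} xs {ys a} → At P a (xs ++ ys) → At P a xs × At P (length xs + a) ys
At-++ [] p = [] , p
At-++ {P} (x ∷ xs) {ys} {a} (p ∷ q) with At-++ {P} xs q
... | q₁ , q₂ = p ∷ q₁ , transport (λ b → At P b ys) (+-suc (length xs) a) q₂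

-- Quantifying over the fuel f that remains lets paths be composed by adding their steps, before the
-- total fuel is known.
record Reach (P : Program) (a : ℕ) (m : Memory) (b : ℕ) (m′ : Memory) (t : ℕ) : Set where
  constructor reach
  field
    steps : ℕ
    bound : steps ≤ t
    runs  : ∀ f → exec P (steps + f) a m ≡ exec P f b m′

infixr 5 _⨾_
_⨾_ : ∀ {P a m b m′ c m″ s t} → Reach P a m b m′ s → Reach P b m′ c m″ t → Reach P a m c m″ (s + t)
_⨾_ {P} {a} {m} (reach s p f) (reach t q g) = reach (s + t) (+-mono-≤ p q)
  λ k → trans (cong (λ z → exec P z a m) (+-assoc s t k)) (trans (f (t + k)) (g k))

within : ∀ {P a m b m′ s t} → s ≤ t → Reach P a m b m′ s → Reach P a m b m′ t
within le (reach s p f) = reach s (≤-trans p le) f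

straight : Instr → Bool
straight (JZ _ _) = false
straight (JMP _)  = false
straight HALT     = false
straight _        = true

apply : Instr → Memory → Memory
apply (LOADI r k) m = upd m r k
apply (ADD r a b) m = upd m r (m a + m b)
apply (SUB r a b) m = upd m r (m a ∸ m b)
apply (LOAD r a)  m = upd m r (m (m a))
apply (STORE a r) m = upd m (m a) (m r)
apply _           m = m

applyAll : List Instr → Memory → Memory
applyAll []       m = m
applyAll (i ∷ is) m = applyAll is (apply i m)

exec-straight : ∀ P i a m f → T (straight i) → fetch P a ≡ i → exec P (suc f) a m ≡ exec P f (suc a) (apply i m)
exec-straight P (LOADI _ _) a m f _ eq rewrite eq = refl
exec-straight P (ADD _ _ _) a m f _ eq rewrite eq = refl
exec-straight P (SUB _ _ _) a m f _ eq rewrite eq = refl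
exec-straight P (LOAD _ _)  a m f _ eq rewrite eq = refl
exec-straight P (STORE _ _) a m f _ eq rewrite eq = refl

T-∧ˡ : ∀ {a b} → T (a ∧ b) → T a
T-∧ˡ {true} _ = tt
T-∧ʳ : ∀ {a b} → T (a ∧ b) → T b
T-∧ʳ {true} p = p

exec-block : ∀ P is a m f → T (every straight is) → At P a is →
             exec P (length is + f) a m ≡ exec P f (length is + a) (applyAll is m)
exec-block P []       a m f _ _ = refl
exec-block P (i ∷ is) a m f s (p ∷ q) =
  trans (exec-straight P i a m (length is + f) (T-∧ˡ {straight i} s) p)
        (trans (exec-block P is (suc a) (apply i m) f (T-∧ʳ {straight i} s) q)
               (cong (λ b → exec P f b (applyAll is (apply i m))) (+-suc (length is) a)))

block : ∀ {P} is {a m} → T (every straight is) → At P a is →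
        Reach P a m (length is + a) (applyAll is m) (length is)
block {P} is s p = reach (length is) ≤-refl λ f → exec-block P is _ _ f s p

jump : ∀ {P a m l} → fetch P a ≡ JMP l → Reach P a m l m 1
jump {P} {a} {m} {l} eq = reach 1 ≤-refl go
  where go : ∀ f → exec P (suc f) a m ≡ exec P f l m
        go f rewrite eq = refl

jz₀ : ∀ {P a m r l} → fetch P a ≡ JZ r l → m r ≡ 0 → Reach P a m l m 1
jz₀ {P} {a} {m} {r} {l} eq z = reach 1 ≤-refl go
  where go : ∀ f → exec P (suc f) a m ≡ exec P f l m
        go f rewrite eq | z = refl

jz₁ : ∀ {P a m r l k} → fetch P a ≡ JZ r l → m r ≡ suc k → Reach P a m (suc a) m 1
jz₁ {P} {a} {m} {r} {l} eq z = reach 1 ≤-refl go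
  where go : ∀ f → exec P (suc f) a m ≡ exec P f (suc a) m
        go f rewrite eq | z = refl

-- Representation of values and the machine invariant.

-- Words carry no type tag: a number stands for itself and a pair for the address of two consecutive
-- cells, both below the heap end `7 + k`. Which reading applies is determined by the value
-- represented.
Rep : Memory → ℕ → Val → ℕ → Set
Rep m k (num n)    w = w ≡ n
Rep m k (pair a b) w = Σ ℕ λ i → w ≡ 7 + i × 2 + i ≤ k × Rep m k a (m (7 + i)) × Rep m k b (m (8 + i))

Same : Memory → Memory → ℕ → Set
Same m m′ k = ∀ i → i < k → m′ (7 + i) ≡ m (7 + i)

-- Everything reachable from a represented value lies below k, and allocation writes from k on.
-- Values may therefore share cells freely.
Rep-frame : ∀ {m m′ k k′} v {w} → k ≤ k′ → Same m m′ k → Rep m k v w → Rep m′ k′ v w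
Rep-frame (num n) le same p = p
Rep-frame {m} {m′} {k} {k′} (pair a b) le same (i , eq , lt , p , q) =
  i , eq , ≤-trans lt le ,
  transport (Rep m′ k′ a) (sym (same i (<-trans (n<1+n i) lt))) (Rep-frame a le same p) ,
  transport (Rep m′ k′ b) (sym (same (suc i) lt)) (Rep-frame b le same q)

record State (m : Memory) (env acc stk : Val) : Set where
  constructor state
  field
    hp    : ℕ
    hp≡   : m 3 ≡ 7 + hp
    inEnv : Rep m hp env (m 1)
    inAcc : Rep m hp acc (m 0)
    inStk : Rep m hp stk (m 2)

≡ᵇ-refl : ∀ n → (n ≡ᵇ n) ≡ true
≡ᵇ-refl zero = refl
≡ᵇ-refl (suc n) = ≡ᵇ-refl n

≡ᵇ-false : ∀ {i j} → i < j → (i ≡ᵇ j) ≡ false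
≡ᵇ-false {zero} {suc j} _ = refl
≡ᵇ-false {suc i} {suc j} (s≤s p) = ≡ᵇ-false p

alloc : ∀ {m m′ k} a b → Rep m k a (m′ (7 + k)) → Rep m k b (m′ (8 + k)) → Same m m′ k →
        Rep m′ (2 + k) (pair a b) (7 + k)
alloc {k = k} a b p q same = k , refl , ≤-refl ,
  Rep-frame a (m≤n+m k 2) same p , Rep-frame b (m≤n+m k 2) same q

state-PUSH : ∀ {m v w s} → State m v w s → State (applyAll PUSH m) v w (pair w s)
state-PUSH {m} {v} {w} {s} (state k h e a t) = state (2 + k) eq₃
  (Rep-frame v (m≤n+m k 2) same (transport (Rep m k v) (sym r₁) e))
  (Rep-frame w (m≤n+m k 2) same (transport (Rep m k w) (sym r₀) a))
  (transport (Rep m′ (2 + k) (pair w s)) (sym r₂)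
    (alloc w s (transport (Rep m k w) (sym c₀) a) (transport (Rep m k s) (sym c₁) t) same))
  where
  m′ = applyAll PUSH m
  eq₃ : m′ 3 ≡ 9 + k
  eq₃ rewrite h = refl
  r₁ : m′ 1 ≡ m 1
  r₁ rewrite h = refl
  r₀ : m′ 0 ≡ m 0
  r₀ rewrite h = refl
  r₂ : m′ 2 ≡ 7 + k
  r₂ rewrite h = refl
  c₀ : m′ (7 + k) ≡ m 0
  c₀ rewrite h | ≡ᵇ-false (n<1+n k) | ≡ᵇ-refl k = refl
  c₁ : m′ (8 + k) ≡ m 2
  c₁ rewrite h | ≡ᵇ-refl k = refl
  same : Same m m′ k
  same i lt rewrite h | ≡ᵇ-false lt | ≡ᵇ-false (<-trans lt (n<1+n k)) = refl

state-PUSHENV : ∀ {m v w s} → State m v w s → State (applyAll PUSHENV m) v w (pair v s)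
state-PUSHENV {m} {v} {w} {s} (state k h e a t) = state (2 + k) eq₃
  (Rep-frame v (m≤n+m k 2) same (transport (Rep m k v) (sym r₁) e))
  (Rep-frame w (m≤n+m k 2) same (transport (Rep m k w) (sym r₀) a))
  (transport (Rep m′ (2 + k) (pair v s)) (sym r₂)
    (alloc v s (transport (Rep m k v) (sym c₀) e) (transport (Rep m k s) (sym c₁) t) same))
  where
  m′ = applyAll PUSHENV m
  eq₃ : m′ 3 ≡ 9 + k
  eq₃ rewrite h = refl
  r₁ : m′ 1 ≡ m 1
  r₁ rewrite h = refl
  r₀ : m′ 0 ≡ m 0
  r₀ rewrite h = refl
  r₂ : m′ 2 ≡ 7 + k
  r₂ rewrite h = refl
  c₀ : m′ (7 + k) ≡ m 1
  c₀ rewrite h | ≡ᵇ-false (n<1+n k) | ≡ᵇ-refl k = refl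
  c₁ : m′ (8 + k) ≡ m 2
  c₁ rewrite h | ≡ᵇ-refl k = refl
  same : Same m m′ k
  same i lt rewrite h | ≡ᵇ-false lt | ≡ᵇ-false (<-trans lt (n<1+n k)) = refl

state-EXTEND : ∀ {m v w s} → State m v w s → State (applyAll EXTEND m) (pair w v) w s
state-EXTEND {m} {v} {w} {s} (state k h e a t) = state (2 + k) eq₃
  (transport (Rep m′ (2 + k) (pair w v)) (sym r₁)
    (alloc w v (transport (Rep m k w) (sym c₀) a) (transport (Rep m k v) (sym c₁) e) same))
  (Rep-frame w (m≤n+m k 2) same (transport (Rep m k w) (sym r₀) a))
  (Rep-frame s (m≤n+m k 2) same (transport (Rep m k s) (sym r₂) t))
  where
  m′ = applyAll EXTEND m
  eq₃ : m′ 3 ≡ 9 + k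
  eq₃ rewrite h = refl
  r₁ : m′ 1 ≡ 7 + k
  r₁ rewrite h = refl
  r₀ : m′ 0 ≡ m 0
  r₀ rewrite h = refl
  r₂ : m′ 2 ≡ m 2
  r₂ rewrite h = refl
  c₀ : m′ (7 + k) ≡ m 0
  c₀ rewrite h | ≡ᵇ-false (n<1+n k) | ≡ᵇ-refl k = refl
  c₁ : m′ (8 + k) ≡ m 1
  c₁ rewrite h | ≡ᵇ-refl k = refl
  same : Same m m′ k
  same i lt rewrite h | ≡ᵇ-false lt | ≡ᵇ-false (<-trans lt (n<1+n k)) = refl

state-POP : ∀ {m v w x s} → State m v w (pair x s) → State (applyAll POP m) v w s
state-POP {m} {v} {w} {x} {s} (state k h e a (i , h₂ , lt , p , q)) = state k h
  (Rep-frame v ≤-refl same e) (Rep-frame w ≤-refl same a)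
  (transport (Rep m′ k s) (sym r₂) (Rep-frame s ≤-refl same q))
  where
  m′ = applyAll POP m
  same : Same m m′ k
  same _ _ = refl
  r₂ : m′ 2 ≡ m (8 + i)
  r₂ rewrite h₂ = refl

state-CONS : ∀ {m v w x s} → State m v w (pair x s) → State (applyAll CONS m) v (pair x w) s
state-CONS {m} {v} {w} {x} {s} (state k h e a (i , h₂ , lt , p , q)) =
  state-POP {m″} (state (2 + k) eq₃
    (Rep-frame v (m≤n+m k 2) same (transport (Rep m k v) (sym r₁) e))
    (transport (Rep m″ (2 + k) (pair x w)) (sym r₀)
      (alloc x w (transport (Rep m k x) (sym c₀) p) (transport (Rep m k w) (sym c₁) a) same))
    (transport (Rep m″ (2 + k) (pair x s)) (sym r₂)
      (Rep-frame (pair x s) (m≤n+m k 2) same (i , h₂ , lt , p , q))))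
  where
  m″ = applyAll (LOAD 5 2 ∷ STORE 3 5 ∷ LOADI 4 1 ∷ ADD 3 4 3 ∷ STORE 3 0 ∷ SUB 0 3 4 ∷ ADD 3 4 3 ∷ []) m
  eq₃ : m″ 3 ≡ 9 + k
  eq₃ rewrite h = refl
  r₁ : m″ 1 ≡ m 1
  r₁ rewrite h = refl
  r₀ : m″ 0 ≡ 7 + k
  r₀ rewrite h = refl
  r₂ : m″ 2 ≡ m 2
  r₂ rewrite h = refl
  c₀ : m″ (7 + k) ≡ m (7 + i)
  c₀ rewrite h | ≡ᵇ-false (n<1+n k) | ≡ᵇ-refl k | h₂ = refl
  c₁ : m″ (8 + k) ≡ m 0
  c₁ rewrite h | ≡ᵇ-refl k = refl
  same : Same m m″ k
  same j lt rewrite h | ≡ᵇ-false lt | ≡ᵇ-false (<-trans lt (n<1+n k)) = refl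

state-acc : ∀ {m v w s u} m′ → m′ 1 ≡ m 1 → m′ 2 ≡ m 2 → m′ 3 ≡ m 3 → (∀ i → m′ (7 + i) ≡ m (7 + i)) →
            (st : State m v w s) → Rep m (State.hp st) u (m′ 0) → State m′ v u s
state-acc {v = v} {s = s} {u} m′ r₁ r₂ r₃ same (state k h e _ t) a = state k (trans r₃ h)
  (transport (Rep m′ k v) (sym r₁) (Rep-frame v ≤-refl (λ i _ → same i) e))
  (Rep-frame u ≤-refl (λ i _ → same i) a)
  (transport (Rep m′ k s) (sym r₂) (Rep-frame s ≤-refl (λ i _ → same i) t))

-- The sum of the two truncated differences is the distance of i and j, and subtracting from 1 twice
-- turns every nonzero distance into 1.
neq-∸ : ∀ i j → 1 ∸ (1 ∸ ((i ∸ j) + (j ∸ i))) ≡ bit (i ≡ᵇ j)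
neq-∸ zero    zero    = refl
neq-∸ zero    (suc j) = cong (1 ∸_) (0∸n≡0 j)
neq-∸ (suc i) zero    = cong (1 ∸_) (0∸n≡0 (i + 0))
neq-∸ (suc i) (suc j) = neq-∸ i j

state-OP : ∀ {m v i j s} o → State m v (num j) (pair (num i) s) →
           State (applyAll (OP o) m) v (num (⟦ o ⟧ i j)) s
state-OP {m} {v} {i} {j} {s} plus st@(state k h e a (l , h₂ , lt , p , q)) =
  state-POP {x = num i} (state-acc (applyAll (LOAD 5 2 ∷ ADD 0 5 0 ∷ []) m) refl refl refl (λ _ → refl) st eq)
  where
  eq : m (m 2) + m 0 ≡ i + j
  eq rewrite h₂ | p | a = refl
state-OP {m} {v} {i} {j} {s} minus st@(state k h e a (l , h₂ , lt , p , q)) =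
  state-POP {x = num i} (state-acc (applyAll (LOAD 5 2 ∷ SUB 0 5 0 ∷ []) m) refl refl refl (λ _ → refl) st eq)
  where
  eq : m (m 2) ∸ m 0 ≡ i ∸ j
  eq rewrite h₂ | p | a = refl
state-OP {m} {v} {i} {j} {s} neq st@(state k h e a (l , h₂ , lt , p , q)) =
  state-POP {x = num i} (state-acc
    (applyAll (LOAD 5 2 ∷ SUB 4 5 0 ∷ SUB 5 0 5 ∷ ADD 5 4 5 ∷ LOADI 4 1 ∷ SUB 5 4 5 ∷ SUB 0 4 5 ∷ []) m)
    refl refl refl (λ _ → refl) st eq)
  where
  eq : 1 ∸ (1 ∸ ((m (m 2) ∸ m 0) + (m 0 ∸ m (m 2)))) ≡ bit (i ≡ᵇ j)
  eq rewrite h₂ | p | a = neq-∸ i j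

state-SETENV : ∀ {m v w s} → State m v w s → State (applyAll (LOADI 4 0 ∷ ADD 1 4 0 ∷ []) m) w w s
state-SETENV (state k h e a t) = state k h
  (Rep-frame _ ≤-refl (λ _ _ → refl) a) (Rep-frame _ ≤-refl (λ _ _ → refl) a) (Rep-frame _ ≤-refl (λ _ _ → refl) t)

state-SND : ∀ {m v a b s} → State m v (pair a b) s →
            State (applyAll (LOADI 4 1 ∷ ADD 4 4 0 ∷ LOAD 0 4 ∷ []) m) v b s
state-SND {m} {b = b} st@(state k h _ (i , h₀ , _ , _ , q) _) =
  state-acc m′ refl refl refl (λ _ → refl) st (transport (Rep m k b) (sym r₀) q)
  where
  m′ = applyAll (LOADI 4 1 ∷ ADD 4 4 0 ∷ LOAD 0 4 ∷ []) m
  r₀ : m′ 0 ≡ m (8 + i)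
  r₀ rewrite h₀ = refl

state-LOADI : ∀ {m v w s} r → State m v w s → State (applyAll (LOADI 0 r ∷ []) m) v (num r) s
state-LOADI r st = state-acc _ refl refl refl (λ _ → refl) st refl

state-ENTER : ∀ {m v w s} r → State m v w s → State (applyAll (ENTER r) m) w (num r) (pair (num r) (pair v s))
state-ENTER r st = state-PUSH (state-LOADI r (state-SETENV (state-PUSHENV st)))

state-LEAVE : ∀ {m v w x s} → State m v w (pair x s) → State (applyAll LEAVE m) x w s
state-LEAVE {m} {v} {w} {x} {s} (state k h e a (i , h₂ , lt , p , q)) =
  state-POP {x = x} (state k h (Rep-frame x ≤-refl same (transport (Rep m k x) (sym r₁) p))
    (Rep-frame w ≤-refl same a) (Rep-frame (pair x s) ≤-refl same (i , h₂ , lt , p , q)))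
  where
  m′ = applyAll (LOAD 1 2 ∷ []) m
  same : Same m m′ k
  same _ _ = refl
  r₁ : m′ 1 ≡ m (7 + i)
  r₁ rewrite h₂ = refl

-- Correctness of the compiled code.

record Reaches (P : Program) (a : ℕ) (m : Memory) (b : ℕ) (env acc stk : Val) (t : ℕ) : Set where
  constructor reaches
  field
    {mem} : Memory
    path  : Reach P a m b mem t
    inv   : State mem env acc stk

dispatches : ∀ {P} rs {a m v w r s} → r ∈ rs → At P a (dispatch rs a) → State m v w (pair (num r) s) →
             Reaches P a m r v w s (length (dispatch rs a))
dispatches {P} (r′ ∷ rs) {a} {m} {v} {w} {r} {s} r∈ p st@(state k h e x (i , h₂ , lt , c , d))
  with At-++ {P} (LOAD 5 2 ∷ LOADI 4 r′ ∷ SUB 6 5 4 ∷ SUB 5 4 5 ∷ ADD 5 5 6 ∷ []) p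
... | p₁ , (pz ∷ pj ∷ p₂) with At-++ {P} POP p₂
...   | p₃ , (pj′ ∷ p₄) = go _ refl r∈
  where
  test = LOAD 5 2 ∷ LOADI 4 r′ ∷ SUB 6 5 4 ∷ SUB 5 4 5 ∷ ADD 5 5 6 ∷ []
  m₁ = applyAll test m
  st₁ : State m₁ v w (pair (num r) s)
  st₁ = state-acc m₁ refl refl refl (λ _ → refl) st x
  diff : ℕ
  diff = (r′ ∸ r) + (r ∸ r′)
  m₁5 : m₁ 5 ≡ diff
  m₁5 rewrite h₂ | c = refl
  same-tag : diff ≡ 0 → r′ ≡ r
  same-tag z = ≤-antisym (m∸n≡0⇒m≤n (m+n≡0⇒m≡0 (r′ ∸ r) z)) (m∸n≡0⇒m≤n (m+n≡0⇒n≡0 (r′ ∸ r) z))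
  go : ∀ n → diff ≡ n → r ∈ r′ ∷ rs → Reaches P a m r v w s (11 + length (dispatch rs (11 + a)))
  go zero z _ rewrite sym (same-tag z) = reaches
    (within (m≤m+n 10 _) (block test _ p₁ ⨾ jz₀ pz (trans m₁5 z) ⨾ block POP _ p₃ ⨾ jump pj′))
    (state-POP st₁)
  go (suc n) z (here refl) = ⊥-elim (1+n≢0 (trans (sym z) (cong₂ _+_ (n∸n≡0 r) (n∸n≡0 r))))
  go (suc n) z (there r∈rs) with dispatches rs r∈rs p₄ st₁
  ... | reaches path st₂ = reaches
    (within (+-monoˡ-≤ _ (m≤m+n 7 4)) (block test _ p₁ ⨾ jz₁ pz (trans m₁5 z) ⨾ jump pj ⨾ path)) st₂

infixr 5 _▸_
_▸_ : ∀ {P a m b c v w s v′ w′ s′ t t′} → Reaches P a m b v w s t →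
      (∀ {m} → State m v w s → Reaches P b m c v′ w′ s′ t′) → Reaches P a m c v′ w′ s′ (t + t′)
reaches p st ▸ k with k st
... | reaches q st′ = reaches (p ⨾ q) st′

arriving : ∀ {P a m b b′ v w s t} → b ≡ b′ → Reaches P a m b v w s t → Reaches P a m b′ v w s t
arriving refl x = x

budget : ∀ {P a m b v w s t t′} → t ≤ t′ → Reaches P a m b v w s t → Reaches P a m b v w s t′
budget le (reaches p st) = reaches (within le p) st

straightly : ∀ {P a m v w s} is → T (every straight is) → At P a is → State (applyAll is m) v w s →
             Reaches P a m (length is + a) v w s (length is)
straightly is str p st = reaches (block is str p) st

enter : ∀ {P a m v w s} r → At P a (ENTER r) → State m v w s →
        Reaches P a m (15 + a) w (num r) (pair (num r) (pair v s)) 15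
enter r p st = straightly (ENTER r) tt p (state-ENTER r st)

leave : ∀ {P a m v w x s} → At P a LEAVE → State m v w (pair x s) → Reaches P a m (4 + a) x w s 4
leave p st = straightly LEAVE tt p (state-LEAVE st)

jumping : ∀ {P a m v w s l} → fetch P a ≡ JMP l → State m v w s → Reaches P a m l v w s 1
jumping p st = reaches (jump p) st

branch₀ : ∀ {P a m v s l} → fetch P a ≡ JZ 0 l → State m v (num 0) s → Reaches P a m l v (num 0) s 1
branch₀ p st = reaches (jz₀ p (State.inAcc st)) st

NonZero-rep : ∀ {m k w} u → caseZ u ⊥ ⊤ → Rep m k u w → Σ ℕ λ n → w ≡ suc n
NonZero-rep (num (suc n)) _ eq = n , eq
NonZero-rep (pair _ _) _ (i , eq , _) = 6 + i , eq

branch₁ : ∀ {P a m v w s l} → caseZ w ⊥ ⊤ → fetch P a ≡ JZ 0 l → State m v w s → Reaches P a m (suc a) v w s 1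
branch₁ {w = w} nz p st = reaches (jz₁ p (proj₂ (NonZero-rep w nz (State.inAcc st)))) st

-- M bounds the work of one call apart from the calls it makes.
record Seg (P : Program) (M : ℕ) (is : List Instr) (a : ℕ) (m : Memory) (env acc stk : Val) (t : ℕ) : Set where
  constructor seg
  field unseg : Reaches P a m (length is + a) env acc stk (length is + M * t)
open Seg

record Fits (M : ℕ) (is : List Instr) : Set where
  constructor fits
  field fit : length is ≤ M
open Fits

seg-++ : ∀ {P M a m v w s v′ w′ s′ t t′} xs {ys} → Seg P M xs a m v w s t →
         (∀ {m} → State m v w s → Seg P M ys (length xs + a) m v′ w′ s′ t′) →
         Seg P M (xs ++ ys) a m v′ w′ s′ (t + t′)
seg-++ {P} {M} {a} {t = t} {t′} xs {ys} x k = seg go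
  where
  swap : ∀ x y a → y + (x + a) ≡ (x + y) + a
  swap = solve-∀
  cost : ∀ x y M t t′ → (x + M * t) + (y + M * t′) ≡ (x + y) + M * (t + t′)
  cost = solve-∀
  go : Reaches P a _ (length (xs ++ ys) + a) _ _ _ (length (xs ++ ys) + M * (t + t′))
  go rewrite length-++ xs {ys} = arriving (swap (length xs) (length ys) a)
    (budget (≤-reflexive (cost (length xs) (length ys) M t t′)) (unseg x ▸ λ st → unseg (k st)))

seg-block : ∀ {P M a m v w s} is → T (every straight is) → At P a is → State (applyAll is m) v w s →
            Seg P M is a m v w s 0
seg-block is str p st = seg (budget (m≤m+n _ _) (straightly is str p st))

recost : ∀ {P M is a m v w s t t′} → t ≡ t′ → Seg P M is a m v w s t → Seg P M is a m v w s t′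
recost refl x = x

-- `S` contains the sites of the body and in addition the tag with which the outermost invocation of
-- the body returns to whoever entered it.
record Ctx (P : Program) (M : ℕ) (B : Expr) (en : ℕ) (S : List ℕ) : Set where
  constructor ctx
  field
    body-at  : At P en (code B en en)
    disp-at  : At P (after B en en) (dispatch S (after B en en))
    complete : sites B en en ⊆ S
    room     : length (code B en en) + length (dispatch S (after B en en)) ≤ M

-- Induction on the evaluation. Apart from calls, control moves only forward through the segment,
-- which costs at most its length; each of the t calls costs at most M, the bound for a body
-- together with its dispatch. The body of a nested `fix` is part of the segment, so the same M
-- bounds it.
simulate : ∀ {B e v u t} → Eval B e v u t → ∀ {P M en S a m w s} → Ctx P M B en S →
           At P a (code e en a) → sites e en a ⊆ S → Fits M (code e en a) →
           State m v w s → Seg P M (code e en a) a m v u s t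

simulate-body : ∀ {B v u t} → Eval B B v u t → ∀ {P M en S m w s r} → Ctx P M B en S → r ∈ S →
                State m v w (pair (num r) s) → Reaches P en m r v u s (M * suc t)
simulate-body {B} {t = t} d {P} {M} {en} {S} c@(ctx at dat com room) r∈S st
  = budget le (unseg (simulate d c at com (fits (m+n≤o⇒m≤o _ room)) st) ▸ dispatches S r∈S dat)
  where
  shape : ∀ x y M t → (x + M * t) + y ≡ (x + y) + M * t
  shape = solve-∀
  le : (length (code B en en) + M * t) + length (dispatch S (after B en en)) ≤ M * suc t
  le = ≤-trans (≤-reflexive (shape (length (code B en en)) _ M t))
         (≤-trans (+-monoˡ-≤ (M * t) room) (≤-reflexive (sym (*-suc M t))))

fits-++ˡ : ∀ xs {ys M} → Fits M (xs ++ ys) → Fits M xs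
fits-++ˡ xs {ys} (fits le) = fits (m+n≤o⇒m≤o (length xs) (≤-trans (≤-reflexive (sym (length-++ xs {ys}))) le))

fits-++ʳ : ∀ xs {ys M} → Fits M (xs ++ ys) → Fits M ys
fits-++ʳ xs {ys} (fits le) = fits (m+n≤o⇒n≤o (length xs) (≤-trans (≤-reflexive (sym (length-++ xs {ys}))) le))

fits-∷ : ∀ {x xs M} → Fits M (x ∷ xs) → Fits M xs
fits-∷ (fits le) = fits (<⇒≤ le)

simulate arg c at sub le st = seg-block _ tt at (state-acc _ refl refl refl (λ _ → refl) st (State.inEnv st))
simulate (lit {k = k}) c at sub le st = seg-block _ tt at (state-LOADI k st)
simulate (fst {B} {e} {v} {a} {b} {t} d) {en = en} {a = o} c at sub le st
  with At-++ (code e en o) at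
... | at₁ , at₂ = recost (+-identityʳ t) (seg-++ (code e en o) (simulate d c at₁ sub (fits-++ˡ (code e en o) le) st)
  λ {m} st′@(state k h _ (i , h₀ , _ , p , _) _) → seg-block _ tt at₂
    (state-acc _ refl refl refl (λ _ → refl) st′ (transport (λ x → Rep m k a (m x)) (sym h₀) p)))
simulate (snd {B} {e} {v} {a} {b} {t} d) {en = en} {a = o} c at sub le st
  with At-++ (code e en o) at
... | at₁ , at₂ = recost (+-identityʳ t) (seg-++ (code e en o) (simulate d c at₁ sub (fits-++ˡ (code e en o) le) st)
  λ st′ → seg-block _ tt at₂ (state-SND st′))
simulate (_&_ {e = e} {f} {s = s} {t} d₁ d₂) {en = en} {a = o} c at sub le st
  with At-++ (code e en o) at
... | at₁ , at₂ with At-++ PUSH at₂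
... | at₃ , at₄ with At-++ (code f en (6 + after e en o)) at₄
... | at₅ , at₆ = recost (cong (s +_) (+-identityʳ t))
  (seg-++ (code e en o)
    (simulate d₁ c at₁ (λ x → sub (∈-++⁺ˡ x)) (fits-++ˡ (code e en o) le) st) λ st →
   seg-++ PUSH (seg-block PUSH tt at₃ (state-PUSH st)) λ st →
   seg-++ (code f en (6 + after e en o))
    (simulate d₂ c at₅ (λ x → sub (∈-++⁺ʳ (sites e en o) x))
      (fits-++ˡ (code f en _) (fits-++ʳ PUSH (fits-++ʳ (code e en o) le))) st) λ st →
   seg-block CONS tt at₆ (state-CONS st))
simulate (op {o = p} {e} {f} {s = s} {t} d₁ d₂) {en = en} {a = o} c at sub le st
  with At-++ (code e en o) at
... | at₁ , at₂ with At-++ PUSH at₂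
... | at₃ , at₄ with At-++ (code f en (6 + after e en o)) at₄
... | at₅ , at₆ = recost (cong (s +_) (+-identityʳ t))
  (seg-++ (code e en o)
    (simulate d₁ c at₁ (λ x → sub (∈-++⁺ˡ x)) (fits-++ˡ (code e en o) le) st) λ st →
   seg-++ PUSH (seg-block PUSH tt at₃ (state-PUSH st)) λ st →
   seg-++ (code f en (6 + after e en o))
    (simulate d₂ c at₅ (λ x → sub (∈-++⁺ʳ (sites e en o) x))
      (fits-++ˡ (code f en _) (fits-++ʳ PUSH (fits-++ʳ (code e en o) le))) st) λ st →
   seg-block (OP p) (straight-OP p) at₆ (state-OP p st))
  where
  straight-OP : ∀ p → T (every straight (OP p))
  straight-OP plus = tt
  straight-OP minus = tt
  straight-OP neq = tt
simulate (bind {e = e} {f} {s = s} {t} d₁ d₂) {en = en} {a = o} c at sub le st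
  with At-++ (code e en o) at
... | at₁ , at₂ with At-++ PUSHENV at₂
... | at₃ , at₄ with At-++ EXTEND at₄
... | at₅ , at₆ with At-++ (code f en (12 + after e en o)) at₆
... | at₇ , at₈ = recost (cong (s +_) (+-identityʳ t))
  (seg-++ (code e en o)
    (simulate d₁ c at₁ (λ x → sub (∈-++⁺ˡ x)) (fits-++ˡ (code e en o) le) st) λ st →
   seg-++ PUSHENV (seg-block PUSHENV tt at₃ (state-PUSHENV st)) λ st →
   seg-++ EXTEND (seg-block EXTEND tt at₅ (state-EXTEND st)) λ st →
   seg-++ (code f en (12 + after e en o))
    (simulate d₂ c at₇ (λ x → sub (∈-++⁺ʳ (sites e en o) x))
      (fits-++ˡ (code f en _) (fits-++ʳ (PUSHENV ++ EXTEND) (fits-++ʳ (code e en o) le))) st) λ st →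
   seg-block LEAVE tt at₈ (state-LEAVE st))
simulate (ifz₀ {e = e} {f} {g} {s = s} {t} d₁ d₂) {P} {M} {en} {a = o} c at sub le st
  with At-++ (code e en o) at
... | at₁ , (jz ∷ at₂) with At-++ (code g en (suc (after e en o))) at₂
... | at₃ , (_ ∷ at₄) = seg-++ (code e en o)
    (simulate d₁ c at₁ (λ x → sub (∈-++⁺ˡ x)) (fits-++ˡ (code e en o) le) st) rest
  where
  A = after e en o
  b = suc A
  cg = code g en b
  l = suc (after g en b)
  cf = code f en l
  rest : ∀ {m} → State m _ (num 0) _ → Seg P M (JZ 0 l ∷ cg ++ JMP (after f en l) ∷ cf) A m _ _ _ t
  rest st = seg (arriving end (budget cost (branch₀ jz st ▸ λ st →
    unseg (simulate d₂ c at₄ (λ x → sub (∈-++⁺ʳ (sites e en o) (∈-++⁺ʳ (sites g en b) x)))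
      (fits-∷ (fits-++ʳ cg (fits-∷ (fits-++ʳ (code e en o) le)))) st))))
    where
    arith : ∀ x y A → x + suc (y + suc A) ≡ suc (y + suc x) + A
    arith = solve-∀
    end : length cf + l ≡ length (JZ 0 l ∷ cg ++ JMP (after f en l) ∷ cf) + A
    end rewrite length-++ cg {JMP (after f en l) ∷ cf} = arith (length cf) (length cg) A
    cost : 1 + (length cf + M * t) ≤ length (JZ 0 l ∷ cg ++ JMP (after f en l) ∷ cf) + M * t
    cost rewrite length-++ cg {JMP (after f en l) ∷ cf} =
      s≤s (+-monoˡ-≤ (M * t) (≤-trans (n≤1+n _) (m≤n+m _ (length cg))))
simulate (ifz₁ {e = e} {f} {g} {w = z} {s = s} {t} nz d₁ d₂) {P} {M} {en} {a = o} c at sub le st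
  with At-++ (code e en o) at
... | at₁ , (jz ∷ at₂) with At-++ (code g en (suc (after e en o))) at₂
... | at₃ , (jm ∷ _) = seg-++ (code e en o)
    (simulate d₁ c at₁ (λ x → sub (∈-++⁺ˡ x)) (fits-++ˡ (code e en o) le) st) rest
  where
  A = after e en o
  b = suc A
  cg = code g en b
  l = suc (after g en b)
  cf = code f en l
  rest : ∀ {m} → State m _ z _ → Seg P M (JZ 0 l ∷ cg ++ JMP (after f en l) ∷ cf) A m _ _ _ t
  rest st = seg (arriving end (budget cost (branch₁ nz jz st ▸ λ st →
    unseg (simulate d₂ c at₃ (λ x → sub (∈-++⁺ʳ (sites e en o) (∈-++⁺ˡ x)))
      (fits-++ˡ cg (fits-∷ (fits-++ʳ (code e en o) le))) st) ▸ jumping jm)))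
    where
    arith : ∀ x y A → x + suc (y + suc A) ≡ suc (y + suc x) + A
    arith = solve-∀
    end : length cf + l ≡ length (JZ 0 l ∷ cg ++ JMP (after f en l) ∷ cf) + A
    end rewrite length-++ cg {JMP (after f en l) ∷ cf} = arith (length cf) (length cg) A
    arith′ : ∀ y x T → (1 + ((y + T) + 1)) + x ≡ suc (y + suc x) + T
    arith′ = solve-∀
    cost : 1 + ((length cg + M * t) + 1) ≤ length (JZ 0 l ∷ cg ++ JMP (after f en l) ∷ cf) + M * t
    cost rewrite length-++ cg {JMP (after f en l) ∷ cf} =
      ≤-trans (m≤m+n _ (length cf)) (≤-reflexive (arith′ (length cg) (length cf) (M * t)))
simulate (call {e = e} {s = s} {t} d₁ d₂) {P} {M} {en} {a = o} c at sub le st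
  with At-++ (code e en o) at
... | at₁ , at₂ with At-++ (ENTER (16 + after e en o)) at₂
... | at₃ , (jm ∷ at₄) = seg-++ (code e en o)
    (simulate d₁ c at₁ (λ x → sub (∈-++⁺ˡ x)) (fits-++ˡ (code e en o) le) st) rest
  where
  A = after e en o
  rest : ∀ {m} → State m _ _ _ → Seg P M (ENTER (16 + A) ++ JMP en ∷ LEAVE) A m _ _ _ (suc t)
  rest st = seg (budget (≤-reflexive (arith (M * suc t)))
    (enter (16 + A) at₃ st ▸ λ st → jumping jm st ▸ λ st →
     simulate-body d₂ c (sub (∈-++⁺ʳ (sites e en o) (here refl))) st ▸ leave at₄))
    where
    arith : ∀ T → 15 + (1 + (T + 4)) ≡ 20 + T
    arith = solve-∀
simulate (fix {C = C} {e} {s = s} {t} d₁ d₂) {P} {M} {en} {a = o} c at sub le st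
  with At-++ (code e en o) at
... | at₁ , at₂ = seg-++ (code e en o)
    (simulate d₁ c at₁ sub (fits-++ˡ (code e en o) le) st) rest
  where
  A = after e en o
  b = 15 + A
  cC = code C b b
  l = after C b b
  ss = sites C b b
  r = length (dispatch (0 ∷ ss) l) + l
  cD = dispatch (r ∷ ss) l
  parts = At-++ (ENTER r) at₂
  parts₂ = At-++ cC (proj₂ parts)
  parts₃ = At-++ cD (proj₂ parts₂)
  rest-le : length cC + length cD + 4 ≤ M
  rest-le = ≤-trans (≤-reflexive eq) (fit (fits-++ʳ (ENTER r) (fits-++ʳ (code e en o) le)))
    where
    eq : length cC + length cD + 4 ≡ length (cC ++ cD ++ LEAVE)
    eq rewrite length-++ cC {cD ++ LEAVE} | length-++ cD {LEAVE} = +-assoc (length cC) (length cD) 4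
  inner : Ctx P M C b (r ∷ ss)
  inner = ctx (proj₁ parts₂) (proj₁ parts₃) there (m+n≤o⇒m≤o _ rest-le)
  rest : ∀ {m} → State m _ _ _ → Seg P M (ENTER r ++ cC ++ cD ++ LEAVE) A m _ _ _ (suc t)
  rest st = seg (arriving end (budget cost (enter r (proj₁ parts) st ▸ λ st →
     simulate-body d₂ inner (here refl) st ▸ leave (proj₂ parts₃))))
    where
    arith : ∀ x y A → 4 + (y + (x + (15 + A))) ≡ (15 + (x + (y + 4))) + A
    arith = solve-∀
    end : 4 + r ≡ length (ENTER r ++ cC ++ cD ++ LEAVE) + A
    end rewrite length-++ cC {cD ++ LEAVE} | length-++ cD {LEAVE} = arith (length cC) (length cD) A
    arith′ : ∀ x y T → (15 + (T + 4)) + (x + y) ≡ (15 + (x + (y + 4))) + T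
    arith′ = solve-∀
    cost : 15 + (M * suc t + 4) ≤ length (ENTER r ++ cC ++ cD ++ LEAVE) + M * suc t
    cost rewrite length-++ cC {cD ++ LEAVE} | length-++ cD {LEAVE} =
      ≤-trans (m≤m+n _ (length cC + length cD)) (≤-reflexive (arith′ (length cC) (length cD) (M * suc t)))

-- Loading the input into a list.

-- Copies the input registers 1–6 to addresses 8L,…,8L+5, where L is the input length,
-- so that they can be used as working registers.
SAVE : List Instr
SAVE = STORE 0 1 ∷ LOADI 1 1 ∷ ADD 0 1 0 ∷ STORE 0 2 ∷ ADD 0 1 0 ∷ STORE 0 3 ∷ ADD 0 1 0 ∷ STORE 0 4 ∷
       ADD 0 1 0 ∷ STORE 0 5 ∷ ADD 0 1 0 ∷ STORE 0 6 ∷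
       LOADI 2 1 ∷ ADD 3 2 0 ∷ LOADI 4 5 ∷ SUB 6 0 4 ∷ LOADI 4 0 ∷ ADD 5 4 6 ∷ LOADI 1 0 ∷ []

-- Doubling needs register 0 only, and no other register is free before the saving. Three doublings
-- suffice: 8L = 7 + x with L at most x, if L is at least 1, so the save area lies beyond all input
-- and within the heap region.
OCTUPLE : List Instr
OCTUPLE = ADD 0 0 0 ∷ ADD 0 0 0 ∷ ADD 0 0 0 ∷ []

-- Register 5 counts down in steps of 8 because only 8L is known.
TAKE : List Instr
TAKE = LOAD 4 6 ∷ STORE 3 4 ∷ ADD 3 2 3 ∷ STORE 3 1 ∷ SUB 1 3 2 ∷ ADD 3 2 3 ∷ ADD 6 2 6 ∷ LOADI 4 8 ∷ SUB 5 5 4 ∷ []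

takes : ℕ → ℕ → List Instr → List Instr
takes zero    l is = is
takes (suc c) l is = JZ 5 l ∷ TAKE ++ takes c l is

LOOP : ℕ → ℕ → List Instr
LOOP a l = JZ 5 l ∷ TAKE ++ JMP a ∷ []

CLEAR : List Instr
CLEAR = LOADI 2 0 ∷ LOADI 0 0 ∷ []

-- The first six tokens come from the save area; the later ones still stand in the registers from 7
-- on. `OCTUPLE` and `SAVE` have 3 + 19 instructions, each of the six blocks has 10 and the change
-- of source 1, which puts the loop at 83; its 11 instructions put the exit at 94.
prelude : List Instr
prelude = OCTUPLE ++ SAVE ++ takes 6 94 (LOADI 6 7 ∷ LOOP 83 94 ++ CLEAR)

record Reading (m : Memory) (k q j : ℕ) (v : Val) : Set where
  constructor reading
  field
    one  : m 2 ≡ 1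
    hp≡  : m 3 ≡ 7 + k
    src  : m 6 ≡ 7 + q
    todo : m 5 ≡ j
    list : Rep m k v (m 1)

reading-TAKE : ∀ {m k q j v t} → Reading m k q (8 + j) v → m (7 + q) ≡ t →
               Reading (applyAll TAKE m) (2 + k) (suc q) j (pair (num t) v) × Same m (applyAll TAKE m) k
reading-TAKE {m} {k} {q} {j} {v} {t} (reading o h s d r) c =
  reading r₂ r₃ r₆ r₅ (transport (Rep m′ (2 + k) (pair (num t) v)) (sym r₁)
    (alloc (num t) v c₀ (transport (Rep m k v) (sym c₁) r) same)) , same
  where
  m′ = applyAll TAKE m
  r₂ : m′ 2 ≡ 1
  r₂ rewrite h | o = refl
  r₃ : m′ 3 ≡ 9 + k
  r₃ rewrite h | o = refl
  r₆ : m′ 6 ≡ 8 + q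
  r₆ rewrite h | o | s = refl
  r₅ : m′ 5 ≡ j
  r₅ rewrite h | o | d = refl
  r₁ : m′ 1 ≡ 7 + k
  r₁ rewrite h | o = refl
  c₀ : m′ (7 + k) ≡ t
  c₀ rewrite h | o | s | ≡ᵇ-false (n<1+n k) | ≡ᵇ-refl k = c
  c₁ : m′ (8 + k) ≡ m 1
  c₁ rewrite h | o | ≡ᵇ-refl k = refl
  same : Same m m′ k
  same i lt rewrite h | o | ≡ᵇ-false lt | ≡ᵇ-false (<-trans lt (n<1+n k)) = refl

num-list : List ℕ → Val
num-list []       = num 0
num-list (n ∷ ns) = pair (num n) (num-list ns)

rev-onto : List ℕ → Val → Val
rev-onto []       v = v
rev-onto (n ∷ ns) v = rev-onto ns (pair (num n) v)

record Loaded (P : Program) (a : ℕ) (m : Memory) (l : ℕ) (v : Val) (t : ℕ) : Set where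
  constructor loaded
  field
    {mem} : Memory
    path  : Reach P a m l mem t
    {hp}  : ℕ
    hp≡   : mem 3 ≡ 7 + hp
    list  : Rep mem hp v (mem 1)

infixr 5 _▹_
_▹_ : ∀ {P a m b m′ l v s t} → Reach P a m b m′ s → Loaded P b m′ l v t → Loaded P a m l v (s + t)
p ▹ loaded q h r = loaded (p ⨾ q) h r

sooner : ∀ {P a m l v s t} → s ≤ t → Loaded P a m l v s → Loaded P a m l v t
sooner le (loaded p h r) = loaded (within le p) h r

-- The unread tokens lie below the heap end, so the list cells being allocated never overwrite them.
-- Each token is put in front, which reverses the input.
loop : ∀ {P a l} ts {m k q v} → At P a (LOOP a l) → Reading m k q (8 * length ts) v → q + length ts ≤ k →
       (∀ i → i < length ts → m (7 + (q + i)) ≡ nth ts i) → Loaded P a m l (rev-onto ts v) (1 + 11 * length ts)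
loop [] (jz ∷ _) (reading _ h _ d r) le c = loaded (jz₀ jz d) h r
loop {P} {a} {l} (t ∷ ts) {m} {k} {q} {v} at@(jz ∷ p) rd le c with At-++ {P} TAKE p
... | p₁ , (jm ∷ []) = sooner (≤-reflexive (arith (length ts)))
    (jz₁ jz (trans (Reading.todo rd) (*-suc 8 (length ts))) ▹ block TAKE _ p₁ ▹ jump jm ▹
     loop ts at (proj₁ next) (≤-trans (≤-reflexive (sym (+-suc q (length ts)))) (m≤n⇒m≤1+n (m≤n⇒m≤1+n le))) c′)
  where
  arith : ∀ n → 1 + (9 + (1 + (1 + 11 * n))) ≡ 1 + 11 * suc n
  arith = solve-∀
  rd′ : Reading m k q (8 + 8 * length ts) v
  rd′ = transport (λ j → Reading m k q j v) (*-suc 8 (length ts)) rd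
  next = reading-TAKE rd′ (trans (cong (λ x → m (7 + x)) (sym (+-identityʳ q))) (c 0 (s≤s z≤n)))
  c′ : ∀ i → i < length ts → applyAll TAKE m (7 + (suc q + i)) ≡ nth ts i
  c′ i lt = trans (proj₂ next (suc q + i) (≤-trans (≤-reflexive (sym (+-suc (suc q) i)))
                     (≤-trans (+-monoʳ-≤ (suc q) lt) (≤-trans (≤-reflexive (sym (+-suc q _))) le))))
                  (trans (cong (λ x → m (7 + x)) (sym (+-suc q i))) (c (suc i) (s≤s lt)))

-- Of the tokens `ts` still to be read, the first c are in the save area and the others start at
-- register 7. An input of fewer than six tokens leaves the chain at one of the `JZ`.
taking : ∀ {P a l b} c ts {is m k q v} → At P a (takes c l (LOADI 6 7 ∷ LOOP b l ++ is)) →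
         b ≡ suc (c * 10 + a) →
         Reading m k q (8 * length ts) v → q + c ≤ k → length ts ≤ c + k →
         (∀ i → i < c → m (7 + (q + i)) ≡ nth ts i) →
         (∀ i → c + i < length ts → m (7 + i) ≡ nth ts (c + i)) →
         Loaded P a m l (rev-onto ts v) (2 + 11 * length ts)
taking {P} {a} {l} zero ts {is} (i₁ ∷ p) refl (reading o h s d r) le le′ c c′ with At-++ {P} (LOOP (suc a) l) p
... | p₁ , _ = block (LOADI 6 7 ∷ []) tt (i₁ ∷ []) ▹
               loop ts p₁ (reading o h refl d (Rep-frame _ ≤-refl (λ _ _ → refl) r)) le′ c′
taking (suc c) [] (jz ∷ _) _ (reading _ h _ d r) _ _ _ _ = sooner (s≤s z≤n) (loaded (jz₀ jz d) h r)
taking {P} {a} {l} {b} (suc c) (t ∷ ts) {m = m} {k} {q} {v} (jz ∷ p) eq rd le le′ c₁ c₂ with At-++ {P} TAKE p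
... | p₁ , p₂ = sooner (≤-trans (n≤1+n _) (≤-reflexive (arith (length ts))))
    (jz₁ jz (trans (Reading.todo rd) (*-suc 8 (length ts))) ▹ block TAKE _ p₁ ▹
     taking c ts p₂ (trans eq (arith′ c a)) (proj₁ next)
       (≤-trans (≤-reflexive (sym (+-suc q c))) (m≤n⇒m≤1+n (m≤n⇒m≤1+n le)))
       (≤-trans (≤-pred le′) (+-monoʳ-≤ c (m≤n+m k 2))) c₁′ c₂′)
  where
  arith : ∀ n → suc (1 + (9 + (2 + 11 * n))) ≡ 2 + 11 * suc n
  arith = solve-∀
  arith′ : ∀ c a → suc (suc c * 10 + a) ≡ suc (c * 10 + (9 + suc a))
  arith′ = solve-∀
  rd′ : Reading m k q (8 + 8 * length ts) v
  rd′ = transport (λ j → Reading m k q j v) (*-suc 8 (length ts)) rd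
  next = reading-TAKE rd′ (trans (cong (λ x → m (7 + x)) (sym (+-identityʳ q))) (c₁ 0 (s≤s z≤n)))
  c₁′ : ∀ i → i < c → applyAll TAKE m (7 + (suc q + i)) ≡ nth ts i
  c₁′ i lt = trans (proj₂ next (suc q + i) (≤-trans (≤-reflexive (sym (+-suc (suc q) i)))
                     (≤-trans (+-monoʳ-≤ (suc q) lt) (≤-trans (≤-reflexive (sym (+-suc q _))) le))))
                   (trans (cong (λ x → m (7 + x)) (sym (+-suc q i))) (c₁ (suc i) (s≤s lt)))
  c₂′ : ∀ i → c + i < length ts → applyAll TAKE m (7 + i) ≡ nth ts (c + i)
  c₂′ i lt = trans (proj₂ next i (+-cancelˡ-< c _ _ (≤-trans lt (≤-pred le′)))) (c₂ i (s≤s lt))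

record Saved (m m′ : Memory) (x : ℕ) : Set where
  field
    rd    : Reading m′ (6 + x) x (7 + x) (num 0)
    saved : ∀ i → i < 6 → m′ (7 + (x + i)) ≡ m (suc i)
    same  : Same m m′ x

saving : ∀ {m x} → m 0 ≡ 7 + x → Saved m (applyAll SAVE m) x
saving {m} {x} h = record
  { rd = reading refl r₃ r₆ r₅ refl
  ; saved = λ i lt → trans (cong (λ y → m′ (7 + y)) (+-comm x i)) (s i lt)
  ; same = same }
  where
  m′ = applyAll SAVE m
  r₃ : m′ 3 ≡ 13 + x
  r₃ rewrite h = refl
  r₅ : m′ 5 ≡ 7 + x
  r₅ rewrite h = refl
  r₆ : m′ 6 ≡ 7 + x
  r₆ rewrite h = refl
  far : ∀ c → (x ≡ᵇ suc (c + x)) ≡ false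
  far c = ≡ᵇ-false (s≤s (m≤n+m x c))
  s : ∀ i → i < 6 → m′ (7 + (i + x)) ≡ m (suc i)
  s 0 _ rewrite h | far 0 | far 1 | far 2 | far 3 | far 4 | ≡ᵇ-refl x = refl
  s 1 _ rewrite h | far 0 | far 1 | far 2 | far 3 | ≡ᵇ-refl x = refl
  s 2 _ rewrite h | far 0 | far 1 | far 2 | ≡ᵇ-refl x = refl
  s 3 _ rewrite h | far 0 | far 1 | ≡ᵇ-refl x = refl
  s 4 _ rewrite h | far 0 | ≡ᵇ-refl x = refl
  s 5 _ rewrite h | ≡ᵇ-refl x = refl
  s (suc (suc (suc (suc (suc (suc i)))))) (s≤s (s≤s (s≤s (s≤s (s≤s (s≤s ()))))))
  beyond : ∀ {i} → i < x → ∀ c → (i ≡ᵇ c + x) ≡ false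
  beyond lt c = ≡ᵇ-false (≤-trans lt (m≤n+m x c))
  same : Same m m′ x
  same i lt rewrite h | beyond lt 0 | beyond lt 1 | beyond lt 2 | beyond lt 3 | beyond lt 4 | beyond lt 5 = refl

record Start (P : Program) (w : List ℕ) : Set where
  field
    {m}   : Memory
    {x}   : ℕ
    path  : Reach P 0 (initMem w) 22 m 22
    rd    : Reading m (6 + x) x (8 * length w) (num 0)
    saved : ∀ i → i < 6 → m (7 + (x + i)) ≡ nth w i
    large : length w ≤ x
    kept  : ∀ i → 6 + i < length w → m (7 + i) ≡ nth w (6 + i)

octuple : ∀ P m → At P 0 OCTUPLE → Σ Memory λ m′ →
          Reach P 0 m 3 m′ 3 × m′ 0 ≡ 8 * m 0 × (∀ i → m′ (suc i) ≡ m (suc i))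
octuple P m p = applyAll OCTUPLE m , block OCTUPLE tt p , octo (m 0) , λ _ → refl
  where
  octo : ∀ l → ((l + l) + (l + l)) + ((l + l) + (l + l)) ≡ 8 * l
  octo = solve-∀

saving-at : ∀ P {m x} → At P 3 SAVE → m 0 ≡ 7 + x → Σ Memory λ m′ → Reach P 3 m 22 m′ 19 × Saved m m′ x
saving-at P {m} p h = applyAll SAVE m , block SAVE tt p , saving h

start : ∀ {P} w → 1 ≤ length w → At P 0 OCTUPLE → At P 3 SAVE → Start P w
start {P} w ne p₁ p₂ with octuple P (initMem w) p₁
... | m₁ , q₁ , eight , same₁ with saving-at P {m₁} {m₁ 0 ∸ 7} p₂ (sym (m+[n∸m]≡n (≤-trans 7≤8L (≤-reflexive (sym eight)))))
  where
  7≤8L : 7 ≤ 8 * length w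
  7≤8L = ≤-trans (n≤1+n 7) (*-monoʳ-≤ 8 ne)
... | m₂ , q₂ , sv = record
  { path = q₁ ⨾ q₂
  ; rd = transport (λ j → Reading m₂ (6 + x) x j (num 0)) (trans (sym x≡) eight) (Saved.rd sv)
  ; saved = λ i lt → trans (Saved.saved sv i lt) (same₁ i)
  ; large = L≤x
  ; kept = λ i lt → trans (Saved.same sv i (≤-trans (≤-trans (s≤s (m≤n+m i 6)) lt) L≤x)) (same₁ (6 + i)) }
  where
  L = length w
  x = m₁ 0 ∸ 7
  big : 7 + L ≤ m₁ 0
  big = ≤-trans (+-monoˡ-≤ L (*-monoʳ-≤ 7 ne)) (≤-reflexive (trans (+-comm (7 * L) L) (sym eight)))
  x≡ : m₁ 0 ≡ 7 + x
  x≡ = sym (m+[n∸m]≡n (≤-trans (m≤m+n 7 L) big))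
  L≤x : L ≤ x
  L≤x = +-cancelˡ-≤ 7 _ _ (≤-trans big (≤-reflexive x≡))

clear : ∀ {P w v t} → At P 94 CLEAR → Loaded P 0 (initMem w) 94 v t →
        Reaches P 0 (initMem w) 96 v (num 0) (num 0) (t + 2)
clear {v = v} p (loaded {m} q {k} h r) = reaches (q ⨾ block CLEAR tt p)
  (state k h (Rep-frame v ≤-refl (λ _ _ → refl) r) refl refl)

takes-load : ∀ {P} w → Start P w → At P 22 (takes 6 94 (LOADI 6 7 ∷ LOOP 83 94 ++ CLEAR)) →
             Loaded P 0 (initMem w) 94 (rev-onto w (num 0)) (22 + (2 + 11 * length w))
takes-load w record { path = path ; rd = rd ; saved = saved ; large = large ; kept = kept } p =
  path ▹ taking 6 w {is = CLEAR} p refl rd (≤-reflexive (+-comm _ 6)) (≤-trans large (m≤n+m _ 12)) saved kept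

At-takes : ∀ {P a l is} c → At P a (takes c l is) → At P (c * 10 + a) is
At-takes zero p = p
At-takes {P} {a} {l} {is} (suc c) (_ ∷ p) = transport (λ b → At P b is) (shift c a) (At-takes c (proj₂ (At-++ TAKE p)))
  where
  shift : ∀ c a → c * 10 + (9 + suc a) ≡ suc c * 10 + a
  shift = solve-∀

preloaded : ∀ {P} w → 1 ≤ length w → At P 0 prelude →
            Reaches P 0 (initMem w) 96 (rev-onto w (num 0)) (num 0) (num 0) (22 + (2 + 11 * length w) + 2)
preloaded {P} w ne at with At-++ {P} OCTUPLE at
... | p₁ , p₂ with At-++ {P} SAVE p₂
... | p₃ , p₄ with At-takes 6 p₄
... | (_ ∷ p₅) = clear {w = w} (proj₂ (At-++ {P} (LOOP 83 94) p₅)) (takes-load w (start w ne p₁ p₃) p₄)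

-- The complete machine.

At-self : ∀ is → At is 0 is
At-self is = shifted [] is refl
  where
  fetch-mid : ∀ pre i is → fetch (pre ++ i ∷ is) (length pre) ≡ i
  fetch-mid [] i is = refl
  fetch-mid (_ ∷ pre) i is = fetch-mid pre i is
  shifted : ∀ {P} pre is → P ≡ pre ++ is → At P (length pre) is
  shifted pre [] eq = []
  shifted {P} pre (i ∷ is) refl = fetch-mid pre i is ∷
    transport (λ l → At P l is) (trans (length-++ pre) (+-comm (length pre) 1))
      (shifted (pre ++ i ∷ []) is (assoc pre))
    where
    assoc : ∀ pre → pre ++ i ∷ is ≡ (pre ++ i ∷ []) ++ is
    assoc [] = refl
    assoc (x ∷ pre) = cong (x ∷_) (assoc pre)

fetch-end : ∀ P k → fetch P (length P + k) ≡ HALT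
fetch-end [] k = refl
fetch-end (_ ∷ P) k = fetch-end P k

exec-mono : ∀ P f {g a m m′} → exec P f a m ≡ just m′ → exec P (f + g) a m ≡ just m′
exec-mono P (suc f) {g} {a} {m} eq with fetch P a
... | LOADI _ _ = exec-mono P f eq
... | ADD _ _ _ = exec-mono P f eq
... | SUB _ _ _ = exec-mono P f eq
... | LOAD _ _  = exec-mono P f eq
... | STORE _ _ = exec-mono P f eq
... | JMP _     = exec-mono P f eq
... | HALT      = eq
... | JZ r l with m r ≡ᵇ 0
...   | true  = exec-mono P f eq
...   | false = exec-mono P f eq

-- The prelude ends at 96 and seven instructions push the exit tag, so the body starts at 103. The
-- exit address is the first one past the program, where `fetch` returns `HALT`.
tail-code : Expr → ℕ → List Instr
tail-code B r = (LOADI 0 r ∷ PUSH) ++ code B 103 103 ++ dispatch (r ∷ sites B 103 103) (after B 103 103)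

exit-address : Expr → ℕ
exit-address B = length (dispatch (0 ∷ sites B 103 103) (after B 103 103)) + after B 103 103

machine : Expr → Program
machine B = prelude ++ tail-code B (exit-address B)

machine-reaches : ∀ {P B v m n t} → At P 96 (tail-code B (exit-address B)) → State m v (num 0) (num 0) →
  Run B v (num n) t →
  Reaches P 96 m (exit-address B) v (num n) (num 0) (7 + length (tail-code B (exit-address B)) * t)
machine-reaches {P} {B} {v} {m} {n} {t} at st (s , d , lt) with At-++ {P} (LOADI 0 (exit-address B) ∷ PUSH) at
... | p₁ , p₂ with At-++ {P} (code B 103 103) p₂
... | p₃ , p₄ = budget (+-monoʳ-≤ 7 (*-monoʳ-≤ M lt))
    (straightly (LOADI 0 r ∷ PUSH) tt p₁ (state-PUSH (state-LOADI r st)) ▸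
     simulate-body d {M = M} (ctx p₃ p₄ there room) (here refl))
  where
  r = exit-address B
  cB = code B 103 103
  cD = dispatch (r ∷ sites B 103 103) (after B 103 103)
  M = length (tail-code B r)
  room : length cB + length cD ≤ M
  room = ≤-trans (≤-reflexive (sym (length-++ cB))) (m≤n+m (length (cB ++ cD)) 7)

call-cost : Expr → ℕ
call-cost B = length (tail-code B (exit-address B))

exit-end : ∀ B → 7 + (length (code B 103 103) + length (dispatch (exit-address B ∷ sites B 103 103) (after B 103 103))) + 96
           ≡ exit-address B
exit-end B = arith (length (code B 103 103)) (length (dispatch (0 ∷ sites B 103 103) (after B 103 103)))
  where
  arith : ∀ x y → (7 + (x + y)) + 96 ≡ y + (x + 103)
  arith = solve-∀

call-cost-≡ : ∀ B → call-cost B ≡ 7 + (length (code B 103 103) + length (dispatch (exit-address B ∷ sites B 103 103) (after B 103 103)))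
call-cost-≡ B = cong (7 +_) (length-++ (code B 103 103))

At-parts : ∀ xs ys → At (xs ++ ys) 0 xs × At (xs ++ ys) (length xs + 0) ys
At-parts xs ys = At-++ xs (At-self (xs ++ ys))

fetch-after : ∀ xs ys → fetch (xs ++ ys) (length ys + length xs) ≡ HALT
fetch-after xs ys = trans (cong (fetch (xs ++ ys)) (sym (trans (+-identityʳ _) (trans (length-++ xs) (+-comm (length xs) _)))))
  (fetch-end (xs ++ ys) 0)

halting : ∀ {P m a v n s t} → Reaches P 0 m a v (num n) s t → fetch P a ≡ HALT →
          Σ Memory λ m′ → (∀ {T} → t + 1 ≤ T → exec P T 0 m ≡ just m′) × m′ 0 ≡ n
halting {P} {m} {a} {t = t} (reaches {m′} (reach s le path) st) eq = m′ , halts , State.inAcc st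
  where
  stop : exec P 1 a m′ ≡ just m′
  stop rewrite eq = refl
  halts : ∀ {T} → t + 1 ≤ T → exec P T 0 m ≡ just m′
  halts {T} big = trans (cong (λ f → exec P f 0 m) (sym (m+[n∸m]≡n (≤-trans (+-monoˡ-≤ 1 le) big))))
    (exec-mono P (s + 1) (trans (path 1) stop))

machine-halts : ∀ B w {n t} → 1 ≤ length w → Run B (rev-onto w (num 0)) (num n) t →
  Σ Memory λ m → (∀ {T} → (((22 + (2 + 11 * length w)) + 2) + (7 + call-cost B * t)) + 1 ≤ T →
                  exec (machine B) T 0 (initMem w) ≡ just m) × m 0 ≡ n
machine-halts B w ne r = halting
  (preloaded w ne (proj₁ parts) ▸ λ st → machine-reaches {B = B} (proj₂ parts) st r)
  (trans (cong (fetch (machine B)) (trans (sym (exit-end B)) (cong (_+ 96) (sym (call-cost-≡ B)))))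
         (fetch-after prelude (tail-code B (exit-address B))))
  where
  parts = At-parts prelude (tail-code B (exit-address B))

-- Substitution and the replacement of terms.

∨-false : ∀ {a b} → a ∨ b ≡ false → a ≡ false × b ≡ false
∨-false {false} p = refl , p

∧-true : ∀ {a b} → a ∧ b ≡ true → a ≡ true × b ≡ true
∧-true {true} p = refl , p

≡ᵇ-true : ∀ {x y} → (x ≡ᵇ y) ≡ true → x ≡ y
≡ᵇ-true {x} {y} p = ≡ᵇ⇒≡ x y (transport T (sym p) tt)

≡ᵇ-sym : ∀ x y → (x ≡ᵇ y) ≡ (y ≡ᵇ x)
≡ᵇ-sym zero    zero    = refl
≡ᵇ-sym zero    (suc y) = refl
≡ᵇ-sym (suc x) zero    = refl
≡ᵇ-sym (suc x) (suc y) = ≡ᵇ-sym x y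

positive : ∀ A → 1 ≤ len A
positive TOP = s≤s z≤n
positive BOT = s≤s z≤n
positive (atom _ _) = s≤s z≤n
positive (and _ _) = s≤s z≤n
positive (or _ _) = s≤s z≤n
positive (imp _ _) = s≤s z≤n
positive (all _ _) = s≤s z≤n
positive (ex _ _) = s≤s z≤n

len-subst : ∀ x t A → len (subst x t A) ≡ len A
len-subst x t TOP = refl
len-subst x t BOT = refl
len-subst x t (atom r ts) = cong suc (length-map (substT x t) ts)
len-subst x t (and A B) = cong₂ (λ a b → suc (a + b)) (len-subst x t A) (len-subst x t B)
len-subst x t (or A B)  = cong₂ (λ a b → suc (a + b)) (len-subst x t A) (len-subst x t B)
len-subst x t (imp A B) = cong₂ (λ a b → suc (a + b)) (len-subst x t A) (len-subst x t B)
len-subst x t (all y A) with x ≡ᵇ y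
... | true  = refl
... | false = cong (2 +_) (len-subst x t A)
len-subst x t (ex y A) with x ≡ᵇ y
... | true  = refl
... | false = cong (2 +_) (len-subst x t A)

substT-id : ∀ x t s → freeInT x s ≡ false → substT x t s ≡ s
substT-id x t (var y)   p rewrite p = refl
substT-id x t (const c) p = refl

substTs-id : ∀ x t ts → anyB (freeInT x) ts ≡ false → map (substT x t) ts ≡ ts
substTs-id x t []       p = refl
substTs-id x t (s ∷ ts) p = cong₂ _∷_ (substT-id x t s (proj₁ (∨-false p))) (substTs-id x t ts (proj₂ (∨-false {freeInT x s} p)))

subst-id : ∀ x t A → freeIn x A ≡ false → subst x t A ≡ A
subst-id x t TOP p = refl
subst-id x t BOT p = refl
subst-id x t (atom r ts) p = cong (atom r) (substTs-id x t ts p)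
subst-id x t (and A B) p = cong₂ and (subst-id x t A (proj₁ (∨-false p))) (subst-id x t B (proj₂ (∨-false {freeIn x A} p)))
subst-id x t (or A B) p  = cong₂ or (subst-id x t A (proj₁ (∨-false p))) (subst-id x t B (proj₂ (∨-false {freeIn x A} p)))
subst-id x t (imp A B) p = cong₂ imp (subst-id x t A (proj₁ (∨-false p))) (subst-id x t B (proj₂ (∨-false {freeIn x A} p)))
subst-id x t (all y A) p with x ≡ᵇ y
... | true  = refl
... | false = cong (all y) (subst-id x t A p)
subst-id x t (ex y A) p with x ≡ᵇ y
... | true  = refl
... | false = cong (ex y) (subst-id x t A p)

substitutable-const : ∀ c x A → substitutable (const c) x A ≡ true
substitutable-const c x TOP = refl
substitutable-const c x BOT = refl
substitutable-const c x (atom r ts) = refl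
substitutable-const c x (and A B) rewrite substitutable-const c x A = substitutable-const c x B
substitutable-const c x (or A B)  rewrite substitutable-const c x A = substitutable-const c x B
substitutable-const c x (imp A B) rewrite substitutable-const c x A = substitutable-const c x B
substitutable-const c x (all y A) with not (x ≡ᵇ y) ∧ freeIn x A
... | true  = substitutable-const c x A
... | false = refl
substitutable-const c x (ex y A) with not (x ≡ᵇ y) ∧ freeIn x A
... | true  = substitutable-const c x A
... | false = refl

bound : (Term → Term) → ℕ → Term → Term
bound φ x (var y)   = if x ≡ᵇ y then var y else φ (var y)
bound φ x (const c) = φ (const c)

replace : (Term → Term) → Formula → Formula
replace φ TOP         = TOP
replace φ BOT         = BOT
replace φ (atom r ts) = atom r (map φ ts)
replace φ (and A B)   = and (replace φ A) (replace φ B)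
replace φ (or A B)    = or (replace φ A) (replace φ B)
replace φ (imp A B)   = imp (replace φ A) (replace φ B)
replace φ (all x A)   = all x (replace (bound φ x) A)
replace φ (ex x A)    = ex x (replace (bound φ x) A)

-- Tame replacements cannot be captured and introduce no free variable.
Tame : (Term → Term) → Set
Tame φ = ∀ t → φ t ≡ t ⊎ φ t ≡ const 0

tame-bound : ∀ {φ} x → Tame φ → Tame (bound φ x)
tame-bound x h (var y) with x ≡ᵇ y
... | true  = inj₁ refl
... | false = h (var y)
tame-bound x h (const c) = h (const c)

freeInT-tame : ∀ {φ x} t → Tame φ → freeInT x t ≡ false → freeInT x (φ t) ≡ false
freeInT-tame t h p with h t
... | inj₁ eq rewrite eq = p
... | inj₂ eq rewrite eq = refl

freeIn-replace : ∀ {φ} x A → Tame φ → freeIn x A ≡ false → freeIn x (replace φ A) ≡ false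
freeIn-replace x TOP h p = refl
freeIn-replace x BOT h p = refl
freeIn-replace {φ} x (atom r ts) h p = go ts p
  where
  go : ∀ ts → anyB (freeInT x) ts ≡ false → anyB (freeInT x) (map φ ts) ≡ false
  go [] p = refl
  go (t ∷ ts) p rewrite freeInT-tame {φ} {x} t h (proj₁ (∨-false p)) = go ts (proj₂ (∨-false {freeInT x t} p))
freeIn-replace {φ} x (and A B) h p
  rewrite freeIn-replace {φ} x A h (proj₁ (∨-false p)) = freeIn-replace x B h (proj₂ (∨-false {freeIn x A} p))
freeIn-replace {φ} x (or A B) h p
  rewrite freeIn-replace {φ} x A h (proj₁ (∨-false p)) = freeIn-replace x B h (proj₂ (∨-false {freeIn x A} p))
freeIn-replace {φ} x (imp A B) h p
  rewrite freeIn-replace {φ} x A h (proj₁ (∨-false p)) = freeIn-replace x B h (proj₂ (∨-false {freeIn x A} p))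
freeIn-replace x (all y A) h p with x ≡ᵇ y
... | true  = refl
... | false = freeIn-replace x A (tame-bound y h) p
freeIn-replace x (ex y A) h p with x ≡ᵇ y
... | true  = refl
... | false = freeIn-replace x A (tame-bound y h) p

AgreeOn : Formula → (Term → Term) → (Term → Term) → Set
AgreeOn A φ ψ = (∀ c → φ (const c) ≡ ψ (const c)) × (∀ y → freeIn y A ≡ true → φ (var y) ≡ ψ (var y))

agree-bound : ∀ {A φ ψ} x → (∀ c → φ (const c) ≡ ψ (const c)) →
              (∀ y → not (y ≡ᵇ x) ∧ freeIn y A ≡ true → φ (var y) ≡ ψ (var y)) →
              AgreeOn A (bound φ x) (bound ψ x)
agree-bound {A} {φ} {ψ} x hc hv = hc , go
  where
  go : ∀ y → freeIn y A ≡ true → bound φ x (var y) ≡ bound ψ x (var y)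
  go y p with x ≡ᵇ y in eq
  ... | true  = refl
  ... | false = hv y (cong₂ (λ a b → not a ∧ b) (trans (≡ᵇ-sym y x) eq) p)

true-∨ˡ : ∀ {a b} → a ≡ true → a ∨ b ≡ true
true-∨ˡ refl = refl
true-∨ʳ : ∀ {a b} → b ≡ true → a ∨ b ≡ true
true-∨ʳ {true}  _ = refl
true-∨ʳ {false} p = p

replace-agree : ∀ A {φ ψ} → AgreeOn A φ ψ → replace φ A ≡ replace ψ A
replace-agree TOP h = refl
replace-agree BOT h = refl
replace-agree (atom r ts) {φ} {ψ} (hc , hv) = cong (atom r) (go ts hv)
  where
  go : ∀ ts → (∀ y → anyB (freeInT y) ts ≡ true → φ (var y) ≡ ψ (var y)) → map φ ts ≡ map ψ ts
  go [] h = refl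
  go (const c ∷ ts) h = cong₂ _∷_ (hc c) (go ts h)
  go (var y ∷ ts) h = cong₂ _∷_ (h y (true-∨ˡ (≡ᵇ-refl y))) (go ts λ z p → h z (true-∨ʳ p))
replace-agree (and A B) (hc , hv) =
  cong₂ and (replace-agree A (hc , λ y p → hv y (true-∨ˡ p))) (replace-agree B (hc , λ y p → hv y (true-∨ʳ p)))
replace-agree (or A B) (hc , hv) =
  cong₂ or (replace-agree A (hc , λ y p → hv y (true-∨ˡ p))) (replace-agree B (hc , λ y p → hv y (true-∨ʳ p)))
replace-agree (imp A B) (hc , hv) =
  cong₂ imp (replace-agree A (hc , λ y p → hv y (true-∨ˡ p))) (replace-agree B (hc , λ y p → hv y (true-∨ʳ p)))
replace-agree (all x A) {φ} {ψ} (hc , hv) = cong (all x) (replace-agree A (agree-bound {A} {φ} {ψ} x hc hv))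
replace-agree (ex x A)  {φ} {ψ} (hc , hv) = cong (ex x) (replace-agree A (agree-bound {A} {φ} {ψ} x hc hv))

pointwise : ∀ A {φ ψ} → (∀ t → φ t ≡ ψ t) → AgreeOn A φ ψ
pointwise A h = (λ c → h (const c)) , λ y _ → h (var y)

bound-swap : ∀ φ x y t → bound (bound φ x) y t ≡ bound (bound φ y) x t
bound-swap φ x y (const c) = refl
bound-swap φ x y (var z) with x ≡ᵇ z | y ≡ᵇ z
... | true  | true  = refl
... | true  | false = refl
... | false | true  = refl
... | false | false = refl

bound-idem : ∀ φ x t → bound (bound φ x) x t ≡ bound φ x t
bound-idem φ x (const c) = refl
bound-idem φ x (var z) with x ≡ᵇ z
... | true  = refl
... | false = refl

bound-other : ∀ φ y t → freeInT y t ≡ false → bound φ y t ≡ φ t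
bound-other φ y (var z) p rewrite p = refl
bound-other φ y (const c) p = refl

replaceT-subst : ∀ {φ} x t s → Tame φ → φ (substT x t s) ≡ substT x (φ t) (bound φ x s)
replaceT-subst {φ} x t (const c) h with h (const c)
... | inj₁ eq rewrite eq = refl
... | inj₂ eq rewrite eq = refl
replaceT-subst {φ} x t (var y) h with x ≡ᵇ y in e
... | true rewrite e = refl
... | false with h (var y)
...   | inj₁ eq rewrite eq | e = refl
...   | inj₂ eq rewrite eq = refl

-- On the right x is a placeholder and has to survive the replacement, hence `bound φ x`. Tameness
-- prevents another term from being replaced by x and then caught by the substitution.
replace-subst : ∀ A {φ} x t → Tame φ → substitutable t x A ≡ true →
                replace φ (subst x t A) ≡ subst x (φ t) (replace (bound φ x) A)

replace-subst-under : ∀ A {φ} x y t → Tame φ → (x ≡ᵇ y) ≡ false →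
  not (not (x ≡ᵇ y) ∧ freeIn x A) ∨ (not (freeInT y t) ∧ substitutable t x A) ≡ true →
  replace (bound φ y) (subst x t A) ≡ subst x (φ t) (replace (bound (bound φ x) y) A)
replace-subst-under A {φ} x y t h ne p rewrite ne with freeIn x A in fr
... | true  with freeInT y t in ft
...   | false =
  trans (replace-subst A x t (tame-bound y h) p)
    (cong₂ (subst x) (bound-other φ y t ft) (replace-agree A (pointwise A (bound-swap φ y x))))
replace-subst-under A {φ} x y t h ne p | false =
  trans (cong (replace (bound φ y)) (subst-id x t A fr))
    (trans (replace-agree A ((λ c → refl) , agree))
      (sym (subst-id x (φ t) _ (freeIn-replace x A (tame-bound y (tame-bound x h)) fr))))
  where
  agree : ∀ z → freeIn z A ≡ true → bound φ y (var z) ≡ bound (bound φ x) y (var z)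
  agree z q with x ≡ᵇ z in e
  ... | false = refl
  ... | true with ≡ᵇ-true {x} e
  ...   | refl with trans (sym q) fr
  ...     | ()

replace-subst TOP x t h p = refl
replace-subst BOT x t h p = refl
replace-subst (atom r ts) {φ} x t h p = cong (atom r) (go ts)
  where
  go : ∀ ts → map φ (map (substT x t) ts) ≡ map (substT x (φ t)) (map (bound φ x) ts)
  go [] = refl
  go (s ∷ ts) = cong₂ _∷_ (replaceT-subst x t s h) (go ts)
replace-subst (and A B) x t h p =
  cong₂ and (replace-subst A x t h (proj₁ (∧-true p))) (replace-subst B x t h (proj₂ (∧-true {substitutable t x A} p)))
replace-subst (or A B) x t h p =
  cong₂ or (replace-subst A x t h (proj₁ (∧-true p))) (replace-subst B x t h (proj₂ (∧-true {substitutable t x A} p)))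
replace-subst (imp A B) x t h p =
  cong₂ imp (replace-subst A x t h (proj₁ (∧-true p))) (replace-subst B x t h (proj₂ (∧-true {substitutable t x A} p)))
replace-subst (all y A) {φ} x t h p with x ≡ᵇ y in e
... | false = cong (all y) (replace-subst-under A x y t h e
  (trans (cong (λ b → not (not b ∧ freeIn x A) ∨ (not (freeInT y t) ∧ substitutable t x A)) e) p))
... | true with ≡ᵇ-true {x} e
...   | refl = cong (all x) (replace-agree A (pointwise A (λ s → sym (bound-idem φ x s))))
replace-subst (ex y A) {φ} x t h p with x ≡ᵇ y in e
... | false = cong (ex y) (replace-subst-under A x y t h e
  (trans (cong (λ b → not (not b ∧ freeIn x A) ∨ (not (freeInT y t) ∧ substitutable t x A)) e) p))
... | true with ≡ᵇ-true {x} e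
...   | refl = cong (ex x) (replace-agree A (pointwise A (λ s → sym (bound-idem φ x s))))

-- Two replacements, because φ becomes `bound φ y` under a quantifier while the substituted term is
-- always replaced by the outer ψ. Tame replacements create no free variable, so they create no
-- capture.
substitutable-replace : ∀ A {φ ψ} x t → Tame φ → Tame ψ → substitutable t x A ≡ true →
                        substitutable (ψ t) x (replace φ A) ≡ true

substitutable-under : ∀ A {φ ψ} x y t → Tame φ → Tame ψ →
  not (not (x ≡ᵇ y) ∧ freeIn x A) ∨ (not (freeInT y t) ∧ substitutable t x A) ≡ true →
  not (not (x ≡ᵇ y) ∧ freeIn x (replace (bound φ y) A)) ∨
    (not (freeInT y (ψ t)) ∧ substitutable (ψ t) x (replace (bound φ y) A)) ≡ true
substitutable-under A {φ} {ψ} x y t h k p with x ≡ᵇ y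
... | true  = refl
... | false with freeIn x A in fr
...   | false rewrite freeIn-replace x A (tame-bound y h) fr = refl
...   | true with freeInT y t in ft
...     | false rewrite freeInT-tame {ψ} t k ft =
  true-∨ʳ {not (freeIn x (replace (bound φ y) A))} (substitutable-replace A x t (tame-bound y h) k p)

substitutable-replace TOP x t h k p = refl
substitutable-replace BOT x t h k p = refl
substitutable-replace (atom r ts) x t h k p = refl
substitutable-replace (and A B) {φ} {ψ} x t h k p
  rewrite substitutable-replace A {φ} {ψ} x t h k (proj₁ (∧-true p)) =
  substitutable-replace B x t h k (proj₂ (∧-true {substitutable t x A} p))
substitutable-replace (or A B) {φ} {ψ} x t h k p
  rewrite substitutable-replace A {φ} {ψ} x t h k (proj₁ (∧-true p)) =
  substitutable-replace B x t h k (proj₂ (∧-true {substitutable t x A} p))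
substitutable-replace (imp A B) {φ} {ψ} x t h k p
  rewrite substitutable-replace A {φ} {ψ} x t h k (proj₁ (∧-true p)) =
  substitutable-replace B x t h k (proj₂ (∧-true {substitutable t x A} p))
substitutable-replace (all y A) x t h k p = substitutable-under A x y t h k p
substitutable-replace (ex y A)  x t h k p = substitutable-under A x y t h k p

-- All argument occurrences, with repetitions and bound variables. Additional terms only add sound
-- clauses, and occurrences are what the length of the formula pays for.
args : Formula → List Term
args TOP         = []
args BOT         = []
args (atom r ts) = ts
args (and A B)   = args A ++ args B
args (or A B)    = args A ++ args B
args (imp A B)   = args A ++ args B
args (all x A)   = args A
args (ex x A)    = args A

replace-fixed : ∀ A {φ} → (∀ {t} → t ∈ args A → φ t ≡ t) → replace φ A ≡ A
replace-fixed TOP h = refl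
replace-fixed BOT h = refl
replace-fixed (atom r ts) {φ} h = cong (atom r) (go ts h)
  where
  go : ∀ ts → (∀ {t} → t ∈ ts → φ t ≡ t) → map φ ts ≡ ts
  go [] h = refl
  go (t ∷ ts) h = cong₂ _∷_ (h (here refl)) (go ts (λ i → h (there i)))
replace-fixed (and A B) h = cong₂ and (replace-fixed A (λ i → h (∈-++⁺ˡ i))) (replace-fixed B (λ i → h (∈-++⁺ʳ (args A) i)))
replace-fixed (or A B) h  = cong₂ or (replace-fixed A (λ i → h (∈-++⁺ˡ i))) (replace-fixed B (λ i → h (∈-++⁺ʳ (args A) i)))
replace-fixed (imp A B) h = cong₂ imp (replace-fixed A (λ i → h (∈-++⁺ˡ i))) (replace-fixed B (λ i → h (∈-++⁺ʳ (args A) i)))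
replace-fixed (all x A) {φ} h = cong (all x) (replace-fixed A λ {t} i → fixed t (h i))
  where
  fixed : ∀ t → φ t ≡ t → bound φ x t ≡ t
  fixed (const c) p = p
  fixed (var y) p with x ≡ᵇ y
  ... | true  = refl
  ... | false = p
replace-fixed (ex x A) {φ} h = cong (ex x) (replace-fixed A λ {t} i → fixed t (h i))
  where
  fixed : ∀ t → φ t ≡ t → bound φ x t ≡ t
  fixed (const c) p = p
  fixed (var y) p with x ≡ᵇ y
  ... | true  = refl
  ... | false = p

-- Horn clauses for the instances of subformulas

Clause : Set
Clause = List Formula × Formula

data Horn (cs : List Clause) : Formula → Set where
  by : ∀ {ps c} → (ps , c) ∈ cs → All (Horn cs) ps → Horn cs c

same : Formula → Formula → Clause → List Clause
same A B c = if does (A ≟F B) then c ∷ [] else []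

-- Serves both quantifiers. One direction is the rule with the side condition on x; the other is the
-- substitution rule, where the instance equals A for every term.
vacuous : ℕ → Formula → Formula → List Clause
vacuous x A u = if freeIn x A then [] else ((A ∷ [] , u) ∷ (u ∷ [] , A) ∷ [])

instance-clauses : (Formula → List Clause) → (Formula → Clause) → ℕ → Formula → Term → List Clause
instance-clauses cl rule x A t =
  if substitutable t x A then cl (subst x t A) ++ rule (subst x t A) ∷ [] else []

-- The first argument k bounds the recursion depth; it should be at least the length of the formula.
clauses : List Term → ℕ → Formula → List Clause
clauses Ts zero    u = []
clauses Ts (suc k) TOP = ([] , TOP) ∷ []
clauses Ts (suc k) BOT = []
clauses Ts (suc k) (atom r ts) = []
clauses Ts (suc k) u@(and A B) =
  (A ∷ B ∷ [] , u) ∷ (u ∷ [] , A) ∷ (u ∷ [] , B) ∷ (clauses Ts k A ++ clauses Ts k B)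
clauses Ts (suc k) u@(or A B) =
  (A ∷ [] , u) ∷ (B ∷ [] , u) ∷ (same A B (u ∷ [] , A) ++ (clauses Ts k A ++ clauses Ts k B))
clauses Ts (suc k) u@(imp A B) =
  (B ∷ [] , u) ∷ (u ∷ A ∷ [] , B) ∷ (same A B ([] , u) ++ (clauses Ts k A ++ clauses Ts k B))
clauses Ts (suc k) u@(all x A) =
  vacuous x A u ++ concatMap (instance-clauses (clauses Ts k) (λ B → u ∷ [] , B) x A) Ts
clauses Ts (suc k) u@(ex x A) =
  vacuous x A u ++ concatMap (instance-clauses (clauses Ts k) (λ B → B ∷ [] , u) x A) Ts

facts : List Term → List Formula → List Clause
facts Ts []       = []
facts Ts (A ∷ As) = ([] , A) ∷ (clauses Ts (len A) A ++ facts Ts As)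

-- By normalization ex falso is needed for the goal only.
problem : List Term → List Formula → Formula → List Clause
problem Ts H Q = (BOT ∷ [] , Q) ∷ (clauses Ts (len Q) Q ++ facts Ts H)

-- Soundness of the clauses.

module _ {H : List Formula} where

  Sound : Clause → Set
  Sound (ps , c) = All (H ⊢_) ps → H ⊢ c

  sound-same : ∀ {A B c} → (A ≡ B → Sound c) → ∀ {d} → d ∈ same A B c → Sound d
  sound-same {A} {B} h d with A ≟F B
  sound-same h (here refl) | yes eq = h eq

  sound-instances : ∀ {cl rule x A} Ts → (∀ {B d} → d ∈ cl B → Sound d) →
    (∀ t → substitutable t x A ≡ true → Sound (rule (subst x t A))) →
    ∀ {d} → d ∈ concatMap (instance-clauses cl rule x A) Ts → Sound d
  sound-instances {cl} {rule} {x} {A} (t ∷ Ts) h r {d} i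
    with ∈-++⁻ (instance-clauses cl rule x A t) i
  ... | inj₂ j = sound-instances {cl} {rule} {x} {A} Ts h r j
  ... | inj₁ j with substitutable t x A in s
  ...   | true with ∈-++⁻ (cl (subst x t A)) j
  ...     | inj₁ k = h k
  ...     | inj₂ (here refl) = r t s

  sound-clauses : ∀ Ts k A {d} → d ∈ clauses Ts k A → Sound d
  sound-both : ∀ Ts k A B {d} → d ∈ clauses Ts k A ++ clauses Ts k B → Sound d
  sound-both Ts k A B i with ∈-++⁻ (clauses Ts k A) i
  ... | inj₁ j = sound-clauses Ts k A j
  ... | inj₂ j = sound-clauses Ts k B j
  sound-clauses Ts (suc k) TOP (here refl) _ = axTop
  sound-clauses Ts (suc k) (and A B) (here refl) (a ∷ b ∷ []) = andI a b
  sound-clauses Ts (suc k) (and A B) (there (here refl)) (u ∷ []) = andE₁ u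
  sound-clauses Ts (suc k) (and A B) (there (there (here refl))) (u ∷ []) = andE₂ u
  sound-clauses Ts (suc k) (and A B) (there (there (there i))) = sound-both Ts k A B i
  sound-clauses Ts (suc k) (or A B) (here refl) (a ∷ []) = orI₁ a
  sound-clauses Ts (suc k) (or A B) (there (here refl)) (b ∷ []) = orI₂ b
  sound-clauses Ts (suc k) (or A B) (there (there i)) with ∈-++⁻ (same A B _) i
  ... | inj₁ j = sound-same {A} {B} (λ { refl (u ∷ []) → orC u }) j
  ... | inj₂ j = sound-both Ts k A B j
  sound-clauses Ts (suc k) (imp A B) (here refl) (b ∷ []) = impI b
  sound-clauses Ts (suc k) (imp A B) (there (here refl)) (u ∷ a ∷ []) = mp a u
  sound-clauses Ts (suc k) (imp A B) (there (there i)) with ∈-++⁻ (same A B _) i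
  ... | inj₁ j = sound-same {A} {B} (λ { refl _ → axId }) j
  ... | inj₂ j = sound-both Ts k A B j
  sound-clauses Ts (suc k) (all x A) i with ∈-++⁻ (vacuous x A (all x A)) i
  ... | inj₂ j =
    sound-instances {clauses Ts k} {λ B → all x A ∷ [] , B} {x} {A} Ts (sound-clauses Ts k _) (λ { t s (u ∷ []) → allE {x = x} {A} s u }) j
  ... | inj₁ j with freeIn x A in f
  sound-clauses Ts (suc k) (all x A) i | inj₁ (here refl) | false = λ { (a ∷ []) → allI f a }
  sound-clauses Ts (suc k) (all x A) i | inj₁ (there (here refl)) | false = λ { (u ∷ []) →
    transport (H ⊢_) (subst-id x (const 0) A f) (allE (substitutable-const 0 x A) u) }
  sound-clauses Ts (suc k) (ex x A) i with ∈-++⁻ (vacuous x A (ex x A)) i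
  ... | inj₂ j =
    sound-instances {clauses Ts k} {λ B → B ∷ [] , ex x A} {x} {A} Ts (sound-clauses Ts k _) (λ { t s (u ∷ []) → exI {x = x} {A} s u }) j
  ... | inj₁ j with freeIn x A in f
  sound-clauses Ts (suc k) (ex x A) i | inj₁ (here refl) | false = λ { (a ∷ []) →
    exI {t = const 0} (substitutable-const 0 x A) (transport (H ⊢_) (sym (subst-id x (const 0) A f)) a) }
  sound-clauses Ts (suc k) (ex x A) i | inj₁ (there (here refl)) | false = λ { (u ∷ []) → exE f u }

  sound-facts : ∀ Ts As → As ⊆ H → ∀ {d} → d ∈ facts Ts As → Sound d
  sound-facts Ts (A ∷ As) sub (here refl) _ = hyp (sub (here refl))
  sound-facts Ts (A ∷ As) sub (there i) with ∈-++⁻ (clauses Ts (len A) A) i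
  ... | inj₁ j = sound-clauses Ts (len A) A j
  ... | inj₂ j = sound-facts Ts As (λ x → sub (there x)) j

  sound-problem : ∀ Ts Q {d} → d ∈ problem Ts H Q → Sound d
  sound-problem Ts Q (here refl) (b ∷ []) = botE b
  sound-problem Ts Q (there i) with ∈-++⁻ (clauses Ts (len Q) Q) i
  ... | inj₁ j = sound-clauses Ts (len Q) Q j
  ... | inj₂ j = sound-facts Ts H (λ x → x) j

  sound-Horn : ∀ {cs} → (∀ {d} → d ∈ cs → Sound d) → ∀ {A} → Horn cs A → H ⊢ A
  sound-Horns : ∀ {cs} → (∀ {d} → d ∈ cs → Sound d) → ∀ {As} → All (Horn cs) As → All (H ⊢_) As
  sound-Horn h (by i ps) = h i (sound-Horns h ps)
  sound-Horns h [] = []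
  sound-Horns h (p ∷ ps) = sound-Horn h p ∷ sound-Horns h ps

-- Completeness of the clauses.

same-refl : ∀ A c → same A A c ≡ c ∷ []
same-refl A c with A ≟F A
... | yes _ = refl
... | no ne = ⊥-elim (ne refl)

vacuous-∉ : ∀ x A u → freeIn x A ≡ false → vacuous x A u ≡ (A ∷ [] , u) ∷ (u ∷ [] , A) ∷ []
vacuous-∉ x A u p rewrite p = refl

∈-instances : ∀ {cl rule x A t Ts} → t ∈ Ts → substitutable t x A ≡ true →
  cl (subst x t A) ++ rule (subst x t A) ∷ [] ⊆ concatMap (instance-clauses cl rule x A) Ts
∈-instances {cl} {rule} {x} {A} {t} {t ∷ Ts} (here refl) s {d} i = ∈-++⁺ˡ (go s)
  where
  go : substitutable t x A ≡ true → d ∈ instance-clauses cl rule x A t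
  go s rewrite s = i
∈-instances {cl} {rule} {x} {A} {t} {t′ ∷ Ts} (there j) s i =
  ∈-++⁺ʳ (instance-clauses cl rule x A t′) (∈-instances {cl} {rule} {x} {A} j s i)

module Completeness (Ts : List Term) (0∈Ts : const 0 ∈ Ts) (cs : List Clause) where

  D : Formula → Set
  D = Horn cs

  -- The depth is existential because a component or an instance inherits the remaining depth of the
  -- formula above it, which may exceed its own length.
  record Covered (A : Formula) : Set where
    constructor covered
    field
      {depth} : ℕ
      deep    : len A ≤ depth
      inside  : clauses Ts depth A ⊆ cs

  -- Formulas have positive length, so the depth is a successor; with this exposed, `clauses`
  -- computes.
  data Covered′ : Formula → Set where
    covered′ : ∀ {A} k → len A ≤ suc k → clauses Ts (suc k) A ⊆ cs → Covered′ A

  unfold : ∀ {A} → Covered A → Covered′ A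
  unfold {A} (covered {zero} d _) with ≤-trans (positive A) d
  ... | ()
  unfold (covered {suc k} d i) = covered′ k d i

  and-coveredˡ : ∀ {A B} → Covered (and A B) → Covered A
  and-coveredˡ {A} {B} c with unfold c
  ... | covered′ k d i = covered (≤-trans (m≤m+n (len A) (len B)) (≤-pred d)) λ j → i (there (there (there (∈-++⁺ˡ j))))
  and-coveredʳ : ∀ {A B} → Covered (and A B) → Covered B
  and-coveredʳ {A} {B} c with unfold c
  ... | covered′ k d i =
    covered (≤-trans (m≤n+m (len B) (len A)) (≤-pred d)) λ j → i (there (there (there (∈-++⁺ʳ (clauses Ts k A) j))))
  or-coveredˡ : ∀ {A B} → Covered (or A B) → Covered A
  or-coveredˡ {A} {B} c with unfold c
  ... | covered′ k d i =
    covered (≤-trans (m≤m+n (len A) (len B)) (≤-pred d)) λ j → i (there (there (∈-++⁺ʳ (same A B _) (∈-++⁺ˡ j))))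
  or-coveredʳ : ∀ {A B} → Covered (or A B) → Covered B
  or-coveredʳ {A} {B} c with unfold c
  ... | covered′ k d i =
    covered (≤-trans (m≤n+m (len B) (len A)) (≤-pred d)) λ j → i (there (there (∈-++⁺ʳ (same A B _) (∈-++⁺ʳ (clauses Ts k A) j))))
  imp-coveredˡ : ∀ {A B} → Covered (imp A B) → Covered A
  imp-coveredˡ {A} {B} c with unfold c
  ... | covered′ k d i =
    covered (≤-trans (m≤m+n (len A) (len B)) (≤-pred d)) λ j → i (there (there (∈-++⁺ʳ (same A B _) (∈-++⁺ˡ j))))
  imp-coveredʳ : ∀ {A B} → Covered (imp A B) → Covered B
  imp-coveredʳ {A} {B} c with unfold c
  ... | covered′ k d i =
    covered (≤-trans (m≤n+m (len B) (len A)) (≤-pred d)) λ j → i (there (there (∈-++⁺ʳ (same A B _) (∈-++⁺ʳ (clauses Ts k A) j))))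

  len-instance : ∀ {k} x t A → 2 + len A ≤ suc k → len (subst x t A) ≤ k
  len-instance x t A d = ≤-trans (≤-reflexive (len-subst x t A)) (≤-trans (m≤n+m (len A) 1) (≤-pred d))

  all-instance : ∀ {x A t} → t ∈ Ts → substitutable t x A ≡ true → Covered (all x A) → Covered (subst x t A)
  all-instance {x} {A} {t} t∈ s c with unfold c
  ... | covered′ k d i = covered {depth = k} (len-instance x t A d)
    λ j → i (∈-++⁺ʳ (vacuous x A (all x A)) (∈-instances {clauses Ts k} {λ B → all x A ∷ [] , B} {x} {A} t∈ s (∈-++⁺ˡ j)))

  ex-instance : ∀ {x A t} → t ∈ Ts → substitutable t x A ≡ true → Covered (ex x A) → Covered (subst x t A)
  ex-instance {x} {A} {t} t∈ s c with unfold c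
  ... | covered′ k d i = covered {depth = k} (len-instance x t A d)
    λ j → i (∈-++⁺ʳ (vacuous x A (ex x A)) (∈-instances {clauses Ts k} {λ B → B ∷ [] , ex x A} {x} {A} t∈ s (∈-++⁺ˡ j)))

  all-vacuous : ∀ {x A} → freeIn x A ≡ false → Covered (all x A) → Covered A
  all-vacuous {x} {A} f c = transport Covered (subst-id x (const 0) A f) (all-instance {x} {A} 0∈Ts (substitutable-const 0 x A) c)

  ex-vacuous : ∀ {x A} → freeIn x A ≡ false → Covered (ex x A) → Covered A
  ex-vacuous {x} {A} f c = transport Covered (subst-id x (const 0) A f) (ex-instance {x} {A} 0∈Ts (substitutable-const 0 x A) c)

  -- V contains the derivable covered formulas and is closed under the introduction rules
  -- only; closure under the elimination rules is then a matter of inversion.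
  data V : Formula → Set where
    given : ∀ {A} → D A → Covered A → V A
    bot   : ∀ {A} → D BOT → V A
    top   : V TOP
    and   : ∀ {A B} → V A → V B → V (and A B)
    orˡ   : ∀ {A B} → V A → V (or A B)
    orʳ   : ∀ {A B} → V B → V (or A B)
    imp   : ∀ {A B} → V B → V (imp A B)
    id    : ∀ {A} → V (imp A A)
    all   : ∀ {x A} → freeIn x A ≡ false → V A → V (all x A)
    ex    : ∀ {x A t} → t ∈ Ts → substitutable t x A ≡ true → V (subst x t A) → V (ex x A)

  -- Whatever an introduction of a covered formula starts from is covered too, so every introduction
  -- is the application of a clause. Only ex falso has no clause for arbitrary A, hence the
  -- alternative.
  V⇒D : ∀ {A} → V A → Covered A → D A ⊎ D BOT
  V⇒D (given d _) c = inj₁ d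
  V⇒D (bot b) c = inj₂ b
  V⇒D top c with unfold c
  ... | covered′ k _ i = inj₁ (by (i (here refl)) [])
  V⇒D (and {A} {B} a b) c with V⇒D a (and-coveredˡ c) | V⇒D b (and-coveredʳ c) | unfold c
  ... | inj₂ e | _      | _ = inj₂ e
  ... | inj₁ _ | inj₂ e | _ = inj₂ e
  ... | inj₁ p | inj₁ q | covered′ k _ i = inj₁ (by (i (here refl)) (p ∷ q ∷ []))
  V⇒D (orˡ a) c with V⇒D a (or-coveredˡ c) | unfold c
  ... | inj₂ e | _ = inj₂ e
  ... | inj₁ p | covered′ k _ i = inj₁ (by (i (here refl)) (p ∷ []))
  V⇒D (orʳ b) c with V⇒D b (or-coveredʳ c) | unfold c
  ... | inj₂ e | _ = inj₂ e
  ... | inj₁ p | covered′ k _ i = inj₁ (by (i (there (here refl))) (p ∷ []))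
  V⇒D (imp b) c with V⇒D b (imp-coveredʳ c) | unfold c
  ... | inj₂ e | _ = inj₂ e
  ... | inj₁ p | covered′ k _ i = inj₁ (by (i (here refl)) (p ∷ []))
  V⇒D (id {A}) c with unfold c
  ... | covered′ k _ i = inj₁ (by (i (there (there (∈-++⁺ˡ
          (transport (([] , imp A A) ∈_) (sym (same-refl A _)) (here refl)))))) [])
  V⇒D (all {x} {A} f a) c with V⇒D a (all-vacuous f c) | unfold c
  ... | inj₂ e | _ = inj₂ e
  ... | inj₁ p | covered′ k _ i = inj₁ (by (i (∈-++⁺ˡ
          (transport ((A ∷ [] , all x A) ∈_) (sym (vacuous-∉ x A _ f)) (here refl)))) (p ∷ []))
  V⇒D (ex {x} {A} {t} t∈ s a) c with V⇒D a (ex-instance t∈ s c) | unfold c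
  ... | inj₂ e | _ = inj₂ e
  ... | inj₁ p | covered′ k _ i = inj₁ (by (i (∈-++⁺ʳ (vacuous x A (ex x A))
          (∈-instances {clauses Ts k} {λ B → B ∷ [] , ex x A} {x} {A} t∈ s (∈-++⁺ʳ (clauses Ts k (subst x t A)) (here refl))))) (p ∷ []))

  V-andˡ : ∀ {A B} → V (and A B) → V A
  V-andˡ (bot b) = bot b
  V-andˡ (and a _) = a
  V-andˡ (given d c) with unfold c
  ... | covered′ k _ i = given (by (i (there (here refl))) (d ∷ [])) (and-coveredˡ c)

  V-andʳ : ∀ {A B} → V (and A B) → V B
  V-andʳ (bot b) = bot b
  V-andʳ (and _ b) = b
  V-andʳ (given d c) with unfold c
  ... | covered′ k _ i = given (by (i (there (there (here refl)))) (d ∷ [])) (and-coveredʳ c)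

  V-or : ∀ {A} → V (or A A) → V A
  V-or (bot b) = bot b
  V-or (orˡ a) = a
  V-or (orʳ a) = a
  V-or {A} (given d c) with unfold c
  ... | covered′ k _ i = given (by (i (there (there (∈-++⁺ˡ
          (transport ((or A A ∷ [] , A) ∈_) (sym (same-refl A _)) (here refl)))))) (d ∷ [])) (or-coveredˡ c)

  -- An introduced implication already contains its conclusion, or it is `A → A` and the minor
  -- premise is the conclusion. Only a given implication uses its clause; then A is covered and
  -- `V⇒D` applies to the minor premise.
  V-mp : ∀ {A B} → V A → V (imp A B) → V B
  V-mp a (bot b) = bot b
  V-mp a (imp b) = b
  V-mp a id = a
  V-mp a (given d c) with V⇒D a (imp-coveredˡ c) | unfold c
  ... | inj₂ e | _ = bot e
  ... | inj₁ p | covered′ k _ i = given (by (i (there (here refl))) (d ∷ p ∷ [])) (imp-coveredʳ c)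

  V-bot : ∀ {A} → V BOT → V A
  V-bot (given d _) = bot d
  V-bot (bot b) = bot b

  -- A universal formula is introduced only when x is not free in A, and then every instance is A
  -- itself.
  V-all : ∀ {x A t} → t ∈ Ts → substitutable t x A ≡ true → V (all x A) → V (subst x t A)
  V-all t∈ s (bot b) = bot b
  V-all {x} {A} {t} t∈ s (all f a) = transport V (sym (subst-id x t A f)) a
  V-all {x} {A} {t} t∈ s (given d c) with unfold c
  ... | covered′ k _ i = given (by (i (∈-++⁺ʳ (vacuous x A (all x A))
          (∈-instances {clauses Ts k} {λ B → all x A ∷ [] , B} {x} {A} t∈ s (∈-++⁺ʳ (clauses Ts k (subst x t A)) (here refl))))) (d ∷ []))
        (all-instance t∈ s c)

  -- By the side condition of the elimination, the instance from which the formula was introduced is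
  -- A, whatever the witness was.
  V-ex : ∀ {x A} → freeIn x A ≡ false → V (ex x A) → V A
  V-ex f (bot b) = bot b
  V-ex {x} {A} f (ex {t = t} _ _ a) = transport V (subst-id x t A f) a
  V-ex {x} {A} f (given d c) with unfold c
  ... | covered′ k _ i = given (by (i (∈-++⁺ˡ
          (transport ((ex x A ∷ [] , A) ∈_) (sym (vacuous-∉ x A _ f)) (there (here refl))))) (d ∷ [])) (ex-vacuous f c)

  collapse : Term → Term
  collapse t = if does (t ∈? Ts) then t else const 0

  collapse-tame : Tame collapse
  collapse-tame t with t ∈? Ts
  ... | yes _ = inj₁ refl
  ... | no _  = inj₂ refl

  collapse-∈ : ∀ t → collapse t ∈ Ts
  collapse-∈ t with t ∈? Ts
  ... | yes i = i
  ... | no _  = 0∈Ts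

  collapse-fixed : ∀ {t} → t ∈ Ts → collapse t ≡ t
  collapse-fixed {t} i with t ∈? Ts
  ... | yes _ = refl
  ... | no ni = ⊥-elim (ni i)

  vacuous-replace : ∀ {x A} → freeIn x A ≡ false → replace (bound collapse x) A ≡ replace collapse A
  vacuous-replace {x} {A} f = replace-agree A ((λ c → refl) , agree)
    where
    agree : ∀ y → freeIn y A ≡ true → bound collapse x (var y) ≡ collapse (var y)
    agree y q with x ≡ᵇ y in e
    ... | false = refl
    ... | true with ≡ᵇ-true {x} e
    ...   | refl with trans (sym q) f
    ...     | ()

  -- Induction on the derivation. Replacing terms turns each application of a quantifier rule into
  -- one whose term lies in `Ts`, and these are the only ones that `V` admits.
  valid : ∀ {H} → (∀ {A} → A ∈ H → V (replace collapse A)) → ∀ {A} → H ⊢ A → V (replace collapse A)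
  valid h (hyp i) = h i
  valid h axTop = top
  valid h axId = id
  valid h (andI d e) = and (valid h d) (valid h e)
  valid h (andE₁ d) = V-andˡ (valid h d)
  valid h (andE₂ d) = V-andʳ (valid h d)
  valid h (orI₁ d) = orˡ (valid h d)
  valid h (orI₂ d) = orʳ (valid h d)
  valid h (orC d) = V-or (valid h d)
  valid h (impI d) = imp (valid h d)
  valid h (mp d e) = V-mp (valid h d) (valid h e)
  valid h (botE d) = V-bot (valid h d)
  valid h (allI {x} {A} f d) = all (freeIn-replace x A (tame-bound x collapse-tame) f)
    (transport V (sym (vacuous-replace {x} {A} f)) (valid h d))
  valid h (allE {x} {A} {t} s d) = transport V (sym (replace-subst A x t collapse-tame s))
    (V-all (collapse-∈ t) (substitutable-replace A x t (tame-bound x collapse-tame) collapse-tame s) (valid h d))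
  valid h (exI {x} {A} {t} s d) =
    ex (collapse-∈ t) (substitutable-replace A x t (tame-bound x collapse-tame) collapse-tame s)
      (transport V (replace-subst A x t collapse-tame s) (valid h d))
  valid h (exE {x} {A} f d) = transport V (vacuous-replace {x} {A} f)
    (V-ex (freeIn-replace x A (tame-bound x collapse-tame) f) (valid h d))

-- The replacement fixes the goal and the hypotheses, as all their arguments lie in `Ts`. If `V⇒D`
-- yields only BOT, the first clause of `problem` leads on to the goal.
complete-problem : ∀ {Ts H Q} → const 0 ∈ Ts → (∀ {A t} → A ∈ Q ∷ H → t ∈ args A → t ∈ Ts) →
                   H ⊢ Q → Horn (problem Ts H Q) Q
complete-problem {Ts} {H} {Q} 0∈ sub d = conclude (V⇒D goal (covered ≤-refl λ i → there (∈-++⁺ˡ i)))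
  where
  open Completeness Ts 0∈ (problem Ts H Q)
  fixed : ∀ {A} → A ∈ Q ∷ H → replace collapse A ≡ A
  fixed {A} i = replace-fixed A λ t∈ → collapse-fixed (sub i t∈)
  in-facts : ∀ {A As} → A ∈ As → ([] , A) ∷ clauses Ts (len A) A ⊆ facts Ts As
  in-facts (here refl) (here refl) = here refl
  in-facts (here refl) (there j) = there (∈-++⁺ˡ j)
  in-facts {As = B ∷ As} (there i) j = there (∈-++⁺ʳ (clauses Ts (len B) B) (in-facts i j))
  in-problem : facts Ts H ⊆ problem Ts H Q
  in-problem i = there (∈-++⁺ʳ (clauses Ts (len Q) Q) i)
  hyps : ∀ {A} → A ∈ H → V (replace collapse A)
  hyps i = transport V (sym (fixed (there i)))
    (given (by (in-problem (in-facts i (here refl))) []) (covered ≤-refl λ j → in-problem (in-facts i (there j))))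
  goal : V Q
  goal = transport V (fixed (here refl)) (valid hyps d)
  conclude : Horn (problem Ts H Q) Q ⊎ Horn (problem Ts H Q) BOT → Horn (problem Ts H Q) Q
  conclude (inj₁ q) = q
  conclude (inj₂ b) = by (here refl) (b ∷ [])

-- Programs for equality, free variables and substitution.

-- Naming the difference k of two polynomials reduces their inequality to an identity for the ring
-- solver.
slack : ∀ k {a b} → a + k ≡ b → a ≤ b
slack k eq = ≤-trans (m≤m+n _ k) (≤-reflexive eq)

Goal : Expr → Val → Val → ℕ → Set
Goal B v u t = wp B B v (λ w s → w ≡ u × s < t)

truth : Bool → Val
truth b = num (bit b)

yes! no! nil : Expr
yes! = lit 0
no!  = lit 1
nil  = lit 0

eqn : Expr → Expr → Expr → Expr → Expr
eqn a b = ifz (op neq a b)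

onto : List ℕ → Val → Val
onto []       v = v
onto (n ∷ ns) v = pair (num n) (onto ns v)

onto-++ : ∀ xs ys v → onto (xs ++ ys) v ≡ onto xs (onto ys v)
onto-++ []       ys v = refl
onto-++ (x ∷ xs) ys v = cong (pair (num x)) (onto-++ xs ys v)

terms : List Term → Val → Val
terms ts v = onto (map encT ts) v

-- Formulas are represented by trees with three kinds of nodes; the keys are the tokens of the input format.
data Tree : Set where
  lf : ℕ → List Term → Tree
  bn : ℕ → Tree → Tree → Tree
  qn : ℕ → ℕ → Tree → Tree

tree : Formula → Tree
tree TOP         = lf 0 []
tree BOT         = lf 1 []
tree (atom r ts) = lf (10 + 3 * r) ts
tree (and A B)   = bn 2 (tree A) (tree B)
tree (or A B)    = bn 3 (tree A) (tree B)
tree (imp A B)   = bn 4 (tree A) (tree B)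
tree (all x A)   = qn 5 x (tree A)
tree (ex x A)    = qn 6 x (tree A)

-- A left inverse of `tree`. It makes `tree` injective, so that comparing trees decides equality of
-- formulas; the values outside the image are arbitrary.
untree : Tree → Formula
untree (lf 0 _) = TOP
untree (lf 1 _) = BOT
untree (lf (suc (suc k)) ts) = atom ((k ∸ 8) / 3) ts
untree (bn 2 A B) = and (untree A) (untree B)
untree (bn 3 A B) = or (untree A) (untree B)
untree (bn _ A B) = imp (untree A) (untree B)
untree (qn 5 x A) = all x (untree A)
untree (qn _ x A) = ex x (untree A)

untree-tree : ∀ A → untree (tree A) ≡ A
untree-tree TOP = refl
untree-tree BOT = refl
untree-tree (atom r ts) = cong (λ i → atom i ts) (trans (cong (_/ 3) (*-comm 3 r)) (m*n/n≡m r 3))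
untree-tree (and A B) = cong₂ and (untree-tree A) (untree-tree B)
untree-tree (or A B)  = cong₂ or (untree-tree A) (untree-tree B)
untree-tree (imp A B) = cong₂ imp (untree-tree A) (untree-tree B)
untree-tree (all x A) = cong (all x) (untree-tree A)
untree-tree (ex x A)  = cong (ex x) (untree-tree A)

tlen : Tree → ℕ
tlen (lf k ts)  = suc (length ts)
tlen (bn k a b) = suc (tlen a + tlen b)
tlen (qn k x a) = 2 + tlen a

tlen-tree : ∀ A → tlen (tree A) ≡ len A
tlen-tree TOP = refl
tlen-tree BOT = refl
tlen-tree (atom r ts) = refl
tlen-tree (and A B) = cong₂ (λ a b → suc (a + b)) (tlen-tree A) (tlen-tree B)
tlen-tree (or A B)  = cong₂ (λ a b → suc (a + b)) (tlen-tree A) (tlen-tree B)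
tlen-tree (imp A B) = cong₂ (λ a b → suc (a + b)) (tlen-tree A) (tlen-tree B)
tlen-tree (all x A) = cong (2 +_) (tlen-tree A)
tlen-tree (ex x A)  = cong (2 +_) (tlen-tree A)

-- A quantified variable is stored as its token, so that it can be compared directly with the tokens
-- of terms.
⟪_⟫ : Tree → Val
⟪ lf k ts ⟫  = pair (num 0) (pair (num k) (terms ts (num 0)))
⟪ bn k a b ⟫ = pair (num 1) (pair (num k) (pair ⟪ a ⟫ ⟪ b ⟫))
⟪ qn k x a ⟫ = pair (num 2) (pair (num k) (pair (num (encT (var x))) ⟪ a ⟫))

⌜_⌝ : Formula → Val
⌜ A ⌝ = ⟪ tree A ⟫

shape key payload left right : Expr → Expr
shape e   = fst e
key e     = fst (snd e)
payload e = snd (snd e)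
left e    = fst (payload e)
right e   = snd (payload e)

bool-≡ : ∀ {a b} → (T a → T b) → (T b → T a) → a ≡ b
bool-≡ {true}  {true}  f g = refl
bool-≡ {false} {false} f g = refl
bool-≡ {true}  {false} f g = ⊥-elim (f tt)
bool-≡ {false} {true}  f g = ⊥-elim (g tt)

triple-≡ᵇ : ∀ i j → (3 * i ≡ᵇ 3 * j) ≡ (i ≡ᵇ j)
triple-≡ᵇ i j = bool-≡ (λ p → ≡⇒≡ᵇ i j (*-cancelˡ-≡ i j 3 (≡ᵇ⇒≡ (3 * i) (3 * j) p)))
                       (λ p → ≡⇒≡ᵇ (3 * i) (3 * j) (cong (3 *_) (≡ᵇ⇒≡ i j p)))

triple-≢ : ∀ i j → 3 * i ≢ suc (3 * j)
triple-≢ zero    j ()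
triple-≢ (suc i) zero eq with trans (sym (*-suc 3 i)) eq
... | ()
triple-≢ (suc i) (suc j) eq = triple-≢ i j (+-cancelˡ-≡ 3 _ _ (trans (sym (*-suc 3 i)) (trans eq (cong suc (*-suc 3 j)))))

triple-≢ᵇ : ∀ i j → (3 * i ≡ᵇ suc (3 * j)) ≡ false
triple-≢ᵇ i j = bool-≡ (λ p → triple-≢ i j (≡ᵇ⇒≡ (3 * i) _ p)) λ ()

freeInT-token : ∀ x t → (encT (var x) ≡ᵇ encT t) ≡ freeInT x t
freeInT-token x (var y)   = triple-≡ᵇ x y
freeInT-token x (const c) = triple-≢ᵇ x c

encT-injective : ∀ t s → encT t ≡ encT s → t ≡ s
encT-injective (var i)   (var j)   eq = cong var (*-cancelˡ-≡ i j 3 (+-cancelˡ-≡ 8 _ _ eq))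
encT-injective (var i)   (const j) eq = ⊥-elim (triple-≢ i j (+-cancelˡ-≡ 8 _ _ eq))
encT-injective (const i) (var j)   eq = ⊥-elim (triple-≢ j i (+-cancelˡ-≡ 8 _ _ (sym eq)))
encT-injective (const i) (const j) eq = cong const (*-cancelˡ-≡ i j 3 (+-cancelˡ-≡ 9 _ _ eq))

substT-token : ∀ x t s → (if encT (var x) ≡ᵇ encT s then encT t else encT s) ≡ encT (substT x t s)
substT-token x t (const c) rewrite triple-≢ᵇ x c = refl
substT-token x t (var y) rewrite triple-≡ᵇ x y with x ≡ᵇ y
... | true  = refl
... | false = refl

eqTs : List Term → List Term → Bool
eqTs []       []       = true
eqTs []       (_ ∷ _)  = false
eqTs (_ ∷ _)  []       = false
eqTs (t ∷ ts) (u ∷ us) = if encT t ≡ᵇ encT u then eqTs ts us else false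

eqTsE : Expr
eqTsE = ifz (fst arg) (ifz (snd arg) yes! no!)
  (ifz (snd arg) no!
    (eqn (fst (fst arg)) (fst (snd arg)) (call (snd (fst arg) & snd (snd arg))) no!))

-- The pattern for all programs: the lemma in `-goal` form lets `wp` unfold the body once, and its
-- companion in `-run` form serves as the induction hypothesis for recursive calls.
eqTs-goal : ∀ ts us → Goal eqTsE (pair (terms ts (num 0)) (terms us (num 0))) (truth (eqTs ts us)) (suc (length ts))
eqTs-run  : ∀ ts us → Run eqTsE (pair (terms ts (num 0)) (terms us (num 0))) (truth (eqTs ts us)) (suc (length ts))
eqTs-run ts us = run (eqTs-goal ts us)
eqTs-goal [] [] = refl , ≤-refl
eqTs-goal [] (_ ∷ _) = refl , ≤-refl
eqTs-goal (_ ∷ _) [] = refl , s≤s z≤n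
eqTs-goal (t ∷ ts) (u ∷ us) with encT t ≡ᵇ encT u
... | true  = _ , _ , eqTs-run ts us , refl , ≤-refl
... | false = refl , s≤s z≤n

eqT : Tree → Tree → Bool
eqT (lf k ts)  (lf l us)  = if k ≡ᵇ l then eqTs ts us else false
eqT (bn k a b) (bn l c d) = if k ≡ᵇ l then eqT a c ∧ eqT b d else false
eqT (qn k x a) (qn l y b) = if k ≡ᵇ l then (if encT (var x) ≡ᵇ encT (var y) then eqT a b else false) else false
eqT _ _ = false

eqE : Expr
eqE = let a = fst arg; b = snd arg in
  eqn (shape a) (shape b)
    (eqn (key a) (key b)
      (ifz (shape a) (fix eqTsE (payload a & payload b))
        (eqn (shape a) (lit 1)
          (ifz (call (left a & left b)) (call (right a & right b)) no!)
          (eqn (left a) (left b) (call (right a & right b)) no!)))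
      no!)
    no!

leaf-cost : ∀ l → suc (suc l) ≤ 2 * suc l
leaf-cost l = slack l (go l)
  where
  go : ∀ l → suc (suc l) + l ≡ 2 * suc l
  go = solve-∀

node-cost : ∀ a b → suc (2 * a + 2 * b) ≤ 2 * suc (a + b)
node-cost a b = slack 1 (go a b)
  where
  go : ∀ a b → suc (2 * a + 2 * b) + 1 ≡ 2 * suc (a + b)
  go = solve-∀

quant-cost : ∀ a → suc (2 * a) ≤ 2 * (2 + a)
quant-cost a = slack 3 (go a)
  where
  go : ∀ a → suc (2 * a) + 3 ≡ 2 * (2 + a)
  go = solve-∀

half-cost : ∀ a b → suc (2 * a) ≤ 2 * suc (a + b)
half-cost a b = ≤-trans (s≤s (m≤m+n _ (2 * b))) (node-cost a b)

eqT-goal : ∀ t u → Goal eqE (pair ⟪ t ⟫ ⟪ u ⟫) (truth (eqT t u)) (2 * tlen t)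
eqT-run  : ∀ t u → Run eqE (pair ⟪ t ⟫ ⟪ u ⟫) (truth (eqT t u)) (2 * tlen t)
eqT-run t u = run (eqT-goal t u)
eqT-goal (lf k ts) (lf l us) with k ≡ᵇ l
... | true  = _ , _ , eqTs-run ts us , refl , leaf-cost (length ts)
... | false = refl , s≤s z≤n
eqT-goal (bn k a b) (bn l c d) with k ≡ᵇ l
... | false = refl , s≤s z≤n
... | true with eqT a c | eqT-run a c
...   | true  | r = _ , _ , r , _ , _ , eqT-run b d , refl , node-cost (tlen a) (tlen b)
...   | false | r = _ , _ , r , refl , ≤-trans (s≤s (≤-reflexive (+-identityʳ _))) (half-cost (tlen a) (tlen b))
eqT-goal (qn k x a) (qn l y b) with k ≡ᵇ l
... | false = refl , s≤s z≤n
... | true with encT (var x) ≡ᵇ encT (var y)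
...   | true  = _ , _ , eqT-run a b , refl , quant-cost (tlen a)
...   | false = refl , s≤s z≤n
eqT-goal (lf _ _) (bn _ _ _) = refl , s≤s z≤n
eqT-goal (lf _ _) (qn _ _ _) = refl , s≤s z≤n
eqT-goal (bn _ _ _) (lf _ _) = refl , s≤s z≤n
eqT-goal (bn _ _ _) (qn _ _ _) = refl , s≤s z≤n
eqT-goal (qn _ _ _) (lf _ _) = refl , s≤s z≤n
eqT-goal (qn _ _ _) (bn _ _ _) = refl , s≤s z≤n

eqTs-sound : ∀ ts us → eqTs ts us ≡ true → ts ≡ us
eqTs-sound [] [] p = refl
eqTs-sound (t ∷ ts) (u ∷ us) p with encT t ≡ᵇ encT u in e
... | true = cong₂ _∷_ (encT-injective t u (≡ᵇ-true e)) (eqTs-sound ts us p)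

eqTs-refl : ∀ ts → eqTs ts ts ≡ true
eqTs-refl [] = refl
eqTs-refl (t ∷ ts) rewrite ≡ᵇ-refl (encT t) = eqTs-refl ts

eqT-sound : ∀ t u → eqT t u ≡ true → t ≡ u
eqT-sound (lf k ts) (lf l us) p with k ≡ᵇ l in e
... | true = cong₂ lf (≡ᵇ-true e) (eqTs-sound ts us p)
eqT-sound (bn k a b) (bn l c d) p with k ≡ᵇ l in e
... | true with ≡ᵇ-true {k} e
...   | refl = cong₂ (bn k) (eqT-sound a c (proj₁ (∧-true p))) (eqT-sound b d (proj₂ (∧-true {eqT a c} p)))
eqT-sound (qn k x a) (qn l y b) p with k ≡ᵇ l in e
... | true with ≡ᵇ-true {k} e
...   | refl with encT (var x) ≡ᵇ encT (var y) in f
...     | true with encT-injective (var x) (var y) (≡ᵇ-true f)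
...       | refl = cong (qn k x) (eqT-sound a b p)

eqT-refl : ∀ t → eqT t t ≡ true
eqT-refl (lf k ts) rewrite ≡ᵇ-refl k = eqTs-refl ts
eqT-refl (bn k a b) rewrite ≡ᵇ-refl k | eqT-refl a = eqT-refl b
eqT-refl (qn k x a) rewrite ≡ᵇ-refl k | ≡ᵇ-refl (x + (x + (x + 0))) = eqT-refl a

eqT-does : ∀ A B → eqT (tree A) (tree B) ≡ does (A ≟F B)
eqT-does A B with A ≟F B
... | yes refl = eqT-refl (tree A)
... | no ne with eqT (tree A) (tree B) in e
...   | false = refl
...   | true  = ⊥-elim (ne (trans (sym (untree-tree A)) (trans (cong untree (eqT-sound (tree A) (tree B) e)) (untree-tree B))))

eq-run : ∀ A B → Run eqE (pair ⌜ A ⌝ ⌜ B ⌝) (truth (does (A ≟F B))) (2 * len A)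
eq-run A B rewrite sym (eqT-does A B) | sym (tlen-tree A) = eqT-run (tree A) (tree B)

anyE : Expr
anyE = ifz (snd arg) no! (eqn (fst arg) (fst (snd arg)) yes! (call (fst arg & snd (snd arg))))

any-goal : ∀ x ts → Goal anyE (pair (num (encT (var x))) (terms ts (num 0))) (truth (anyB (freeInT x) ts)) (suc (length ts))
any-run  : ∀ x ts → Run anyE (pair (num (encT (var x))) (terms ts (num 0))) (truth (anyB (freeInT x) ts)) (suc (length ts))
any-run x ts = run (any-goal x ts)
any-goal x [] = refl , ≤-refl
any-goal x (t ∷ ts) rewrite sym (freeInT-token x t) with encT (var x) ≡ᵇ encT t
... | true  = refl , s≤s z≤n
... | false = _ , _ , any-run x ts , refl , ≤-refl

freeE : Expr
freeE = let x = fst arg; A = snd arg in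
  ifz (shape A) (fix anyE (x & payload A))
    (eqn (shape A) (lit 1)
      (ifz (call (x & left A)) yes! (call (x & right A)))
      (eqn x (left A) no! (call (x & right A))))

free-goal : ∀ x A → Goal freeE (pair (num (encT (var x))) ⌜ A ⌝) (truth (freeIn x A)) (2 * len A)
free-run  : ∀ x A → Run freeE (pair (num (encT (var x))) ⌜ A ⌝) (truth (freeIn x A)) (2 * len A)
free-run x A = run (free-goal x A)
free-goal x TOP = _ , _ , any-run x [] , refl , ≤-refl
free-goal x BOT = _ , _ , any-run x [] , refl , ≤-refl
free-goal x (atom r ts) = _ , _ , any-run x ts , refl , leaf-cost (length ts)
free-goal x (and A B) with freeIn x A | free-run x A
... | true  | r = _ , _ , r , refl , ≤-trans (s≤s (≤-reflexive (+-identityʳ _))) (half-cost (len A) (len B))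
... | false | r = _ , _ , r , _ , _ , free-run x B , refl , node-cost (len A) (len B)
free-goal x (or A B) with freeIn x A | free-run x A
... | true  | r = _ , _ , r , refl , ≤-trans (s≤s (≤-reflexive (+-identityʳ _))) (half-cost (len A) (len B))
... | false | r = _ , _ , r , _ , _ , free-run x B , refl , node-cost (len A) (len B)
free-goal x (imp A B) with freeIn x A | free-run x A
... | true  | r = _ , _ , r , refl , ≤-trans (s≤s (≤-reflexive (+-identityʳ _))) (half-cost (len A) (len B))
... | false | r = _ , _ , r , _ , _ , free-run x B , refl , node-cost (len A) (len B)
free-goal x (all y A) rewrite sym (triple-≡ᵇ x y) with 3 * x ≡ᵇ 3 * y
... | true  = refl , s≤s z≤n
... | false = _ , _ , free-run x A , refl , quant-cost (len A)
free-goal x (ex y A) rewrite sym (triple-≡ᵇ x y) with 3 * x ≡ᵇ 3 * y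
... | true  = refl , s≤s z≤n
... | false = _ , _ , free-run x A , refl , quant-cost (len A)

captureE : Expr
captureE = let t = fst (fst arg); x = snd (fst arg); A = snd arg in
  ifz (shape A) yes!
    (eqn (shape A) (lit 1)
      (ifz (call (fst arg & left A)) (call (fst arg & right A)) no!)
      (ifz (fix freeE (x & A)) (eqn (left A) t no! (call (fst arg & right A))) yes!))

-- Quadratic, because the free-variable test, of linear cost, is repeated at every quantifier on the
-- way down.
capture-cost : ℕ → ℕ
capture-cost l = 2 * (l * suc l)

capture-node : ∀ a b → suc (capture-cost a + capture-cost b) ≤ capture-cost (suc (a + b))
capture-node a b = slack (3 + 4 * a + 4 * b + 4 * (a * b)) (go a b)
  where
  go : ∀ a b → suc (2 * (a * suc a) + 2 * (b * suc b)) + (3 + 4 * a + 4 * b + 4 * (a * b)) ≡ 2 * (suc (a + b) * suc (suc (a + b)))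
  go = solve-∀

capture-half : ∀ a b → suc (capture-cost a + 0) ≤ capture-cost (suc (a + b))
capture-half a b = ≤-trans (s≤s (+-monoʳ-≤ (capture-cost a) z≤n)) (capture-node a b)

capture-quant : ∀ a → suc (2 * (2 + a) + capture-cost a) ≤ capture-cost (2 + a)
capture-quant a = slack (7 + 6 * a) (go a)
  where
  go : ∀ a → suc (2 * (2 + a) + 2 * (a * suc a)) + (7 + 6 * a) ≡ 2 * ((2 + a) * suc (2 + a))
  go = solve-∀

capture-free : ∀ a → suc (2 * (2 + a) + 0) ≤ capture-cost (2 + a)
capture-free a = ≤-trans (s≤s (+-monoʳ-≤ (2 * (2 + a)) z≤n)) (capture-quant a)

capture-goal : ∀ t x A → Goal captureE (pair (pair (num (encT t)) (num (encT (var x)))) ⌜ A ⌝)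
                              (truth (substitutable t x A)) (capture-cost (len A))
capture-run : ∀ t x A → Run captureE (pair (pair (num (encT t)) (num (encT (var x)))) ⌜ A ⌝)
                              (truth (substitutable t x A)) (capture-cost (len A))
capture-run t x A = run (capture-goal t x A)
capture-goal t x TOP = refl , s≤s z≤n
capture-goal t x BOT = refl , s≤s z≤n
capture-goal t x (atom r ts) = refl , s≤s z≤n
capture-goal t x (and A B) with substitutable t x A | capture-run t x A
... | true  | r = _ , _ , r , _ , _ , capture-run t x B , refl , capture-node (len A) (len B)
... | false | r = _ , _ , r , refl , capture-half (len A) (len B)
capture-goal t x (or A B) with substitutable t x A | capture-run t x A
... | true  | r = _ , _ , r , _ , _ , capture-run t x B , refl , capture-node (len A) (len B)
... | false | r = _ , _ , r , refl , capture-half (len A) (len B)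
capture-goal t x (imp A B) with substitutable t x A | capture-run t x A
... | true  | r = _ , _ , r , _ , _ , capture-run t x B , refl , capture-node (len A) (len B)
... | false | r = _ , _ , r , refl , capture-half (len A) (len B)
capture-goal t x (all y A) with not (x ≡ᵇ y) ∧ freeIn x A | free-run x (all y A)
... | false | r = _ , _ , r , refl , capture-free (len A)
... | true  | r rewrite sym (freeInT-token y t) with encT (var y) ≡ᵇ encT t
...   | true  = _ , _ , r , refl , capture-free (len A)
...   | false = _ , _ , r , _ , _ , capture-run t x A , refl , capture-quant (len A)
capture-goal t x (ex y A) with not (x ≡ᵇ y) ∧ freeIn x A | free-run x (ex y A)
... | false | r = _ , _ , r , refl , capture-free (len A)
... | true  | r rewrite sym (freeInT-token y t) with encT (var y) ≡ᵇ encT t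
...   | true  = _ , _ , r , refl , capture-free (len A)
...   | false = _ , _ , r , _ , _ , capture-run t x A , refl , capture-quant (len A)

substTsE : Expr
substTsE = let t = fst (fst arg); x = snd (fst arg); ts = snd arg in
  ifz ts nil (eqn x (fst ts) t (fst ts) & call (fst arg & snd ts))

substTs-goal : ∀ t x ts → Goal substTsE (pair (pair (num (encT t)) (num (encT (var x)))) (terms ts (num 0)))
                               (terms (map (substT x t) ts) (num 0)) (suc (length ts))
substTs-run : ∀ t x ts → Run substTsE (pair (pair (num (encT t)) (num (encT (var x)))) (terms ts (num 0)))
                               (terms (map (substT x t) ts) (num 0)) (suc (length ts))
substTs-run t x ts = run (substTs-goal t x ts)
substTs-goal t x [] = refl , ≤-refl
substTs-goal t x (s ∷ ts) rewrite sym (substT-token x t s) with encT (var x) ≡ᵇ encT s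
... | true  = _ , _ , substTs-run t x ts , refl , ≤-refl
... | false = _ , _ , substTs-run t x ts , refl , ≤-refl

substE : Expr
substE = let x = snd (fst arg); A = snd arg in
  ifz (shape A) (lit 0 & key A & fix substTsE (fst arg & payload A))
    (eqn (shape A) (lit 1)
      (lit 1 & key A & call (fst arg & left A) & call (fst arg & right A))
      (eqn x (left A) A (lit 2 & key A & left A & call (fst arg & right A))))

subst-goal : ∀ t x A → Goal substE (pair (pair (num (encT t)) (num (encT (var x)))) ⌜ A ⌝) ⌜ subst x t A ⌝ (2 * len A)
subst-run  : ∀ t x A → Run substE (pair (pair (num (encT t)) (num (encT (var x)))) ⌜ A ⌝) ⌜ subst x t A ⌝ (2 * len A)
subst-run t x A = run (subst-goal t x A)
subst-goal t x TOP = _ , _ , substTs-run t x [] , refl , ≤-refl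
subst-goal t x BOT = _ , _ , substTs-run t x [] , refl , ≤-refl
subst-goal t x (atom r ts) = _ , _ , substTs-run t x ts , refl , leaf-cost (length ts)
subst-goal t x (and A B) = _ , _ , subst-run t x A , _ , _ , subst-run t x B , refl , node-cost (len A) (len B)
subst-goal t x (or A B)  = _ , _ , subst-run t x A , _ , _ , subst-run t x B , refl , node-cost (len A) (len B)
subst-goal t x (imp A B) = _ , _ , subst-run t x A , _ , _ , subst-run t x B , refl , node-cost (len A) (len B)
subst-goal t x (all y A) rewrite sym (triple-≡ᵇ x y) with 3 * x ≡ᵇ 3 * y
... | true  = refl , s≤s z≤n
... | false = _ , _ , subst-run t x A , refl , quant-cost (len A)
subst-goal t x (ex y A) rewrite sym (triple-≡ᵇ x y) with 3 * x ≡ᵇ 3 * y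
... | true  = refl , s≤s z≤n
... | false = _ , _ , subst-run t x A , refl , quant-cost (len A)

-- Reading the input and collecting the terms.

reverseE : Expr
reverseE = ifz (fst arg) (snd arg) (call (snd (fst arg) & fst (fst arg) & snd arg))

reverse-goal : ∀ xs v → Goal reverseE (pair (onto xs (num 0)) v) (rev-onto xs v) (suc (length xs))
reverse-run  : ∀ xs v → Run reverseE (pair (onto xs (num 0)) v) (rev-onto xs v) (suc (length xs))
reverse-run xs v = run (reverse-goal xs v)
reverse-goal []       v = refl , ≤-refl
reverse-goal (x ∷ xs) v = _ , _ , reverse-run xs _ , refl , ≤-refl

rev-onto-reverse : ∀ xs v → rev-onto xs v ≡ onto (reverse xs) v
rev-onto-reverse []       v = refl
rev-onto-reverse (x ∷ xs) v = trans (rev-onto-reverse xs (pair (num x) v))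
  (sym (trans (cong (λ l → onto l v) (unfold-reverse x xs)) (onto-++ (reverse xs) (x ∷ []) v)))

takeE : Expr
takeE = let j = fst arg; xs = snd arg in
  ifz j (nil & xs)
    (bind (call (op minus j (lit 1) & snd xs)) ((fst (snd (snd arg)) & fst (fst arg)) & snd (fst arg)))

take-goal : ∀ xs v → Goal takeE (pair (num (length xs)) (onto xs v)) (pair (onto xs (num 0)) v) (suc (length xs))
take-run  : ∀ xs v → Run takeE (pair (num (length xs)) (onto xs v)) (pair (onto xs (num 0)) v) (suc (length xs))
take-run xs v = run (take-goal xs v)
take-goal []       v = refl , ≤-refl
take-goal (x ∷ xs) v = _ , _ , take-run xs v , refl , ≤-reflexive (cong (λ l → suc (suc l)) (+-identityʳ _))

-- Truncated subtraction sorts the tokens: 0 and 1 are constants, 2 to 4 binary connectives, 5 and 6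
-- quantifiers, and atoms start at 10. The unread rest is returned along with the tree, as Polish
-- notation has no closing delimiter.
parseE : Expr
parseE = let k = fst arg; rest = snd arg in
  ifz (op minus k (lit 1)) ((lit 0 & k & nil) & rest)
    (ifz (op minus k (lit 4))
      (bind (call rest)
        (bind (call (snd (fst arg)))
          (let r = fst arg; l = fst (snd arg); old = snd (snd arg) in
           (lit 1 & fst old & fst l & fst r) & snd r)))
      (ifz (op minus k (lit 6))
        (bind (call (snd rest))
          (let r = fst arg; old = snd arg in
           (lit 2 & fst old & fst (snd old) & fst r) & snd r))
        (bind (fix takeE rest)
          (let r = fst arg; old = snd arg in
           (lit 0 & fst old & fst r) & snd r))))

parse-node : ∀ a b → suc (2 * a + (2 * b + 0)) ≤ 2 * suc (a + b)
parse-node a b = ≤-trans (≤-reflexive (cong (λ c → suc (2 * a + c)) (+-identityʳ _))) (node-cost a b)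

parse-quant : ∀ a → suc (2 * a + 0) ≤ 2 * (2 + a)
parse-quant a = ≤-trans (≤-reflexive (cong suc (+-identityʳ _))) (quant-cost a)

parse-goal : ∀ A v → Goal parseE (onto (encF A) v) (pair ⌜ A ⌝ v) (2 * len A)
parse-run  : ∀ A v → Run parseE (onto (encF A) v) (pair ⌜ A ⌝ v) (2 * len A)
parse-run A v = run (parse-goal A v)
parse-goal TOP v = refl , s≤s z≤n
parse-goal BOT v = refl , s≤s z≤n
parse-goal (atom r ts) v = _ , _ , args-run , refl ,
  ≤-trans (≤-reflexive (cong suc (+-identityʳ _))) (leaf-cost (length ts))
  where
  args-run : Run takeE (pair (num (length ts)) (terms ts v)) (pair (terms ts (num 0)) v) (suc (length ts))
  args-run =
    transport (λ l → Run takeE (pair (num l) (terms ts v)) (pair (terms ts (num 0)) v) (suc l)) (length-map encT ts) (take-run (map encT ts) v)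
parse-goal (and A B) v rewrite onto-++ (encF A) (encF B) v =
  _ , _ , parse-run A _ , _ , _ , parse-run B v , refl , parse-node (len A) (len B)
parse-goal (or A B) v rewrite onto-++ (encF A) (encF B) v =
  _ , _ , parse-run A _ , _ , _ , parse-run B v , refl , parse-node (len A) (len B)
parse-goal (imp A B) v rewrite onto-++ (encF A) (encF B) v =
  _ , _ , parse-run A _ , _ , _ , parse-run B v , refl , parse-node (len A) (len B)
parse-goal (all x A) v = _ , _ , parse-run A v , refl , parse-quant (len A)
parse-goal (ex x A) v  = _ , _ , parse-run A v , refl , parse-quant (len A)

formulas : List Formula → Val
formulas []       = num 0
formulas (A ∷ As) = pair ⌜ A ⌝ (formulas As)

total : List Formula → ℕ
total []       = 0
total (A ∷ As) = len A + total As

parsesE : Expr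
parsesE = ifz arg nil (bind (fix parseE arg) (fst (fst arg) & call (snd (snd (fst arg)))))

parses-goal : ∀ As → Goal parsesE (onto (encList As) (num 0)) (formulas As) (suc (3 * total As))
parses-run  : ∀ As → Run parsesE (onto (encList As) (num 0)) (formulas As) (suc (3 * total As))
parses-run As = run (parses-goal As)

-- `parsesE` stops at the number 0. The token list of a formula is a pair even if its first token is
-- 0, so the test takes the branch that parses.
onto-encF : ∀ A v → Σ Val λ a → Σ Val λ b → onto (encF A) v ≡ pair a b
onto-encF TOP v = _ , _ , refl
onto-encF BOT v = _ , _ , refl
onto-encF (atom _ _) v = _ , _ , refl
onto-encF (and _ _) v = _ , _ , refl
onto-encF (or _ _) v = _ , _ , refl
onto-encF (imp _ _) v = _ , _ , refl
onto-encF (all _ _) v = _ , _ , refl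
onto-encF (ex _ _) v = _ , _ , refl

parses-step : ∀ {k w a b v u s t n} → Run parseE (pair k w) (pair a (pair b v)) s → Run parsesE v u t →
              suc (s + t) ≤ n → Goal parsesE (pair k w) (pair a u) n
parses-step r q le = _ , _ , r , _ , _ , q , refl , le

parses-goal [] = refl , s≤s z≤n
parses-goal (A ∷ As) rewrite onto-++ (encF A) (7 ∷ encList As) (num 0)
  with onto (encF A) (pair (num 7) (onto (encList As) (num 0))) | onto-encF A (pair (num 7) (onto (encList As) (num 0)))
     | parse-run A (pair (num 7) (onto (encList As) (num 0)))
... | _ | _ , _ , refl | r = parses-step r (parses-run As)
  (s≤s (≤-trans (≤-reflexive (shape₁ (len A) (total As)))
    (≤-trans (+-monoʳ-≤ (2 * len A + 3 * total As) (positive A)) (≤-reflexive (shape₂ (len A) (total As))))))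
  where
  shape₁ : ∀ a s → 2 * a + suc (3 * s) ≡ (2 * a + 3 * s) + 1
  shape₁ = solve-∀
  shape₂ : ∀ a s → (2 * a + 3 * s) + a ≡ 3 * (a + s)
  shape₂ = solve-∀

memberE : Expr
memberE = ifz (snd arg) no! (ifz (fix eqE (fst arg & fst (snd arg))) yes! (call (fst arg & snd (snd arg))))

member : Formula → List Formula → Bool
member Q []       = false
member Q (A ∷ As) = if does (Q ≟F A) then true else member Q As

member-goal : ∀ Q As → Goal memberE (pair ⌜ Q ⌝ (formulas As)) (truth (member Q As)) (suc (length As * suc (2 * len Q)))
member-run  : ∀ Q As → Run memberE (pair ⌜ Q ⌝ (formulas As)) (truth (member Q As)) (suc (length As * suc (2 * len Q)))
member-run Q As = run (member-goal Q As)
member-goal Q [] = refl , ≤-refl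
member-goal Q (A ∷ As) with does (Q ≟F A) | eq-run Q A
... | true  | r = _ , _ , r , refl , s≤s (≤-trans (≤-reflexive (+-identityʳ _)) (≤-trans (n≤1+n _) (m≤m+n _ _)))
... | false | r = _ , _ , r , _ , _ , member-run Q As , refl , s≤s (≤-reflexive (+-suc (2 * len Q) _))

appendE : Expr
appendE = ifz (fst arg) (snd arg) (fst (fst arg) & call (snd (fst arg) & snd arg))

append-goal : ∀ xs v → Goal appendE (pair (onto xs (num 0)) v) (onto xs v) (suc (length xs))
append-run  : ∀ xs v → Run appendE (pair (onto xs (num 0)) v) (onto xs v) (suc (length xs))
append-run xs v = run (append-goal xs v)
append-goal []       v = refl , ≤-refl
append-goal (x ∷ xs) v = _ , _ , append-run xs v , refl , ≤-refl

terms-++ : ∀ ts us v → terms (ts ++ us) v ≡ terms ts (terms us v)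
terms-++ ts us v = trans (cong (λ l → onto l v) (map-++ encT ts us)) (onto-++ (map encT ts) (map encT us) v)

argsE : Expr
argsE = let A = fst arg; acc = snd arg in
  ifz (shape A) (fix appendE (payload A & acc))
    (eqn (shape A) (lit 1) (call (left A & call (right A & acc))) (call (right A & acc)))

swap-cost : ∀ a b → suc (2 * b + 2 * a) ≤ 2 * suc (a + b)
swap-cost a b = ≤-trans (≤-reflexive (cong suc (+-comm (2 * b) (2 * a)))) (node-cost a b)

args-goal : ∀ A v → Goal argsE (pair ⌜ A ⌝ v) (terms (args A) v) (2 * len A)
args-run  : ∀ A v → Run argsE (pair ⌜ A ⌝ v) (terms (args A) v) (2 * len A)
args-run A v = run (args-goal A v)
args-goal TOP v = _ , _ , append-run [] v , refl , ≤-refl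
args-goal BOT v = _ , _ , append-run [] v , refl , ≤-refl
args-goal (atom r ts) v = _ , _ , append-run (map encT ts) v , refl ,
  ≤-trans (≤-reflexive (cong (λ l → suc (suc l)) (length-map encT ts))) (leaf-cost (length ts))
args-goal (and A B) v rewrite terms-++ (args A) (args B) v =
  _ , _ , args-run B v , _ , _ , args-run A _ , refl , swap-cost (len A) (len B)
args-goal (or A B) v rewrite terms-++ (args A) (args B) v =
  _ , _ , args-run B v , _ , _ , args-run A _ , refl , swap-cost (len A) (len B)
args-goal (imp A B) v rewrite terms-++ (args A) (args B) v =
  _ , _ , args-run B v , _ , _ , args-run A _ , refl , swap-cost (len A) (len B)
args-goal (all x A) v = _ , _ , args-run A v , refl , quant-cost (len A)
args-goal (ex x A) v  = _ , _ , args-run A v , refl , quant-cost (len A)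

allArgs : List Formula → List Term
allArgs []       = []
allArgs (A ∷ As) = args A ++ allArgs As

allArgsE : Expr
allArgsE = ifz arg nil (fix argsE (fst arg & call (snd arg)))

allArgs-goal : ∀ As → Goal allArgsE (formulas As) (terms (allArgs As) (num 0)) (suc (3 * total As))
allArgs-run  : ∀ As → Run allArgsE (formulas As) (terms (allArgs As) (num 0)) (suc (3 * total As))
allArgs-run As = run (allArgs-goal As)
allArgs-goal [] = refl , ≤-refl
allArgs-goal (A ∷ As) rewrite terms-++ (args A) (allArgs As) (num 0) =
  _ , _ , allArgs-run As , _ , _ , args-run A _ , refl ,
  s≤s (≤-trans (≤-reflexive (shape₁ (len A) (total As)))
    (≤-trans (+-monoʳ-≤ (2 * len A + 3 * total As) (positive A)) (≤-reflexive (shape₂ (len A) (total As)))))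
  where
  shape₁ : ∀ a s → suc (3 * s) + 2 * a ≡ (2 * a + 3 * s) + 1
  shape₁ = solve-∀
  shape₂ : ∀ a s → (2 * a + 3 * s) + a ≡ 3 * (a + s)
  shape₂ = solve-∀

-- Generation of the clauses.

clause : Clause → Val
clause (ps , c) = pair (formulas ps) ⌜ c ⌝

clauseList : List Clause → Val → Val
clauseList []       v = v
clauseList (c ∷ cs) v = pair (clause c) (clauseList cs v)

clauseList-++ : ∀ cs ds v → clauseList (cs ++ ds) v ≡ clauseList cs (clauseList ds v)
clauseList-++ []       ds v = refl
clauseList-++ (c ∷ cs) ds v = cong (pair (clause c)) (clauseList-++ cs ds v)

-- The language offers self-recursion only, so two mutually recursive functions share one program:
-- mode 0 treats a formula, mode 1 runs through the remaining terms for a quantified formula. The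
-- last component accumulates the result, so clause lists are never concatenated.
genE : Expr
genE = ifz (fst arg) one each
  where
  Ts target acc : Expr → Expr
  Ts e     = fst (snd e)
  target e = fst (snd (snd e))
  acc e    = snd (snd (snd e))
  binary quantified one each step : Expr
  binary = let rest = fst arg; u = target (snd arg); l = left u; r = right u in
    eqn (key u) (lit 2) (((l & r & nil) & u) & ((u & nil) & l) & ((u & nil) & r) & rest)
      (eqn (key u) (lit 3)
        (((l & nil) & u) & ((r & nil) & u) & ifz (fix eqE (l & r)) (((u & nil) & l) & rest) rest)
        (((r & nil) & u) & ((u & l & nil) & r) & ifz (fix eqE (l & r)) ((nil & u) & rest) rest))
  quantified = let rest = fst arg; u = target (snd arg); A = right u in
    ifz (fix freeE (left u & A)) rest (((A & nil) & u) & ((u & nil) & A) & rest)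
  one = let u = target arg in
    ifz (shape u) (ifz (key u) ((nil & u) & acc arg) (acc arg))
      (eqn (shape u) (lit 1)
        (bind (call (lit 0 & Ts arg & left u & call (lit 0 & Ts arg & right u & acc arg))) binary)
        (bind (call (lit 1 & Ts arg & (Ts arg & u) & acc arg)) quantified))
  step = let rest = fst arg; old = snd arg; u = snd (target old); at = (fst (fst (target old)) & left u) & right u in
    ifz (fix captureE at)
      (bind (fix substE at)
        (let B = fst arg; rest = fst (snd arg); old = snd (snd arg); u = snd (target old) in
         call (lit 0 & Ts old & B & eqn (key u) (lit 5) ((u & nil) & B) ((B & nil) & u) & rest)))
      rest
  each = let rem = fst (target arg); u = snd (target arg) in
    ifz rem (acc arg) (bind (call (lit 1 & Ts arg & (snd rem & u) & acc arg)) step)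

-- Measures the tree of instances with τ terms for each quantifier. Both the running time of `genE`
-- and the number of clauses are bounded by multiples of it.
inst : ℕ → Formula → ℕ
inst τ TOP        = 1
inst τ BOT        = 1
inst τ (atom _ _) = 1
inst τ (and A B)  = suc (inst τ A + inst τ B)
inst τ (or A B)   = suc (inst τ A + inst τ B)
inst τ (imp A B)  = suc (inst τ A + inst τ B)
inst τ (all x A)  = 2 + τ * suc (inst τ A)
inst τ (ex x A)   = 2 + τ * suc (inst τ A)

inst-subst : ∀ τ x t A → inst τ (subst x t A) ≡ inst τ A
inst-subst τ x t TOP = refl
inst-subst τ x t BOT = refl
inst-subst τ x t (atom _ _) = refl
inst-subst τ x t (and A B) = cong₂ (λ a b → suc (a + b)) (inst-subst τ x t A) (inst-subst τ x t B)
inst-subst τ x t (or A B)  = cong₂ (λ a b → suc (a + b)) (inst-subst τ x t A) (inst-subst τ x t B)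
inst-subst τ x t (imp A B) = cong₂ (λ a b → suc (a + b)) (inst-subst τ x t A) (inst-subst τ x t B)
inst-subst τ x t (all y A) with x ≡ᵇ y
... | true  = refl
... | false = cong (λ a → 2 + τ * suc a) (inst-subst τ x t A)
inst-subst τ x t (ex y A) with x ≡ᵇ y
... | true  = refl
... | false = cong (λ a → 2 + τ * suc a) (inst-subst τ x t A)

-- The work for one node of a formula of length at most n.
unit : ℕ → ℕ
unit n = 2 + 2 * n + capture-cost n

capture-mono : ∀ {l n} → l ≤ n → capture-cost l ≤ capture-cost n
capture-mono le = *-monoʳ-≤ 2 (*-mono-≤ le (s≤s le))

unit-≥ : ∀ {l n} → l ≤ n → suc (2 * l + capture-cost l) < unit n
unit-≥ le = s≤s (s≤s (+-mono-≤ (*-monoʳ-≤ 2 le) (capture-mono le)))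

bin-gen : ∀ {a b l n e} → l ≤ n → e ≤ 2 * l → suc ((unit n * b + unit n * a) + e) ≤ unit n * suc (a + b)
bin-gen {a} {b} {l} {n} {e} le le′ = ≤-trans (+-monoʳ-≤ (suc (unit n * b + unit n * a)) le′)
  (≤-trans (≤-reflexive (shape₁ (unit n) a b (2 * l)))
  (≤-trans (+-monoʳ-≤ (unit n * (a + b)) (≤-trans (s≤s (m≤m+n (2 * l) (capture-cost l))) (<⇒≤ (unit-≥ le))))
           (≤-reflexive (shape₂ (unit n) (a + b)))))
  where
  shape₁ : ∀ g a b e → suc ((g * b + g * a) + e) ≡ g * (a + b) + suc e
  shape₁ = solve-∀
  shape₂ : ∀ g c → g * c + g ≡ g * suc c
  shape₂ = solve-∀

-- Budget for the instances of a quantified formula with s terms left to instantiate.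
rest-cost : ℕ → ℕ → ℕ → ℕ
rest-cost n a s = suc (s * (unit n * suc a))

quant-gen : ∀ {a l n e} s → l ≤ n → e ≤ 2 * l → suc (rest-cost n a s + e) ≤ unit n * (2 + s * suc a)
quant-gen {a} {l} {n} {e} s le le′ = ≤-trans (+-monoʳ-≤ (suc (rest-cost n a s)) le′)
  (≤-trans (≤-reflexive (shape₁ (unit n) s a (2 * l)))
  (≤-trans (+-monoʳ-≤ (unit n * (s * suc a)) (≤-trans (≤-trans (s≤s (s≤s (m≤m+n (2 * l) (capture-cost l)))) (unit-≥ le))
                                                      (m≤m+n (unit n) (unit n))))
           (≤-reflexive (shape₂ (unit n) (s * suc a)))))
  where
  shape₁ : ∀ g s a e → suc (suc (s * (g * suc a)) + e) ≡ g * (s * suc a) + (2 + e)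
  shape₁ = solve-∀
  shape₂ : ∀ g c → g * c + (g + g) ≡ g * (2 + c)
  shape₂ = solve-∀

each-gen : ∀ {a l n} s → l ≤ n →
  suc (rest-cost n a s + (capture-cost l + (2 * l + unit n * a))) ≤ rest-cost n a (suc s)
each-gen {a} {l} {n} s le = ≤-trans (≤-reflexive (shape₁ (unit n) s a (2 * l) (capture-cost l)))
  (≤-trans (+-monoʳ-≤ (s * (unit n * suc a) + unit n * a) (unit-≥ le)) (≤-trans (n≤1+n _) (≤-reflexive (shape₂ (unit n) s a))))
  where
  shape₁ : ∀ g s a e c → suc (suc (s * (g * suc a)) + (c + (e + g * a))) ≡ (s * (g * suc a) + g * a) + (2 + (e + c))
  shape₁ = solve-∀
  shape₂ : ∀ g s a → suc ((s * (g * suc a) + g * a) + g) ≡ suc (suc s * (g * suc a))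
  shape₂ = solve-∀

skip-gen : ∀ {a l n} s → l ≤ n → suc (rest-cost n a s + (capture-cost l + 0)) ≤ rest-cost n a (suc s)
skip-gen {a} {l} {n} s le = ≤-trans (s≤s (+-monoʳ-≤ (rest-cost n a s) (+-monoʳ-≤ (capture-cost l) z≤n))) (each-gen s le)

leaf-gen : ∀ n → 1 ≤ unit n * 1
leaf-gen n = s≤s z≤n

genInput : List Term → Formula → Val → Val
genInput Ts A v = pair (num 0) (pair (terms Ts (num 0)) (pair ⌜ A ⌝ v))

instInput : List Term → List Term → Formula → Val → Val
instInput Ts rem A v = pair (num 1) (pair (terms Ts (num 0)) (pair (pair (terms rem (num 0)) ⌜ A ⌝) v))

-- n bounds the length of every formula met in the recursion, instances included, since substitution
-- preserves length; so the factor `unit n` is the same throughout.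
module Generation (n : ℕ) (Ts : List Term) where

  cost : Formula → ℕ
  cost A = unit n * inst (length Ts) A

  alls : ℕ → ℕ → Formula → List Term → List Clause
  alls k x A = concatMap (instance-clauses (clauses Ts k) (λ B → all x A ∷ [] , B) x A)

  exs : ℕ → ℕ → Formula → List Term → List Clause
  exs k x A = concatMap (instance-clauses (clauses Ts k) (λ B → B ∷ [] , ex x A) x A)

  gen-goal : ∀ k A v → len A ≤ k → k ≤ n → Goal genE (genInput Ts A v) (clauseList (clauses Ts k A) v) (cost A)
  gen-run  : ∀ k A v → len A ≤ k → k ≤ n → Run genE (genInput Ts A v) (clauseList (clauses Ts k A) v) (cost A)
  gen-run k A v le le′ = run (gen-goal k A v le le′)

  both-run : ∀ k A B v → len A + len B ≤ k → k ≤ n →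
    Run genE (genInput Ts B v) (clauseList (clauses Ts k B) v) (cost B) ×
    Run genE (genInput Ts A (clauseList (clauses Ts k B) v)) (clauseList (clauses Ts k A ++ clauses Ts k B) v) (cost A)
  both-run k A B v le le′ = gen-run k B v (≤-trans (m≤n+m _ _) le) le′ ,
    transport (λ w → Run genE (genInput Ts A (clauseList (clauses Ts k B) v)) w (cost A)) (sym (clauseList-++ (clauses Ts k A) (clauses Ts k B) v))
      (gen-run k A _ (≤-trans (m≤m+n _ _) le) le′)

  instance-run : ∀ k x t A v → 2 + len A ≤ suc k → k ≤ n →
    Run genE (genInput Ts (subst x t A) v) (clauseList (clauses Ts k (subst x t A)) v) (cost A)
  instance-run k x t A v le le′ =
    transport (λ i → Run genE (genInput Ts (subst x t A) v) (clauseList (clauses Ts k (subst x t A)) v) (unit n * i)) (inst-subst (length Ts) x t A)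
      (gen-run k (subst x t A) v
        (≤-trans (≤-reflexive (len-subst x t A)) (≤-trans (n≤1+n _) (≤-pred le))) le′)

  all-goal : ∀ k x A rem v → 2 + len A ≤ suc k → k ≤ n →
    Goal genE (instInput Ts rem (all x A) v) (clauseList (alls k x A rem) v) (rest-cost n (inst (length Ts) A) (length rem))
  all-run : ∀ k x A rem v → 2 + len A ≤ suc k → k ≤ n →
    Run genE (instInput Ts rem (all x A) v) (clauseList (alls k x A rem) v) (rest-cost n (inst (length Ts) A) (length rem))
  all-run k x A rem v le le′ = run (all-goal k x A rem v le le′)
  all-goal k x A [] v le le′ = refl , ≤-refl
  all-goal k x A (t ∷ rem) v le le′ with substitutable t x A | capture-run t x A
  ... | false | r = _ , _ , all-run k x A rem v le le′ , _ , _ , r , refl ,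
    skip-gen (length rem) (≤-trans (n≤1+n _) (≤-trans (≤-pred le) le′))
  ... | true  | r rewrite
      ++-assoc (clauses Ts k (subst x t A)) ((all x A ∷ [] , subst x t A) ∷ []) (alls k x A rem)
    | clauseList-++ (clauses Ts k (subst x t A)) ((all x A ∷ [] , subst x t A) ∷ alls k x A rem) v =
    _ , _ , all-run k x A rem v le le′ , _ , _ , r , _ , _ , subst-run t x A , _ , _ , instance-run k x t A _ le le′ , refl ,
    each-gen (length rem) (≤-trans (n≤1+n _) (≤-trans (≤-pred le) le′))

  ex-goal : ∀ k x A rem v → 2 + len A ≤ suc k → k ≤ n →
    Goal genE (instInput Ts rem (ex x A) v) (clauseList (exs k x A rem) v) (rest-cost n (inst (length Ts) A) (length rem))
  ex-run : ∀ k x A rem v → 2 + len A ≤ suc k → k ≤ n →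
    Run genE (instInput Ts rem (ex x A) v) (clauseList (exs k x A rem) v) (rest-cost n (inst (length Ts) A) (length rem))
  ex-run k x A rem v le le′ = run (ex-goal k x A rem v le le′)
  ex-goal k x A [] v le le′ = refl , ≤-refl
  ex-goal k x A (t ∷ rem) v le le′ with substitutable t x A | capture-run t x A
  ... | false | r = _ , _ , ex-run k x A rem v le le′ , _ , _ , r , refl ,
    skip-gen (length rem) (≤-trans (n≤1+n _) (≤-trans (≤-pred le) le′))
  ... | true  | r rewrite
      ++-assoc (clauses Ts k (subst x t A)) ((subst x t A ∷ [] , ex x A) ∷ []) (exs k x A rem)
    | clauseList-++ (clauses Ts k (subst x t A)) ((subst x t A ∷ [] , ex x A) ∷ exs k x A rem) v =
    _ , _ , ex-run k x A rem v le le′ , _ , _ , r , _ , _ , subst-run t x A , _ , _ , instance-run k x t A _ le le′ , refl ,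
    each-gen (length rem) (≤-trans (n≤1+n _) (≤-trans (≤-pred le) le′))

  left-fits : ∀ {a b k} → suc (a + b) ≤ suc k → suc k ≤ n → a ≤ n
  left-fits le le′ = ≤-trans (m≤m+n _ _) (≤-trans (≤-pred le) (<⇒≤ le′))

  body-fits : ∀ {a k} → 2 + a ≤ suc k → suc k ≤ n → a ≤ n
  body-fits le le′ = ≤-trans (n≤1+n _) (≤-trans (≤-pred le) (<⇒≤ le′))

  gen-goal zero A v le le′ = ⊥-elim (1+n≰n (≤-trans (positive A) le))
  gen-goal (suc k) TOP v le le′ = refl , leaf-gen n
  gen-goal (suc k) BOT v le le′ = refl , leaf-gen n
  gen-goal (suc k) (atom r ts) v le le′ = refl , leaf-gen n
  gen-goal (suc k) (and A B) v le le′ with both-run k A B v (≤-pred le) (<⇒≤ le′)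
  ... | rB , rA = _ , _ , rB , _ , _ , rA , refl ,
    bin-gen {inst (length Ts) A} {inst (length Ts) B} {len A} (left-fits le le′) z≤n
  gen-goal (suc k) (or A B) v le le′ with both-run k A B v (≤-pred le) (<⇒≤ le′) | does (A ≟F B) | eq-run A B
  ... | rB , rA | true  | r = _ , _ , rB , _ , _ , rA , _ , _ , r , refl ,
    bin-gen {inst (length Ts) A} {inst (length Ts) B} {len A} (left-fits le le′) (≤-reflexive (+-identityʳ _))
  ... | rB , rA | false | r = _ , _ , rB , _ , _ , rA , _ , _ , r , refl ,
    bin-gen {inst (length Ts) A} {inst (length Ts) B} {len A} (left-fits le le′) (≤-reflexive (+-identityʳ _))
  gen-goal (suc k) (imp A B) v le le′ with both-run k A B v (≤-pred le) (<⇒≤ le′) | does (A ≟F B) | eq-run A B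
  ... | rB , rA | true  | r = _ , _ , rB , _ , _ , rA , _ , _ , r , refl ,
    bin-gen {inst (length Ts) A} {inst (length Ts) B} {len A} (left-fits le le′) (≤-reflexive (+-identityʳ _))
  ... | rB , rA | false | r = _ , _ , rB , _ , _ , rA , _ , _ , r , refl ,
    bin-gen {inst (length Ts) A} {inst (length Ts) B} {len A} (left-fits le le′) (≤-reflexive (+-identityʳ _))
  gen-goal (suc k) (all x A) v le le′ with freeIn x A | free-run x A
  ... | true  | r = _ , _ , all-run k x A Ts v le (<⇒≤ le′) , _ , _ , r , refl ,
    quant-gen {inst (length Ts) A} {len A} (length Ts) (body-fits le le′) (≤-reflexive (+-identityʳ _))
  ... | false | r = _ , _ , all-run k x A Ts v le (<⇒≤ le′) , _ , _ , r , refl ,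
    quant-gen {inst (length Ts) A} {len A} (length Ts) (body-fits le le′) (≤-reflexive (+-identityʳ _))
  gen-goal (suc k) (ex x A) v le le′ with freeIn x A | free-run x A
  ... | true  | r = _ , _ , ex-run k x A Ts v le (<⇒≤ le′) , _ , _ , r , refl ,
    quant-gen {inst (length Ts) A} {len A} (length Ts) (body-fits le le′) (≤-reflexive (+-identityʳ _))
  ... | false | r = _ , _ , ex-run k x A Ts v le (<⇒≤ le′) , _ , _ , r , refl ,
    quant-gen {inst (length Ts) A} {len A} (length Ts) (body-fits le le′) (≤-reflexive (+-identityʳ _))

factsE : Expr
factsE = let Ts = fst arg; As = snd arg in
  ifz As nil ((nil & fst As) & fix genE (lit 0 & Ts & fst As & call (Ts & snd As)))

insts : ℕ → List Formula → ℕ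
insts τ []       = 0
insts τ (A ∷ As) = suc (inst τ A) + insts τ As

facts-goal : ∀ n Ts As → total As ≤ n →
  Goal factsE (pair (terms Ts (num 0)) (formulas As)) (clauseList (facts Ts As) (num 0)) (suc (unit n * insts (length Ts) As))
facts-run : ∀ n Ts As → total As ≤ n →
  Run factsE (pair (terms Ts (num 0)) (formulas As)) (clauseList (facts Ts As) (num 0)) (suc (unit n * insts (length Ts) As))
facts-run n Ts As le = run (facts-goal n Ts As le)
facts-goal n Ts [] le = refl , s≤s z≤n
facts-goal n Ts (A ∷ As) le rewrite clauseList-++ (clauses Ts (len A) A) (facts Ts As) (num 0) =
  _ , _ , facts-run n Ts As (≤-trans (m≤n+m _ _) le) , _ , _ ,
  Generation.gen-run n Ts (len A) A _ ≤-refl (≤-trans (m≤m+n _ _) le) , refl ,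
  s≤s (≤-trans (≤-reflexive (shape₁ (unit n) (inst (length Ts) A) (insts (length Ts) As)))
    (≤-trans (+-monoʳ-≤ (unit n * (inst (length Ts) A + insts (length Ts) As)) (s≤s z≤n))
      (≤-reflexive (shape₂ (unit n) (inst (length Ts) A) (insts (length Ts) As)))))
  where
  shape₁ : ∀ g a s → suc (g * s) + g * a ≡ g * (a + s) + 1
  shape₁ = solve-∀
  shape₂ : ∀ g a s → g * (a + s) + g ≡ g * suc (a + s)
  shape₂ = solve-∀

-- Unit propagation

first-fact : List Clause → Maybe Formula
first-fact []                 = nothing
first-fact (([] , c) ∷ cs)    = just c
first-fact ((_ ∷ _ , _) ∷ cs) = first-fact cs

delete : Formula → List Formula → List Formula
delete C []       = []
delete C (A ∷ As) = if does (C ≟F A) then delete C As else A ∷ delete C As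

-- Once C is known, every clause with head C can go. At least the fact C itself disappears, so each
-- round shortens the list, and the initial length bounds the number of rounds.
reduce : Formula → List Clause → List Clause
reduce C []              = []
reduce C ((ps , c) ∷ cs) = if does (C ≟F c) then reduce C cs else (delete C ps , c) ∷ reduce C cs

propagate : ℕ → Formula → List Clause → Bool
propagate-from : ℕ → Formula → List Clause → Maybe Formula → Bool
propagate zero    Q cs = false
propagate (suc n) Q cs = propagate-from n Q cs (first-fact cs)
propagate-from n Q cs nothing  = false
propagate-from n Q cs (just C) = if does (C ≟F Q) then true else propagate n Q (reduce C cs)

first-fact-∈ : ∀ cs {C} → first-fact cs ≡ just C → ([] , C) ∈ cs
first-fact-∈ (([] , c) ∷ cs)    refl = here refl
first-fact-∈ ((_ ∷ _ , _) ∷ cs) eq   = there (first-fact-∈ cs eq)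

-- Following first premises upwards, a derivation ends in a leaf, and a leaf uses a clause without
-- premises.
no-fact : ∀ cs → first-fact cs ≡ nothing → ∀ {A} → ¬ Horn cs A
no-fact cs eq (by {[]} i ps) = absurd cs eq i
  where
  absurd : ∀ cs {A} → first-fact cs ≡ nothing → ¬ (([] , A) ∈ cs)
  absurd ((_ ∷ _ , _) ∷ cs) eq (there i) = absurd cs eq i
no-fact cs eq (by {_ ∷ _} i (p ∷ ps)) = no-fact cs eq p

reduce-∈ : ∀ {C ps c} cs → (ps , c) ∈ cs → C ≡ c ⊎ (delete C ps , c) ∈ reduce C cs
reduce-∈ {C} ((ps , c) ∷ cs) (here refl) with C ≟F c
... | yes eq = inj₁ eq
... | no _   = inj₂ (here refl)
reduce-∈ {C} ((_ , c) ∷ cs) (there i) with reduce-∈ {C} cs i | C ≟F c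
... | inj₁ eq | _     = inj₁ eq
... | inj₂ j  | yes _ = inj₂ j
... | inj₂ j  | no _  = inj₂ (there j)

∈-reduce : ∀ {C d} cs → d ∈ reduce C cs → Σ (List Formula) λ ps → (ps , proj₂ d) ∈ cs × proj₁ d ≡ delete C ps
∈-reduce {C} ((ps , c) ∷ cs) i with C ≟F c
∈-reduce ((ps , c) ∷ cs) i | yes _ with ∈-reduce cs i
... | qs , j , eq = qs , there j , eq
∈-reduce ((ps , c) ∷ cs) (here refl) | no _ = ps , here refl , refl
∈-reduce ((ps , c) ∷ cs) (there i)   | no _ with ∈-reduce cs i
... | qs , j , eq = qs , there j , eq

length-reduce-≤ : ∀ C cs → length (reduce C cs) ≤ length cs
length-reduce-≤ C [] = z≤n
length-reduce-≤ C ((ps , c) ∷ cs) with does (C ≟F c)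
... | true  = m≤n⇒m≤1+n (length-reduce-≤ C cs)
... | false = s≤s (length-reduce-≤ C cs)

length-reduce : ∀ {C ps} cs → (ps , C) ∈ cs → length (reduce C cs) < length cs
length-reduce {C} ((ps , .C) ∷ cs) (here refl) with C ≟F C
... | yes _ = s≤s (length-reduce-≤ C cs)
... | no ne = ⊥-elim (ne refl)
length-reduce {C} ((ps , c) ∷ cs) (there i) with does (C ≟F c)
... | true  = m≤n⇒m≤1+n (length-reduce cs i)
... | false = s≤s (length-reduce cs i)

All-delete : ∀ {C cs} ps → All (λ A → C ≡ A ⊎ Horn cs A) ps → All (Horn cs) (delete C ps)
All-delete [] [] = []
All-delete {C} (A ∷ ps) (p ∷ q) with C ≟F A | p
... | yes _ | _        = All-delete ps q
... | no ne | inj₁ eq  = ⊥-elim (ne eq)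
... | no _  | inj₂ h   = h ∷ All-delete ps q

delete-All : ∀ {C cs} ps → Horn cs C → All (Horn cs) (delete C ps) → All (Horn cs) ps
delete-All [] h _ = []
delete-All {C} (A ∷ ps) h q with C ≟F A
... | yes refl = h ∷ delete-All ps h q
delete-All (A ∷ ps) h (p ∷ q) | no _ = p ∷ delete-All ps h q

-- Clauses with head C are lost, but they derive only C, and the remaining clauses no longer ask for
-- C as a premise.
Horn-reduce : ∀ {C cs A} → Horn cs A → C ≡ A ⊎ Horn (reduce C cs) A
Horns-reduce : ∀ {C cs As} → All (Horn cs) As → All (λ A → C ≡ A ⊎ Horn (reduce C cs) A) As
Horn-reduce {cs = cs} (by i ps) with reduce-∈ cs i
... | inj₁ eq = inj₁ eq
... | inj₂ j  = inj₂ (by j (All-delete _ (Horns-reduce ps)))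
Horns-reduce [] = []
Horns-reduce (p ∷ ps) = Horn-reduce p ∷ Horns-reduce ps

reduce-Horn : ∀ {C cs A} → Horn cs C → Horn (reduce C cs) A → Horn cs A
reduce-Horns : ∀ {C cs As} → Horn cs C → All (Horn (reduce C cs)) As → All (Horn cs) As
reduce-Horn {C} {cs} h (by i ps) with ∈-reduce cs i
... | qs , j , refl = by j (delete-All qs h (reduce-Horns h ps))
reduce-Horns h [] = []
reduce-Horns h (p ∷ ps) = reduce-Horn h p ∷ reduce-Horns h ps

propagate-sound : ∀ n Q cs → propagate n Q cs ≡ true → Horn cs Q
propagate-sound (suc n) Q cs eq with first-fact cs in f
... | just C with C ≟F Q
...   | yes refl = by (first-fact-∈ cs f) []
...   | no _ = reduce-Horn (by (first-fact-∈ cs f) []) (propagate-sound n Q (reduce C cs) eq)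

propagate-complete : ∀ n Q cs → length cs ≤ n → Horn cs Q → propagate n Q cs ≡ true
propagate-complete zero Q [] le (by () _)
propagate-complete (suc n) Q cs le h with first-fact cs in f
... | nothing = ⊥-elim (no-fact cs f h)
... | just C with C ≟F Q
...   | yes _ = refl
...   | no ne with Horn-reduce {C} h
...     | inj₁ eq = ⊥-elim (ne eq)
...     | inj₂ h′ = propagate-complete n Q (reduce C cs) (≤-pred (≤-trans (length-reduce cs (first-fact-∈ cs f)) le)) h′

optional : Maybe Formula → Val
optional nothing  = num 0
optional (just C) = pair ⌜ C ⌝ (num 0)

findE : Expr
findE = ifz arg nil (ifz (fst (fst arg)) (snd (fst arg) & nil) (call (snd arg)))

find-goal : ∀ cs → Goal findE (clauseList cs (num 0)) (optional (first-fact cs)) (suc (length cs))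
find-run  : ∀ cs → Run findE (clauseList cs (num 0)) (optional (first-fact cs)) (suc (length cs))
find-run cs = run (find-goal cs)
find-goal [] = refl , ≤-refl
find-goal (([] , c) ∷ cs) = refl , s≤s z≤n
find-goal ((_ ∷ _ , c) ∷ cs) = _ , _ , find-run cs , refl , ≤-refl

deleteE : Expr
deleteE = ifz (snd arg) nil
  (bind (call (fst arg & snd (snd arg)))
    (let rest = fst arg; C = fst (snd arg); A = fst (snd (snd arg)) in
     ifz (fix eqE (C & A)) rest (A & rest)))

delete-goal : ∀ C As → Goal deleteE (pair ⌜ C ⌝ (formulas As)) (formulas (delete C As)) (suc (length As * suc (2 * len C)))
delete-run  : ∀ C As → Run deleteE (pair ⌜ C ⌝ (formulas As)) (formulas (delete C As)) (suc (length As * suc (2 * len C)))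
delete-run C As = run (delete-goal C As)

delete-cost : ∀ s e → suc (suc s + (e + 0)) ≤ suc (suc e + s)
delete-cost s e = ≤-reflexive (go s e)
  where
  go : ∀ s e → suc (suc s + (e + 0)) ≡ suc (suc e + s)
  go = solve-∀

delete-goal C [] = refl , ≤-refl
delete-goal C (A ∷ As) with does (C ≟F A) | eq-run C A
... | true  | r = _ , _ , delete-run C As , _ , _ , r , refl , delete-cost (length As * suc (2 * len C)) (2 * len C)
... | false | r = _ , _ , delete-run C As , _ , _ , r , refl , delete-cost (length As * suc (2 * len C)) (2 * len C)

-- Two premises occur in the rules for conjunction and modus ponens. The length is bounded for heads
-- because the cost of an equality test is measured by its first argument, and during propagation
-- this is always a fact, hence a head.
Small : ℕ → Clause → Set
Small n (ps , c) = length ps ≤ 2 × len c ≤ n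

delete-length : ∀ C As → length (delete C As) ≤ length As
delete-length C [] = z≤n
delete-length C (A ∷ As) with does (C ≟F A)
... | true  = m≤n⇒m≤1+n (delete-length C As)
... | false = s≤s (delete-length C As)

reduce-small : ∀ {n} C cs → All (Small n) cs → All (Small n) (reduce C cs)
reduce-small C [] [] = []
reduce-small C ((ps , c) ∷ cs) ((p , q) ∷ s) with does (C ≟F c)
... | true  = reduce-small C cs s
... | false = (≤-trans (delete-length C ps) p , q) ∷ reduce-small C cs s

reduceE : Expr
reduceE = ifz (snd arg) nil
  (bind (call (fst arg & snd (snd arg)))
    (let rest = fst arg; C = fst (snd arg); c = fst (snd (snd arg)) in
     ifz (fix eqE (C & snd c)) rest ((fix deleteE (C & fst c) & snd c) & rest)))

-- Per clause: 1 for the recursive call, 2n for comparing the heads, and 3 + 4n for the deletion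
-- from at most two premises.
reduce-cost : ℕ → ℕ → ℕ
reduce-cost n l = suc (l * (4 + 6 * n))

reduce-keep : ∀ n l {e d} → e ≤ 2 * n → d ≤ suc (2 * suc (2 * n)) → suc (reduce-cost n l + (e + ((d + 0) + 0))) ≤ reduce-cost n (suc l)
reduce-keep n l {e} {d} le le′ =
  ≤-trans (s≤s (+-monoʳ-≤ (reduce-cost n l) (+-mono-≤ le (+-monoˡ-≤ 0 (+-monoˡ-≤ 0 le′))))) (slack 0 (go n l))
  where
  go : ∀ n l → (suc (suc (l * (4 + 6 * n)) + (2 * n + ((suc (2 * suc (2 * n)) + 0) + 0)))) + 0 ≡ suc (suc l * (4 + 6 * n)) 
  go = solve-∀

reduce-drop : ∀ n l {e} → e ≤ 2 * n → suc (reduce-cost n l + (e + 0)) ≤ reduce-cost n (suc l)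
reduce-drop n l {e} le = ≤-trans (s≤s (+-monoʳ-≤ (reduce-cost n l) (+-monoʳ-≤ e z≤n))) (reduce-keep n l {e} {0} le z≤n)

reduce-goal : ∀ n C cs → len C ≤ n → All (Small n) cs →
  Goal reduceE (pair ⌜ C ⌝ (clauseList cs (num 0))) (clauseList (reduce C cs) (num 0)) (reduce-cost n (length cs))
reduce-run : ∀ n C cs → len C ≤ n → All (Small n) cs →
  Run reduceE (pair ⌜ C ⌝ (clauseList cs (num 0))) (clauseList (reduce C cs) (num 0)) (reduce-cost n (length cs))
reduce-run n C cs le sm = run (reduce-goal n C cs le sm)
reduce-goal n C [] le [] = refl , ≤-refl
reduce-goal n C ((ps , c) ∷ cs) le ((p , q) ∷ sm) with does (C ≟F c) | eq-run C c
... | true  | r = _ , _ , reduce-run n C cs le sm , _ , _ , r , refl , reduce-drop n (length cs) (*-monoʳ-≤ 2 le)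
... | false | r = _ , _ , reduce-run n C cs le sm , _ , _ , r , _ , _ , delete-run C ps , refl ,
  reduce-keep n (length cs) (*-monoʳ-≤ 2 le) (s≤s (*-mono-≤ {length ps} {2} {suc (2 * len C)} {suc (2 * n)} p (s≤s (*-monoʳ-≤ 2 le))))

propE : Expr
propE = bind (fix findE (snd arg))
  (let found = fst arg; Q = fst (snd arg); cs = snd (snd arg); C = fst found in
   ifz found (lit 0)
     (ifz (fix eqE (C & Q)) (lit 1) (call (Q & fix reduceE (C & cs)))))

answer : Bool → Val
answer true  = num 1
answer false = num 0

round-cost : ℕ → ℕ → ℕ
round-cost N n = 1 + (suc N + (2 * n + reduce-cost n N))

prop-cost : ℕ → ℕ → ℕ → ℕ
prop-cost N n m = suc m * round-cost N n

first-fact-small : ∀ {n} cs {C} → All (Small n) cs → first-fact cs ≡ just C → len C ≤ n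
first-fact-small (([] , c) ∷ cs)    ((_ , q) ∷ _) refl = q
first-fact-small ((_ ∷ _ , _) ∷ cs) (_ ∷ sm)      eq   = first-fact-small cs sm eq

reduce-cost-mono : ∀ n {l N} → l ≤ N → reduce-cost n l ≤ reduce-cost n N
reduce-cost-mono n le = s≤s (*-monoˡ-≤ (4 + 6 * n) le)

module Propagation (N n : ℕ) where

  round-≤ : ∀ {l e r} → l ≤ N → e ≤ 2 * n → r ≤ reduce-cost n N → suc (suc l + (e + r)) ≤ round-cost N n
  round-≤ p q r = s≤s (s≤s (+-mono-≤ p (+-mono-≤ q r)))

  first-round : ∀ {c} m → c ≤ round-cost N n → c ≤ prop-cost N n m
  first-round m le = ≤-trans le (m≤m+n _ (m * round-cost N n))

  prop-goal : ∀ m Q cs → length cs ≤ m → length cs ≤ N → All (Small n) cs →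
    Goal propE (pair ⌜ Q ⌝ (clauseList cs (num 0))) (answer (propagate m Q cs)) (prop-cost N n m)
  prop-run : ∀ m Q cs → length cs ≤ m → length cs ≤ N → All (Small n) cs →
    Run propE (pair ⌜ Q ⌝ (clauseList cs (num 0))) (answer (propagate m Q cs)) (prop-cost N n m)
  prop-run m Q cs le le′ sm = run (prop-goal m Q cs le le′ sm)
  prop-goal zero Q [] le le′ sm = _ , _ , find-run [] , refl , first-round 0 (round-≤ {e = 0} {r = 0} z≤n z≤n z≤n)
  prop-goal (suc m) Q cs le le′ sm with first-fact cs in f | find-run cs
  ... | nothing | r = _ , _ , r , refl , first-round (suc m) (round-≤ {e = 0} {r = 0} le′ z≤n z≤n)
  ... | just C  | r with does (C ≟F Q) | eq-run C Q
  ...   | true  | q = _ , _ , r , _ , _ , q , refl ,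
    first-round (suc m) (round-≤ {r = 0} le′ (*-monoʳ-≤ 2 (first-fact-small cs sm f)) z≤n)
  ...   | false | q = _ , _ , r , _ , _ , q , _ , _ , reduce-run n C cs (first-fact-small cs sm f) sm , _ , _ ,
    prop-run m Q (reduce C cs) (≤-pred (≤-trans (length-reduce cs (first-fact-∈ cs f)) le))
      (≤-trans (length-reduce-≤ C cs) le′) (reduce-small C cs sm) , refl ,
    ≤-trans (≤-reflexive (assoc (length cs) (2 * len C) (reduce-cost n (length cs)) (prop-cost N n m)))
      (+-monoˡ-≤ (prop-cost N n m)
        (round-≤ le′ (*-monoʳ-≤ 2 (first-fact-small cs sm f)) (reduce-cost-mono n le′)))
    where
    assoc : ∀ l e r p → suc (suc l + (e + (r + p))) ≡ suc (suc l + (e + r)) + p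
    assoc = solve-∀

-- Number and size of the clauses.

length-concatMap : ∀ {A B : Set} {f : A → List B} {m} xs → (∀ x → length (f x) ≤ m) → length (concatMap f xs) ≤ length xs * m
length-concatMap [] h = z≤n
length-concatMap {f = f} (x ∷ xs) h =
  ≤-trans (≤-reflexive (length-++ (f x))) (+-mono-≤ (h x) (length-concatMap xs h))

length-same : ∀ A B c → length (same A B c) ≤ 1
length-same A B c with does (A ≟F B)
... | true  = ≤-refl
... | false = z≤n

length-vacuous : ∀ x A u → length (vacuous x A u) ≤ 2
length-vacuous x A u with freeIn x A
... | true  = z≤n
... | false = ≤-refl

module Count (Ts : List Term) where

  τ = length Ts

  -- A connective contributes at most three clauses of its own, a quantifier at most two and one
  -- more for each instance.
  length-clauses : ∀ k A → length (clauses Ts k A) ≤ 3 * inst τ A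

  length-both : ∀ k A B (cs : List Clause) → length cs ≤ 1 →
    2 + length (cs ++ (clauses Ts k A ++ clauses Ts k B)) ≤ 3 * suc (inst τ A + inst τ B)
  length-both k A B cs le = ≤-trans
    (≤-reflexive (cong (2 +_) (trans (length-++ cs) (cong (length cs +_) (length-++ (clauses Ts k A))))))
    (≤-trans (+-monoʳ-≤ 2 (+-mono-≤ le (+-mono-≤ (length-clauses k A) (length-clauses k B))))
             (≤-reflexive (arith (inst τ A) (inst τ B))))
    where
    arith : ∀ a b → 2 + (1 + (3 * a + 3 * b)) ≡ 3 * suc (a + b)
    arith = solve-∀

  length-instances : ∀ k rule x A u →
    length (vacuous x A u ++ concatMap (instance-clauses (clauses Ts k) rule x A) Ts) ≤ 3 * (2 + τ * suc (inst τ A))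
  length-instances k rule x A u = ≤-trans (≤-reflexive (length-++ (vacuous x A u)))
    (≤-trans (+-mono-≤ (length-vacuous x A u) (length-concatMap Ts each))
             (slack (4 + 2 * τ) (arith τ (inst τ A))))
    where
    each : ∀ t → length (instance-clauses (clauses Ts k) rule x A t) ≤ suc (3 * inst τ A)
    each t with substitutable t x A
    ... | false = z≤n
    ... | true = ≤-trans (≤-reflexive (trans (length-++ (clauses Ts k (subst x t A))) (+-comm _ 1)))
      (s≤s (≤-trans (length-clauses k (subst x t A)) (≤-reflexive (cong (3 *_) (inst-subst τ x t A)))))
    arith : ∀ τ a → (2 + τ * suc (3 * a)) + (4 + 2 * τ) ≡ 3 * (2 + τ * suc a)
    arith = solve-∀

  length-clauses zero A = z≤n
  length-clauses (suc k) TOP = s≤s z≤n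
  length-clauses (suc k) BOT = z≤n
  length-clauses (suc k) (atom _ _) = z≤n
  length-clauses (suc k) (and A B) = length-both k A B ((and A B ∷ [] , B) ∷ []) ≤-refl
  length-clauses (suc k) (or A B)  = length-both k A B (same A B _) (length-same A B _)
  length-clauses (suc k) (imp A B) = length-both k A B (same A B _) (length-same A B _)
  length-clauses (suc k) (all x A) = length-instances k (λ B → all x A ∷ [] , B) x A (all x A)
  length-clauses (suc k) (ex x A)  = length-instances k (λ B → B ∷ [] , ex x A) x A (ex x A)

  length-facts : ∀ As → length (facts Ts As) ≤ 3 * insts τ As
  length-facts [] = z≤n
  length-facts (A ∷ As) = ≤-trans (≤-reflexive (cong suc (length-++ (clauses Ts (len A) A))))
    (≤-trans (s≤s (+-mono-≤ (length-clauses (len A) A) (length-facts As)))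
             (slack 2 (arith (inst τ A) (insts τ As))))
    where
    arith : ∀ a s → suc (3 * a + 3 * s) + 2 ≡ 3 * (suc a + s)
    arith = solve-∀

  length-problem : ∀ H Q → length (problem Ts H Q) ≤ 3 * insts τ (Q ∷ H)
  -- Up to its first clause, `problem Ts H Q` is `facts Ts (Q ∷ H)`, so the lengths agree by
  -- computation.
  length-problem H Q = length-facts (Q ∷ H)

module _ (n : ℕ) (Ts : List Term) where

  small-same : ∀ A B {c} → Small n c → All (Small n) (same A B c)
  small-same A B s with does (A ≟F B)
  ... | true  = s ∷ []
  ... | false = []

  small-vacuous : ∀ x A {u} → len A ≤ n → len u ≤ n → All (Small n) (vacuous x A u)
  small-vacuous x A p q with freeIn x A
  ... | true  = []
  ... | false = (s≤s z≤n , q) ∷ (s≤s z≤n , p) ∷ []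

  small-clauses : ∀ k A → len A ≤ n → All (Small n) (clauses Ts k A)

  small-instances : ∀ k rule x A → len A ≤ n → (∀ t → Small n (rule (subst x t A))) →
    All (Small n) (concatMap (instance-clauses (clauses Ts k) rule x A) Ts)
  small-instances k rule x A le h = concat⁺ (map⁺ (universal each Ts))
    where
    each : ∀ t → All (Small n) (instance-clauses (clauses Ts k) rule x A t)
    each t with substitutable t x A
    ... | false = []
    ... | true = ++⁺ (small-clauses k (subst x t A) (≤-trans (≤-reflexive (len-subst x t A)) le)) (h t ∷ [])

  small-clauses zero A le = []
  small-clauses (suc k) TOP le = (z≤n , le) ∷ []
  small-clauses (suc k) BOT le = []
  small-clauses (suc k) (atom _ _) le = []
  small-clauses (suc k) (and A B) le =
    (≤-refl , le) ∷ (s≤s z≤n , left-le) ∷ (s≤s z≤n , right-le) ∷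
    ++⁺ (small-clauses k A left-le) (small-clauses k B right-le)
    where
    left-le  = ≤-trans (≤-trans (m≤m+n (len A) (len B)) (n≤1+n _)) le
    right-le = ≤-trans (≤-trans (m≤n+m (len B) (len A)) (n≤1+n _)) le
  small-clauses (suc k) (or A B) le =
    (s≤s z≤n , le) ∷ (s≤s z≤n , le) ∷
    ++⁺ (small-same A B (s≤s z≤n , left-le)) (++⁺ (small-clauses k A left-le) (small-clauses k B right-le))
    where
    left-le  = ≤-trans (≤-trans (m≤m+n (len A) (len B)) (n≤1+n _)) le
    right-le = ≤-trans (≤-trans (m≤n+m (len B) (len A)) (n≤1+n _)) le
  small-clauses (suc k) (imp A B) le =
    (s≤s z≤n , le) ∷ (≤-refl , right-le) ∷
    ++⁺ (small-same A B (z≤n , le)) (++⁺ (small-clauses k A left-le) (small-clauses k B right-le))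
    where
    left-le  = ≤-trans (≤-trans (m≤m+n (len A) (len B)) (n≤1+n _)) le
    right-le = ≤-trans (≤-trans (m≤n+m (len B) (len A)) (n≤1+n _)) le
  small-clauses (suc k) (all x A) le = ++⁺ (small-vacuous x A body-le le)
    (small-instances k (λ B → all x A ∷ [] , B) x A body-le λ t → s≤s z≤n , ≤-trans (≤-reflexive (len-subst x t A)) body-le)
    where
    body-le = ≤-trans (m≤n+m (len A) 2) le
  small-clauses (suc k) (ex x A) le = ++⁺ (small-vacuous x A body-le le)
    (small-instances k (λ B → B ∷ [] , ex x A) x A body-le λ t → s≤s z≤n , le)
    where
    body-le = ≤-trans (m≤n+m (len A) 2) le

  small-facts : ∀ As → total As ≤ n → All (Small n) (facts Ts As)
  small-facts [] le = []
  small-facts (A ∷ As) le = (z≤n , head-le) ∷ ++⁺ (small-clauses (len A) A head-le)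
    (small-facts As (≤-trans (m≤n+m _ (len A)) le))
    where
    head-le = ≤-trans (m≤m+n (len A) (total As)) le

  small-problem : ∀ H Q → total (Q ∷ H) ≤ n → All (Small n) (problem Ts H Q)
  small-problem H Q le with small-facts (Q ∷ H) le
  ... | (_ , q) ∷ rest = (s≤s z≤n , q) ∷ rest

-- The main program.

-- The loader leaves the tokens in reverse order, hence the first step. `lit 9` is the token of
-- `const 0`, and the clause put in front is ex falso for the goal, with BOT spelled out as a leaf
-- with key 1.
mainE : Expr
mainE = bind (fix reverseE (arg & nil)) (bind (fix parsesE (fst arg))
  (let Q = fst (fst arg); H = snd (fst arg) in
   ifz (fix memberE (Q & H)) (lit 1)
     (bind (lit 9 & fix allArgsE (fst arg))
       (let Ts = fst arg; Q = fst (fst (snd arg)); H = snd (fst (snd arg)) in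
        fix propE (Q & (((lit 0 & lit 1 & nil) & nil) & Q) & fix genE (lit 0 & Ts & Q & fix factsE (Ts & H)))))))

termsOf : List Formula → Formula → List Term
termsOf H Q = const 0 ∷ allArgs (Q ∷ H)

decide : List Formula → Formula → Bool
decide H Q = if member Q H then true else propagate (length cs) Q cs
  where cs = problem (termsOf H Q) H Q

read-run : ∀ w → Run reverseE (pair (rev-onto w (num 0)) (num 0)) (onto w (num 0)) (suc (length w))
read-run w rewrite rev-onto-reverse w (num 0) | sym (length-reverse w) =
  transport (λ v → Run reverseE (pair (onto (reverse w) (num 0)) (num 0)) v (suc (length (reverse w))))
    (trans (rev-onto-reverse (reverse w) (num 0)) (cong (λ l → onto l (num 0)) (reverse-involutive w)))
    (reverse-run (reverse w) (num 0))

-- The budget for an input of total length n with i instances.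
budget-for : ℕ → ℕ → ℕ
budget-for n i = 6 + 9 * n + n * suc (2 * n) + (unit n * i + prop-cost (3 * i) n (3 * i))

length-total : ∀ As → length As ≤ total As
length-total [] = z≤n
length-total (A ∷ As) = +-mono-≤ (positive A) (length-total As)

main-shape : ∀ {n i w m f g p} → w ≤ 3 * n → m ≤ n * suc (2 * n) → f + g ≤ unit n * i → p ≤ prop-cost (3 * i) n (3 * i) →
  suc (suc w + (suc (3 * n) + (suc m + (suc (3 * n) + ((suc f + g) + p))))) ≤ budget-for n i
main-shape {n} {i} {w} {m} {f} {g} {p} a b c d = ≤-trans (≤-reflexive (shape₁ (3 * n) w m f g p))
  (≤-trans (+-mono-≤ (+-mono-≤ (+-monoʳ-≤ (6 + (3 * n + 3 * n)) a) b) (+-mono-≤ c d)) (≤-reflexive (shape₂ n (n * suc (2 * n)) (unit n * i) (prop-cost (3 * i) n (3 * i)))))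
  where
  shape₁ : ∀ k w m f g p → suc (suc w + (suc k + (suc m + (suc k + ((suc f + g) + p))))) ≡ ((6 + (k + k)) + w + m) + ((f + g) + p)
  shape₁ = solve-∀
  shape₂ : ∀ n m u p → ((6 + (3 * n + 3 * n)) + 3 * n + m) + (u + p) ≡ 6 + 9 * n + m + (u + p)
  shape₂ = solve-∀

length-encF : ∀ A → length (encF A) ≤ 2 * len A
length-encF TOP = s≤s z≤n
length-encF BOT = s≤s z≤n
length-encF (atom r ts) = ≤-trans (≤-reflexive (cong (2 +_) (length-map encT ts))) (leaf-cost (length ts))
length-encF (and A B) =
  ≤-trans (s≤s (≤-trans (≤-reflexive (length-++ (encF A))) (+-mono-≤ (length-encF A) (length-encF B)))) (node-cost (len A) (len B))
length-encF (or A B)  =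
  ≤-trans (s≤s (≤-trans (≤-reflexive (length-++ (encF A))) (+-mono-≤ (length-encF A) (length-encF B)))) (node-cost (len A) (len B))
length-encF (imp A B) =
  ≤-trans (s≤s (≤-trans (≤-reflexive (length-++ (encF A))) (+-mono-≤ (length-encF A) (length-encF B)))) (node-cost (len A) (len B))
length-encF (all x A) = ≤-trans (s≤s (s≤s (length-encF A))) (slack 2 (arith (len A)))
  where
  arith : ∀ a → (2 + 2 * a) + 2 ≡ 2 * (2 + a)
  arith = solve-∀
length-encF (ex x A) = ≤-trans (s≤s (s≤s (length-encF A))) (slack 2 (arith (len A)))
  where
  arith : ∀ a → (2 + 2 * a) + 2 ≡ 2 * (2 + a)
  arith = solve-∀

length-encList : ∀ As → length (encList As) ≤ 3 * total As
length-encList [] = z≤n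
length-encList (A ∷ As) = ≤-trans (≤-reflexive (length-++ (encF A)))
  (≤-trans (+-mono-≤ (length-encF A) (+-mono-≤ (positive A) (length-encList As))) (≤-reflexive (arith (len A) (total As))))
  where
  arith : ∀ a s → 2 * a + (a + 3 * s) ≡ 3 * (a + s)
  arith = solve-∀

member-sound : ∀ Q H → member Q H ≡ true → Q ∈ H
member-sound Q (A ∷ H) eq with Q ≟F A
... | yes refl = here refl
... | no _ = there (member-sound Q H eq)

member-complete : ∀ Q H → Q ∈ H → member Q H ≡ true
member-complete Q (A ∷ H) i with Q ≟F A | i
... | yes _ | _          = refl
... | no ne | here refl  = ⊥-elim (ne refl)
... | no _  | there j    = member-complete Q H j

args⊆allArgs : ∀ {A t} As → A ∈ As → t ∈ args A → t ∈ allArgs As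
args⊆allArgs (A ∷ As) (here refl) i = ∈-++⁺ˡ i
args⊆allArgs (A ∷ As) (there j)   i = ∈-++⁺ʳ (args A) (args⊆allArgs As j i)

decide-sound : ∀ H Q → decide H Q ≡ true → H ⊢ Q
decide-sound H Q eq with member Q H in m
... | true  = hyp (member-sound Q H m)
... | false = sound-Horn (sound-problem (termsOf H Q) Q) (propagate-sound _ Q (problem (termsOf H Q) H Q) eq)

decide-complete : ∀ H Q → H ⊢ Q → decide H Q ≡ true
decide-complete H Q d with member Q H
... | true  = refl
... | false = propagate-complete _ Q _ ≤-refl
  (complete-problem {termsOf H Q} (here refl) (λ i j → there (args⊆allArgs (Q ∷ H) i j)) d)

input : List Formula → Formula → Val
input H Q = rev-onto (encode H Q) (num 0)

member-cost : ∀ H Q → length H * suc (2 * len Q) ≤ total (Q ∷ H) * suc (2 * total (Q ∷ H))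
member-cost H Q = *-mono-≤ (≤-trans (length-total H) (m≤n+m _ (len Q))) (s≤s (*-monoʳ-≤ 2 (m≤m+n (len Q) (total H))))

main-run-∈ : ∀ H Q → member Q H ≡ true → Run mainE (input H Q) (answer (decide H Q)) (budget-for (total (Q ∷ H)) 0)
main-run-∈ H Q eq = run (goal eq)
  where
  n = total (Q ∷ H)
  enough : suc (suc (length (encode H Q)) + (suc (3 * n) + (suc (length H * suc (2 * len Q)) + 0))) ≤ budget-for n 0
  enough =
    ≤-trans (s≤s (s≤s (+-monoʳ-≤ (length (encode H Q)) (s≤s (+-monoʳ-≤ (3 * n) (s≤s (+-monoʳ-≤ (length H * suc (2 * len Q)) z≤n)))))))
    (main-shape {n} {0} {length (encode H Q)} {_} {0} {0} {0} (length-encList (Q ∷ H)) (member-cost H Q) z≤n z≤n)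
  goal : member Q H ≡ true → Goal mainE (input H Q) (answer (decide H Q)) (budget-for n 0)
  goal eq with member Q H | member-run Q H | eq
  ... | true | r | refl = _ , _ , read-run (encode H Q) , _ , _ , parses-run (Q ∷ H) , _ , _ , r , refl , enough

main-run-∉ : ∀ H Q → member Q H ≡ false →
  Run mainE (input H Q) (answer (decide H Q)) (budget-for (total (Q ∷ H)) (insts (length (termsOf H Q)) (Q ∷ H)))
main-run-∉ H Q eq = run (goal eq)
  where
  n = total (Q ∷ H)
  Ts = termsOf H Q
  τ = length Ts
  i = insts τ (Q ∷ H)
  cs = problem Ts H Q
  gen : Run genE (genInput Ts Q (clauseList (facts Ts H) (num 0)))
                 (clauseList (clauses Ts (len Q) Q ++ facts Ts H) (num 0)) (unit n * inst τ Q)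
  gen = transport (λ v → Run genE (genInput Ts Q (clauseList (facts Ts H) (num 0))) v (unit n * inst τ Q))
    (sym (clauseList-++ (clauses Ts (len Q) Q) (facts Ts H) (num 0)))
    (Generation.gen-run n Ts (len Q) Q _ ≤-refl (m≤m+n _ _))
  few : length cs ≤ 3 * i
  few = Count.length-problem Ts H Q
  prop : Run propE (pair ⌜ Q ⌝ (clauseList cs (num 0))) (answer (propagate (length cs) Q cs)) (prop-cost (3 * i) n (length cs))
  prop = Propagation.prop-run (3 * i) n (length cs) Q cs ≤-refl few (small-problem n Ts H Q ≤-refl)
  gen-cost : unit n * insts τ H + unit n * inst τ Q ≤ unit n * i
  gen-cost = ≤-trans (≤-reflexive (sym (*-distribˡ-+ (unit n) (insts τ H) (inst τ Q))))
    (*-monoʳ-≤ (unit n) (≤-trans (≤-reflexive (+-comm (insts τ H) (inst τ Q))) (n≤1+n _)))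
  enough = main-shape {n} {i} {length (encode H Q)} {length H * suc (2 * len Q)} {unit n * insts τ H} {unit n * inst τ Q}
    {prop-cost (3 * i) n (length cs)} (length-encList (Q ∷ H)) (member-cost H Q) gen-cost
    (*-monoˡ-≤ (round-cost (3 * i) n) (s≤s few))
  goal : member Q H ≡ false → Goal mainE (input H Q) (answer (decide H Q)) (budget-for n i)
  goal eq with member Q H | member-run Q H | eq
  ... | false | r | refl = _ , _ , read-run (encode H Q) , _ , _ , parses-run (Q ∷ H) , _ , _ , r ,
    _ , _ , allArgs-run (Q ∷ H) , _ , _ , facts-run n Ts H (m≤n+m _ _) , _ , _ , gen , _ , _ , prop , refl , enough

-- Absorbing polynomial factors into s^s.

quarter : ∀ s → Σ ℕ λ m → m * 4 ≤ s × s ≤ 4 * 2 ^ m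
quarter 0 = 0 , z≤n , z≤n
quarter 1 = 0 , z≤n , s≤s z≤n
quarter 2 = 0 , z≤n , s≤s (s≤s z≤n)
quarter 3 = 0 , z≤n , s≤s (s≤s (s≤s z≤n))
quarter (suc (suc (suc (suc s)))) with quarter s
... | m , p , q = suc m , s≤s (s≤s (s≤s (s≤s p))) ,
  ≤-trans (+-mono-≤ (*-monoʳ-≤ 4 (m^n>0 2 m)) q) (≤-reflexive (double (2 ^ m)))
  where
  double : ∀ x → 4 * x + 4 * x ≡ 4 * (2 * x)
  double = solve-∀

-- With m the quotient of s by 4, s is at most 4 * 2^m; the fourth power of this is 4^4 * 2^(4m).
fourth-power-≤ : ∀ s → s ^ 4 ≤ 256 * 2 ^ s
fourth-power-≤ s with quarter s
... | m , p , q = ≤-trans (^-monoˡ-≤ 4 q) (≤-trans (≤-reflexive (trans (expand (2 ^ m)) (cong (256 *_) (^-*-assoc 2 m 4))))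
  (*-monoʳ-≤ 256 (^-monoʳ-≤ 2 p)))
  where
  expand : ∀ x → (4 * x) * ((4 * x) * ((4 * x) * ((4 * x) * 1))) ≡ 256 * (x * (x * (x * (x * 1))))
  expand = solve-∀

^-distribʳ-* : ∀ e m n → (m * n) ^ e ≡ m ^ e * n ^ e
^-distribʳ-* zero    m n = refl
^-distribʳ-* (suc e) m n = trans (cong (m * n *_) (^-distribʳ-* e m n)) (shuffle m n (m ^ e) (n ^ e))
  where
  shuffle : ∀ a b c d → a * b * (c * d) ≡ a * c * (b * d)
  shuffle = solve-∀

-- The exponents balance: either τ ≤ s/2 and the factor 2^s absorbs s⁴, or e < s/2.
self-power-≤ : ∀ {c} → 256 ≤ c → 7 ^ 7 ≤ c → ∀ s τ e → 1 ≤ τ → τ + e ≤ s → s ^ 4 * τ ^ e ≤ c * s ^ s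
self-power-≤ {c} c₁ c₂ s τ e 1≤τ le with 2 * τ ≤? s
... | yes small = ≤-trans
  (*-mono-≤ (fourth-power-≤ s) (^-monoʳ-≤ τ {{>-nonZero 1≤τ}} (≤-trans (m≤n+m e τ) le)))
  (≤-trans (≤-reflexive (trans (*-assoc 256 (2 ^ s) (τ ^ s)) (cong (256 *_) (sym (^-distribʳ-* s 2 τ)))))
    (*-mono-≤ c₁ (^-monoˡ-≤ s small)))
... | no big = ≤-trans (*-monoʳ-≤ (s ^ 4) (^-monoˡ-≤ e τ≤s))
  (≤-trans (≤-reflexive (sym (^-distribˡ-+-* s 4 e))) final)
  where
  τ≤s : τ ≤ s
  τ≤s = ≤-trans (m≤m+n τ e) le
  1≤s : 1 ≤ s
  1≤s = ≤-trans 1≤τ τ≤s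
  s<2τ : s < 2 * τ
  s<2τ = ≰⇒> big
  e<τ : e < τ
  e<τ = +-cancelˡ-< τ e τ (≤-<-trans le (≤-trans s<2τ (≤-reflexive (cong (τ +_) (+-identityʳ τ)))))
  e+e<s : e + e < s
  e+e<s = ≤-trans (+-monoˡ-< e e<τ) le
  final : s ^ (4 + e) ≤ c * s ^ s
  final with 4 + e ≤? s
  ... | yes p = ≤-trans (^-monoʳ-≤ s {{>-nonZero 1≤s}} p)
                  (≤-trans (≤-reflexive (sym (*-identityˡ (s ^ s)))) (*-monoˡ-≤ (s ^ s) (≤-trans (s≤s z≤n) c₁)))
  -- Here 2e < s < 4 + e, which forces e ≤ 3 and s ≤ 7. The finitely many cases are covered by the
  -- constant 7^7.
  ... | no p = ≤-trans (^-monoˡ-≤ (4 + e) s≤7) (≤-trans (^-monoʳ-≤ 7 (+-monoʳ-≤ 4 e≤3))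
                 (≤-trans c₂ (≤-trans (≤-reflexive (sym (*-identityʳ c)))
                   (*-monoʳ-≤ c (m^n>0 s {{>-nonZero 1≤s}} s)))))
    where
    e<4 : e < 4
    e<4 = +-cancelʳ-< e e 4 (<-trans e+e<s (≰⇒> p))
    e≤3 : e ≤ 3
    e≤3 = ≤-pred e<4
    s≤7 : s ≤ 7
    s≤7 = ≤-pred (≤-trans (≰⇒> p) (+-monoʳ-≤ 4 (≤-trans e≤3 (n≤1+n 3))))

-- Lengths, terms and quantifiers of the instance.

total-sum : ∀ As → total As ≡ sum (map len As)
total-sum [] = refl
total-sum (A ∷ As) = cong (len A +_) (total-sum As)

quantTotal : List Formula → ℕ
quantTotal As = sum (map quants As)

deduplicate-unique : ∀ {As} → Unique As → deduplicate _≟F_ As ≡ As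
deduplicate-unique [] = refl
deduplicate-unique {A ∷ As} (ne ∷ u) rewrite deduplicate-unique u = cong (A ∷_) (filter-all _ ne)

total-filter : ∀ Q {As} → Unique As → total As ≤ len Q + total (filter (λ A → ¬? (Q ≟F A)) As)
total-filter Q [] = z≤n
total-filter Q {A ∷ As} (ne ∷ u) with Q ≟F A
... | yes refl = ≤-reflexive (cong (λ Bs → len Q + total Bs) (sym (filter-all (λ A → ¬? (Q ≟F A)) ne)))
... | no _ = ≤-trans (+-monoʳ-≤ (len A) (total-filter Q u)) (≤-reflexive (swap (len A) (len Q) _))
  where
  swap : ∀ a q s → a + (q + s) ≡ q + (a + s)
  swap = solve-∀

-- If Q is a hypothesis, the total counts it twice and the size once; `Unique H` excludes further
-- repetitions.
total≤2size : ∀ {H} Q → Unique H → total (Q ∷ H) ≤ 2 * size H Q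
total≤2size {H} Q u rewrite sym (total-sum (setS H Q)) | deduplicate-unique u =
  ≤-trans (+-mono-≤ (m≤m+n (len Q) _) (total-filter Q u)) (≤-reflexive (cong (s +_) (sym (+-identityʳ s))))
  where
  s = len Q + total (filter (λ A → ¬? (Q ≟F A)) H)

setS-∉ : ∀ {H Q} → Unique H → Q ∉ H → setS H Q ≡ Q ∷ H
setS-∉ u ni = deduplicate-unique (tabulate (λ { i refl → ni i }) ∷ u)

-- A leaf has one symbol besides its arguments, and a quantifier adds exactly two. In `terms-room`
-- the surplus of 1 at the goal pays for the additional constant.
terms-len : ∀ A → suc (length (args A) + 2 * quants A) ≤ len A
terms-len-bin : ∀ A B → suc (length (args A ++ args B) + 2 * (quants A + quants B)) ≤ suc (len A + len B)
terms-len-bin A B rewrite length-++ (args A) {args B} = s≤s (≤-trans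
  (≤-trans (slack 2 (arith (length (args A)) (length (args B)) (quants A) (quants B))) ≤-refl)
  (+-mono-≤ (terms-len A) (terms-len B)))
  where
  arith : ∀ a b q r → (a + b + 2 * (q + r)) + 2 ≡ suc (a + 2 * q) + suc (b + 2 * r)
  arith = solve-∀
terms-len TOP = ≤-refl
terms-len BOT = ≤-refl
terms-len (atom r ts) = s≤s (≤-reflexive (+-identityʳ _))
terms-len (and A B) = terms-len-bin A B
terms-len (or A B)  = terms-len-bin A B
terms-len (imp A B) = terms-len-bin A B
terms-len (all x A) = ≤-trans (≤-reflexive (arith (length (args A)) (quants A))) (+-monoʳ-≤ 2 (terms-len A))
  where
  arith : ∀ a q → suc (a + 2 * suc q) ≡ 2 + suc (a + 2 * q)
  arith = solve-∀
terms-len (ex x A) = ≤-trans (≤-reflexive (arith (length (args A)) (quants A))) (+-monoʳ-≤ 2 (terms-len A))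
  where
  arith : ∀ a q → suc (a + 2 * suc q) ≡ 2 + suc (a + 2 * q)
  arith = solve-∀

terms-total : ∀ As → length (allArgs As) + 2 * quantTotal As ≤ total As
terms-total [] = z≤n
terms-total (A ∷ As) rewrite length-++ (args A) {allArgs As} = ≤-trans
  (≤-reflexive (arith (length (args A)) (length (allArgs As)) (quants A) (quantTotal As)))
  (+-mono-≤ (<⇒≤ (terms-len A)) (terms-total As))
  where
  arith : ∀ a b q r → a + b + 2 * (q + r) ≡ (a + 2 * q) + (b + 2 * r)
  arith = solve-∀

terms-room : ∀ H Q → length (termsOf H Q) + 2 * quantTotal (Q ∷ H) ≤ total (Q ∷ H)
terms-room H Q rewrite length-++ (args Q) {allArgs H} = ≤-trans
  (≤-reflexive (arith (length (args Q)) (length (allArgs H)) (quants Q) (quantTotal H)))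
  (+-mono-≤ (terms-len Q) (terms-total H))
  where
  arith : ∀ a b q r → suc (a + b) + 2 * (q + r) ≡ suc (a + 2 * q) + (b + 2 * r)
  arith = solve-∀

-- Bounds on the instances and the running time.

module _ (τ : ℕ) (1≤τ : 1 ≤ τ) where

  power-mono : ∀ {p q} → p ≤ q → τ ^ p ≤ τ ^ q
  power-mono = ^-monoʳ-≤ τ {{>-nonZero 1≤τ}}

  1≤power : ∀ q → 1 ≤ τ ^ q
  1≤power q = m^n>0 τ {{>-nonZero 1≤τ}} q

  -- The additional `suc` makes the induction work: the two successors at a binary node are those of
  -- its two induction hypotheses.
  inst-≤ : ∀ A → suc (inst τ A) ≤ 2 * (len A * τ ^ quants A)

  inst-bin : ∀ A B → suc (suc (inst τ A + inst τ B)) ≤ 2 * (suc (len A + len B) * τ ^ (quants A + quants B))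
  inst-bin A B = ≤-trans (≤-reflexive (sym (cong suc (+-suc (inst τ A) (inst τ B)))))
    (≤-trans (+-mono-≤ (≤-trans (inst-≤ A) (*-monoʳ-≤ 2 (*-monoʳ-≤ (len A) (power-mono (m≤m+n (quants A) (quants B))))))
                       (≤-trans (inst-≤ B) (*-monoʳ-≤ 2 (*-monoʳ-≤ (len B) (power-mono (m≤n+m (quants B) (quants A)))))))
             (slack (2 * τ ^ (quants A + quants B)) (arith (len A) (len B) (τ ^ (quants A + quants B)))))
    where
    arith : ∀ a b p → (2 * (a * p) + 2 * (b * p)) + 2 * p ≡ 2 * (suc (a + b) * p)
    arith = solve-∀

  inst-quant : ∀ A → suc (2 + τ * suc (inst τ A)) ≤ 2 * ((2 + len A) * (τ * τ ^ quants A))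
  inst-quant A = ≤-trans (+-mono-≤ (*-monoʳ-≤ 3 (1≤power (suc (quants A)))) (*-monoʳ-≤ τ (inst-≤ A)))
    (slack (τ * τ ^ quants A) (arith (len A) τ (τ ^ quants A)))
    where
    arith : ∀ l t p → (3 * (t * p) + t * (2 * (l * p))) + t * p ≡ 2 * ((2 + l) * (t * p))
    arith = solve-∀

  inst-≤ TOP = ≤-refl
  inst-≤ BOT = ≤-refl
  inst-≤ (atom r ts) = *-monoʳ-≤ 2 (s≤s z≤n)
  inst-≤ (and A B) = inst-bin A B
  inst-≤ (or A B)  = inst-bin A B
  inst-≤ (imp A B) = inst-bin A B
  inst-≤ (all x A) = inst-quant A
  inst-≤ (ex x A)  = inst-quant A

  insts-≤ : ∀ As → insts τ As ≤ 2 * (total As * τ ^ quantTotal As)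
  insts-≤ [] = z≤n
  insts-≤ (A ∷ As) = ≤-trans
    (+-mono-≤ (≤-trans (inst-≤ A) (*-monoʳ-≤ 2 (*-monoʳ-≤ (len A) (power-mono (m≤m+n (quants A) (quantTotal As))))))
              (≤-trans (insts-≤ As) (*-monoʳ-≤ 2 (*-monoʳ-≤ (total As) (power-mono (m≤n+m (quantTotal As) (quants A)))))))
    (≤-reflexive (arith (len A) (total As) (τ ^ (quants A + quantTotal As))))
    where
    arith : ∀ a b p → 2 * (a * p) + 2 * (b * p) ≡ 2 * ((a + b) * p)
    arith = solve-∀

-- Written in the predecessors of n and i, the difference of the two sides is the polynomial given
-- as slack, whose coefficients are all natural numbers. At n = i = 1 the budget is 178.
budget-≤ : ∀ n i → 1 ≤ n → 1 ≤ i → budget-for n i ≤ 200 * (n * n * (i * i))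
budget-≤ (suc n) (suc i) _ _ =
  slack (22 + 146 * i + 101 * (i * i) + 298 * n + 660 * (n * i) + 346 * (n * (i * i)) + 196 * (n * n) + 398 * (n * n * i) + 200 * (n * n * (i * i)))
    (arith n i)
  where
  arith : ∀ n i →
    (6 + 9 * suc n + suc n * suc (2 * suc n) + ((2 + 2 * suc n + 2 * (suc n * suc (suc n))) * suc i +
      suc (3 * suc i) * (1 + (suc (3 * suc i) + (2 * suc n + suc (3 * suc i * (4 + 6 * suc n)))))))
    + (22 + 146 * i + 101 * (i * i) + 298 * n + 660 * (n * i) + 346 * (n * (i * i)) + 196 * (n * n) + 398 * (n * n * i) + 200 * (n * n * (i * i)))
    ≡ 200 * (suc n * suc n * (suc i * suc i))
  arith = solve-∀

budget-mono : ∀ n {i j} → i ≤ j → budget-for n i ≤ budget-for n j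
budget-mono n {i} {j} le = +-monoʳ-≤ (6 + 9 * n + n * suc (2 * n)) (+-mono-≤ (*-monoʳ-≤ (unit n) le)
  (*-mono-≤ (s≤s 3le) (s≤s (+-mono-≤ (s≤s 3le) (+-monoʳ-≤ (2 * n) (reduce-cost-mono n 3le))))))
  where
  3le : 3 * i ≤ 3 * j
  3le = *-monoʳ-≤ 3 le

-- A common form for both branches of the membership test, with e = 2q if clauses are generated and
-- τ = 1, e = 0 if Q is a hypothesis. The constant 800 is the 200 of `budget-≤` times 4, from the
-- square of 2 n τ^q in the first case and from that of 2s in the second.
record Cheap (B : Expr) (H : List Formula) (Q : Formula) : Set where
  field
    τ e cost : ℕ
    runs  : Run B (input H Q) (answer (decide H Q)) cost
    1≤τ   : 1 ≤ τ
    room  : τ + e ≤ size H Q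
    few   : e ≤ 2 * quantsS H Q
    small : cost ≤ 800 * (size H Q ^ 4 * τ ^ e)

1≤size : ∀ H Q → 1 ≤ size H Q
1≤size H Q = ≤-trans (positive Q) (m≤m+n (len Q) _)

square-≤ : ∀ s → 1 ≤ s → s * s ≤ s ^ 4
square-≤ s p =
  ≤-trans (≤-reflexive (sym (trans (*-identityʳ _) refl))) (≤-trans (*-monoʳ-≤ (s * s) (*-mono-≤ p p)) (≤-reflexive (arith s)))
  where
  arith : ∀ s → s * s * (s * s) ≡ s * (s * (s * (s * 1)))
  arith = solve-∀

cheap-∈ : ∀ H Q → Unique H → member Q H ≡ true → Cheap mainE H Q
cheap-∈ H Q u m = record
  { τ = 1 ; e = 0 ; runs = main-run-∈ H Q m ; 1≤τ = ≤-refl ; room = 1≤size H Q ; few = z≤n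
  ; small = ≤-trans (budget-mono n {0} {1} z≤n) (≤-trans (budget-≤ n 1 (≤-trans (positive Q) (m≤m+n _ _)) ≤-refl)
      (≤-trans (*-monoʳ-≤ 200 (*-monoˡ-≤ 1 (*-mono-≤ n≤2s n≤2s))) (≤-trans (≤-reflexive (arith s))
        (*-monoʳ-≤ 800 (*-monoˡ-≤ 1 (square-≤ s (1≤size H Q))))))) }
  where
  n = total (Q ∷ H)
  s = size H Q
  n≤2s : n ≤ 2 * s
  n≤2s = total≤2size Q u
  arith : ∀ s → 200 * ((2 * s) * (2 * s) * 1) ≡ 800 * (s * s * 1)
  arith = solve-∀

cheap-∉ : ∀ H Q → Unique H → member Q H ≡ false → Cheap mainE H Q
cheap-∉ H Q u m = record
  { τ = τ ; e = 2 * q ; runs = main-run-∉ H Q m ; 1≤τ = s≤s z≤n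
  ; room = ≤-trans (terms-room H Q) (≤-reflexive n≡s) ; few = ≤-reflexive (cong (2 *_) q≡)
  ; small = ≤-trans (budget-≤ n i (≤-trans (positive Q) (m≤m+n _ _)) (s≤s z≤n))
      (≤-trans (*-monoʳ-≤ 200 (*-monoʳ-≤ (n * n) (*-mono-≤ i≤ i≤)))
        (≤-trans (≤-reflexive (trans (arith n (τ ^ q)) (cong (λ p → 800 * (n ^ 4 * p)) power)))
          (≤-reflexive (cong (λ n → 800 * (n ^ 4 * τ ^ (2 * q))) n≡s)))) }
  where
  ni : Q ∉ H
  ni j with trans (sym m) (member-complete Q H j)
  ... | ()
  n = total (Q ∷ H)
  τ = length (termsOf H Q)
  q = quantTotal (Q ∷ H)
  i = insts τ (Q ∷ H)
  i≤ : i ≤ 2 * (n * τ ^ q)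
  i≤ = insts-≤ τ (s≤s z≤n) (Q ∷ H)
  n≡s : n ≡ size H Q
  n≡s = trans (total-sum (Q ∷ H)) (cong (λ As → sum (map len As)) (sym (setS-∉ u ni)))
  q≡ : q ≡ quantsS H Q
  q≡ = cong quantTotal (sym (setS-∉ u ni))
  arith : ∀ n p → 200 * (n * n * ((2 * (n * p)) * (2 * (n * p)))) ≡ 800 * (n * (n * (n * (n * 1))) * (p * p))
  arith = solve-∀
  power : τ ^ q * τ ^ q ≡ τ ^ (2 * q)
  power = trans (sym (^-distribˡ-+-* τ q q)) (cong (λ r → τ ^ (q + r)) (sym (+-identityʳ q)))

cheap : ∀ H Q → Unique H → Cheap mainE H Q
cheap H Q u = by-member (member Q H) refl
  where
  by-member : ∀ b → member Q H ≡ b → Cheap mainE H Q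
  by-member true  m = cheap-∈ H Q u m
  by-member false m = cheap-∉ H Q u m

answer-num : ∀ b → Σ ℕ λ k → answer b ≡ num k × (b ≡ true → k ≡ 1) × (k ≡ 1 → b ≡ true)
answer-num true  = 1 , refl , (λ _ → refl) , (λ _ → refl)
answer-num false = 0 , refl , (λ ()) , (λ ())

-- 100 = 34 + 66: a fixed overhead of 34 steps, and 11 steps for loading each of the at most 6s
-- tokens. The at most 800 s^4 τ^e calls cost M each.
step-constant : ℕ → ℕ
step-constant M = 100 + M * 800

total-steps : ∀ {M x w c s} → 1 ≤ s → s ≤ x → w ≤ 6 * s → c ≤ 800 * x →
  (((22 + (2 + 11 * w)) + 2) + (7 + M * c)) + 1 ≤ step-constant M * x
total-steps {M} {x} {w} {c} {s} p q r t = ≤-trans (≤-reflexive (shape₁ w (M * c)))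
  (≤-trans (+-mono-≤ (+-mono-≤ (*-monoʳ-≤ 34 (≤-trans p q)) (*-monoʳ-≤ 11 (≤-trans r (*-monoʳ-≤ 6 q)))) (*-monoʳ-≤ M t))
    (≤-reflexive (shape₂ M x)))
  where
  shape₁ : ∀ w c → (((22 + (2 + 11 * w)) + 2) + (7 + c)) + 1 ≡ 34 * 1 + 11 * w + c
  shape₁ = solve-∀
  shape₂ : ∀ M x → 34 * x + 11 * (6 * x) + M * (800 * x) ≡ (100 + M * 800) * x
  shape₂ = solve-∀

nonempty : ∀ H Q → 1 ≤ length (encode H Q)
nonempty H Q = ≤-trans (m≤n+m 1 (length (encF Q) + length (encList H)))
  (≤-reflexive (trans (arith (length (encF Q)) (length (encList H))) (sym (length-++ (encF Q)))))
  where
  arith : ∀ a b → (a + b) + 1 ≡ a + suc b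
  arith = solve-∀

conclude : ∀ {P : Program} {w k X T} {D : Set} →
  (Σ Memory λ m → (∀ {T} → X ≤ T → exec P T 0 (initMem w) ≡ just m) × m 0 ≡ k) → X ≤ T → (D → k ≡ 1) → (k ≡ 1 → D) →
  Σ Memory λ m → exec P T 0 (initMem w) ≡ just m × (D → m 0 ≡ 1) × (m 0 ≡ 1 → D)
conclude (m , halts , refl) le to from = m , halts le , to , from

cheap-steps : ∀ {B H Q} M → Unique H → (c : Cheap B H Q) →
  (((22 + (2 + 11 * length (encode H Q))) + 2) + (7 + M * Cheap.cost c)) + 1
    ≤ step-constant M * (size H Q ^ 4 * Cheap.τ c ^ Cheap.e c)
cheap-steps {B} {H} {Q} M u c = total-steps {M} {s ^ 4 * τ ^ e} 1≤s x≥s w≤6s small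
  where
  open Cheap c
  s = size H Q
  1≤s = 1≤size H Q
  x≥s : s ≤ s ^ 4 * τ ^ e
  x≥s = ≤-trans (≤-trans (≤-reflexive (sym (*-identityʳ s))) (≤-trans (*-monoʳ-≤ s 1≤s) (square-≤ s 1≤s)))
    (≤-trans (≤-reflexive (sym (*-identityʳ _))) (*-monoʳ-≤ (s ^ 4) (m^n>0 τ {{>-nonZero 1≤τ}} e)))
  w≤6s : length (encode H Q) ≤ 6 * s
  w≤6s = ≤-trans (length-encList (Q ∷ H)) (≤-trans (*-monoʳ-≤ 3 (total≤2size Q u)) (≤-reflexive (arith s)))
    where
    arith : ∀ s → 3 * (2 * s) ≡ 6 * s
    arith = solve-∀

-- Both parts of the theorem concern one program and differ only in how `s ^ 4 * τ ^ e` is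
-- estimated, so the time bound T is left open here.
Solver : Program → ℕ → Set₁
Solver P K = ∀ Inst (T : ℕ → ℕ) →
  (∀ H Q → Inst H Q → ∀ τ e → 1 ≤ τ → τ + e ≤ size H Q → e ≤ 2 * quantsS H Q →
    K * (size H Q ^ 4 * τ ^ e) ≤ T (size H Q)) →
  SolvesWithin Inst P T

solves : ∀ B → (∀ H Q → Unique H → Cheap B H Q) → Solver (machine B) (step-constant (call-cost B))
solves B cheap Inst T h H Q u ins = conclude
  (machine-halts B (encode H Q) (nonempty H Q) (transport (λ v → Run B (input H Q) v cost) (proj₁ (proj₂ ans)) runs))
  (≤-trans (cheap-steps (call-cost B) u c) (h H Q ins τ e 1≤τ room few))
  (λ d → proj₁ (proj₂ (proj₂ ans)) (decide-complete H Q d))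
  (λ z → decide-sound H Q (proj₂ (proj₂ (proj₂ ans)) z))
  where
  c = cheap H Q u
  open Cheap c
  ans = answer-num (decide H Q)

scaled : ∀ K {c x y} → x ≤ c * y → K * x ≤ (K * c) * y + K * c
scaled K {c} {x} {y} le = ≤-trans (*-monoʳ-≤ K le) (≤-trans (≤-reflexive (sym (*-assoc K c y))) (m≤m+n _ (K * c)))

constants : ∀ a b → Σ ℕ λ c → a ≤ c × b ≤ c
constants a b = a + b , m≤m+n a b , m≤n+m b a

poly-≤ : ∀ k s τ e → 1 ≤ τ → τ + e ≤ s → e ≤ 2 * k → s ^ 4 * τ ^ e ≤ 1 * s ^ (4 + 2 * k)
poly-≤ k s τ e 1≤τ room le =
  ≤-trans (*-monoʳ-≤ (s ^ 4) (≤-trans (^-monoˡ-≤ e τ≤s) (^-monoʳ-≤ s {{>-nonZero (≤-trans 1≤τ τ≤s)}} le)))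
    (≤-reflexive (trans (sym (^-distribˡ-+-* s 4 (2 * k))) (sym (*-identityˡ _))))
  where
  τ≤s : τ ≤ s
  τ≤s = ≤-trans (m≤m+n τ e) room

solves-exponential : ∀ {P K} → Solver P K → ∀ c → 256 ≤ c → 7 ^ 7 ≤ c →
  SolvesWithin AnyInstance P (λ n → (K * c) * n ^ n + K * c)
solves-exponential {P} {K} solver c c₁ c₂ = solver AnyInstance (λ n → (K * c) * n ^ n + K * c) λ H Q _ τ e 1≤τ room _ →
  scaled K {c} {size H Q ^ 4 * τ ^ e} {size H Q ^ size H Q} (self-power-≤ c₁ c₂ (size H Q) τ e 1≤τ room)

solves-polynomial : ∀ {P K} → Solver P K → ∀ k →
  SolvesWithin (BoundedQuants k) P (λ n → (K * 1) * n ^ (4 + 2 * k) + K * 1)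
solves-polynomial {P} {K} solver k = solver (BoundedQuants k) (λ n → (K * 1) * n ^ (4 + 2 * k) + K * 1) λ H Q q≤k τ e 1≤τ room few →
  scaled K {1} {size H Q ^ 4 * τ ^ e} {size H Q ^ (4 + 2 * k)} (poly-≤ k (size H Q) τ e 1≤τ room (≤-trans few (*-monoʳ-≤ 2 q≤k)))

-- Stated for a variable program, because evaluating the compiled one is infeasible.
conclusion : ∀ {P K} → Solver P K → (Σ ℕ λ c → 256 ≤ c × 7 ^ 7 ≤ c) →
  Σ Program (λ P → Σ ℕ λ c → SolvesWithin AnyInstance P (λ n → c * n ^ n + c))
  × ((k : ℕ) → Σ Program λ P → Σ ℕ λ c → Σ ℕ λ d → SolvesWithin (BoundedQuants k) P (λ n → c * n ^ d + c))
conclusion {P} {K} solver (c , c₁ , c₂) =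
  (P , K * c , solves-exponential {P} {K} solver c c₁ c₂) ,
  λ k → P , K * 1 , 4 + 2 * k , solves-polynomial {P} {K} solver k

theorem8p2 : Σ Program (λ P → Σ ℕ λ c →
    SolvesWithin AnyInstance P (λ n → c * n ^ n + c))
    × ((k : ℕ) → Σ Program λ P → Σ ℕ λ c → Σ ℕ λ d →
    SolvesWithin (BoundedQuants k) P (λ n → c * n ^ d + c))
theorem8p2 = conclusion {machine mainE} {step-constant (call-cost mainE)} (solves mainE cheap) (constants 256 (7 ^ 7))
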